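{- For each integer $d \geq 3$, there exist a $(d+1)$-dimensional polytope $P \subset \mathbb{R}^{d+1}$ with $(2d+1)(d+1)+1$ facets and a linear objective function $\mathbf{w} \in \mathbb{R}^{d+1}$ such that for every $\mathbf{c} \in \mathbb{R}^{d+1}$ linearly independent from $\mathbf{w}$, the parametric optimization problem of maximizing $(\mathbf{w}+\lambda \mathbf{c})^{\top}\mathbf{x}$ over $\mathbf{x} \in P$, for $\lambda \in \mathbb{R}$, has at least $2^{d-1}$ solutions.
   Context: In (one-parameter) parametric linear optimization, $\mathbf{w}$ and $\mathbf{c}$ are fixed and one seeks the set of all optima of the objectives $\mathbf{w}+\lambda\mathbf{c}$ as $\lambda$ ranges over all of $\mathbb{R}$. A vertex $\mathbf{v}$ of $P$ is counted as a solution of the parametric problem if and only if the line $\{\mathbf{w}+\lambda\mathbf{c} : \lambda \in \mathbb{R}\}$ intersects the normal cone of $\mathbf{v}$, i.e. $\mathbf{v}$ maximizes $(\mathbf{w}+\lambda\mathbf{c})^{\top}\mathbf{x}$ over $P$ for some $\lambda \in \mathbb{R}$. -}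

module Defs where

open import Data.Fin.Base using (Fin)
open import Data.Nat.Base as ℕ using (ℕ; _⊔_)
import Data.Nat.Properties as ℕ
open import Data.Product.Base using (Σ; ∃; _×_; _,_; proj₁; proj₂)
open import Data.Rational.Base as ℚ using (ℚ; 0ℚ; 1ℚ; ½; ∣_∣; positive)
import Data.Rational.Properties as ℚ
open import Data.Rational.Solver using (module +-*-Solver)
open import Data.Vec.Functional using (Vector; foldr; map; zipWith)
import Data.Vec.Functional.Relation.Binary.Equality.Setoid as VecEq
open import Function.Bundles using (Bijection; Injection)
open import Level using (0ℓ)
open import Relation.Binary.Bundles using (Setoid)
import Relation.Binary.Construct.On as On
open import Relation.Binary.PropositionalEquality as ≡ using (_≡_; refl; cong; subst)
open import Relation.Unary using (Pred; _∈_; _⊆_)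
open import Relation.Unary.Relation.Binary.Equality using (≐-setoid)

private
  halves : ∀ ε → ½ ℚ.* ε ℚ.+ ½ ℚ.* ε ≡ ε
  halves ε = ≡.trans (≡.sym (ℚ.*-distribʳ-+ ε ½ ½)) (ℚ.*-identityˡ ε)

  half-pos : ∀ {ε} → 0ℚ ℚ.< ε → 0ℚ ℚ.< ½ ℚ.* ε
  half-pos {ε} 0<ε = subst (ℚ._< ½ ℚ.* ε) (ℚ.*-zeroʳ ½) (ℚ.*-monoʳ-<-pos ½ 0<ε)

  ∣0∣<ε : ∀ {p ε} → p ≡ 0ℚ → 0ℚ ℚ.< ε → ∣ p ∣ ℚ.< ε
  ∣0∣<ε refl 0<ε = 0<ε

  split : ∀ p q r ε → p ≡ q ℚ.+ r →
          ∣ q ∣ ℚ.< ½ ℚ.* ε → ∣ r ∣ ℚ.< ½ ℚ.* ε → ∣ p ∣ ℚ.< ε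
  split _ q r ε refl hq hr = ℚ.≤-<-trans (ℚ.∣p+q∣≤∣p∣+∣q∣ q r)
    (subst (∣ q ∣ ℚ.+ ∣ r ∣ ℚ.<_) (halves ε) (ℚ.+-mono-< hq hr))

  module _ where
    open +-*-Solver

    neg-diff : ∀ p q → ℚ.- (p ℚ.- q) ≡ q ℚ.- p
    neg-diff = solve 2 (λ p q → :- (p :- q) := q :- p) refl

    diff-neg : ∀ p q → q ℚ.- p ≡ ℚ.- p ℚ.- ℚ.- q
    diff-neg = solve 2 (λ p q → q :- p := :- p :- :- q) refl

    diff-via : ∀ p q r → p ℚ.- r ≡ (p ℚ.- q) ℚ.+ (q ℚ.- r)
    diff-via = solve 3 (λ p q r → p :- r := (p :- q) :+ (q :- r)) refl

    diff-cancel : ∀ p q → (p ℚ.- q) ℚ.+ q ≡ p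
    diff-cancel = solve 2 (λ p q → (p :- q) :+ q := p) refl

    diff-+ : ∀ p q r s → (p ℚ.+ q) ℚ.- (r ℚ.+ s) ≡ (p ℚ.- r) ℚ.+ (q ℚ.- s)
    diff-+ = solve 4 (λ p q r s → (p :+ q) :- (r :+ s) := (p :- r) :+ (q :- s)) refl

    diff-* : ∀ p q r s → p ℚ.* q ℚ.- r ℚ.* s ≡ p ℚ.* (q ℚ.- s) ℚ.+ s ℚ.* (p ℚ.- r)
    diff-* = solve 4 (λ p q r s → p :* q :- r :* s := p :* (q :- s) :+ s :* (p :- r)) refl

  ∣-∣-sym : ∀ p q → ∣ p ℚ.- q ∣ ≡ ∣ q ℚ.- p ∣
  ∣-∣-sym p q = ≡.trans (≡.sym (ℚ.∣-p∣≡∣p∣ (p ℚ.- q))) (cong ∣_∣ (neg-diff p q))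

-- The real numbers, as the setoid of Cauchy sequences of rationals
--
-- The relations and operations are opaque only to keep the rational arithmetic
-- from being normalised; "opaque unfolding" recovers their definitions.

IsCauchy : (ℕ → ℚ) → Set
IsCauchy s = ∀ ε → 0ℚ ℚ.< ε →
  ∃ λ N → ∀ m n → N ℕ.≤ m → N ℕ.≤ n → ∣ s m ℚ.- s n ∣ ℚ.< ε

record ℝ : Set where
  constructor mkℝ
  field
    seq    : ℕ → ℚ
    cauchy : IsCauchy seq

open ℝ public

infix 4 _≈_ _≤_

opaque
  _≈_ : ℝ → ℝ → Set
  x ≈ y = ∀ ε → 0ℚ ℚ.< ε → ∃ λ N → ∀ n → N ℕ.≤ n → ∣ seq x n ℚ.- seq y n ∣ ℚ.< ε

  _≤_ : ℝ → ℝ → Set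
  x ≤ y = ∀ ε → 0ℚ ℚ.< ε → ∃ λ N → ∀ n → N ℕ.≤ n → seq x n ℚ.< seq y n ℚ.+ ε

  ≈-refl : ∀ {x} → x ≈ x
  ≈-refl {x} ε 0<ε = 0 , λ n _ → ∣0∣<ε (ℚ.+-inverseʳ (seq x n)) 0<ε

  ≈-sym : ∀ {x y} → x ≈ y → y ≈ x
  ≈-sym {x} {y} x≈y ε 0<ε with N , h ← x≈y ε 0<ε =
    N , λ n N≤n → subst (ℚ._< ε) (∣-∣-sym (seq x n) (seq y n)) (h n N≤n)

  ≈-trans : ∀ {x y z} → x ≈ y → y ≈ z → x ≈ z
  ≈-trans {x} {y} {z} x≈y y≈z ε 0<ε
    with M , f ← x≈y (½ ℚ.* ε) (half-pos 0<ε)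
       | N , g ← y≈z (½ ℚ.* ε) (half-pos 0<ε) =
    M ⊔ N , λ n le → split _ (seq x n ℚ.- seq y n) (seq y n ℚ.- seq z n) ε
      (diff-via (seq x n) (seq y n) (seq z n))
      (f n (ℕ.m⊔n≤o⇒m≤o M N le)) (g n (ℕ.m⊔n≤o⇒n≤o M N le))

ℝ-setoid : Setoid 0ℓ 0ℓ
ℝ-setoid = record
  { Carrier       = ℝ
  ; _≈_           = _≈_
  ; isEquivalence = record
    { refl  = ≈-refl
    ; sym   = ≈-sym
    ; trans = ≈-trans
    }
  }

fromℚ : ℚ → ℝ
fromℚ q = mkℝ (λ _ → q) λ ε 0<ε → 0 , λ _ _ _ _ → ∣0∣<ε (ℚ.+-inverseʳ q) 0<ε

0ℝ 1ℝ : ℝ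
0ℝ = fromℚ 0ℚ
1ℝ = fromℚ 1ℚ

infixl 6 _+_
infixl 7 _*_
infix  8 -_

opaque
  _+_ : ℝ → ℝ → ℝ
  x + y = mkℝ (λ n → seq x n ℚ.+ seq y n) +-cauchy
    where
    +-cauchy : IsCauchy (λ n → seq x n ℚ.+ seq y n)
    +-cauchy ε 0<ε
      with M , f ← cauchy x (½ ℚ.* ε) (half-pos 0<ε)
         | N , g ← cauchy y (½ ℚ.* ε) (half-pos 0<ε) =
      M ⊔ N , λ m n lm ln → split _ (seq x m ℚ.- seq x n) (seq y m ℚ.- seq y n) ε
        (diff-+ (seq x m) (seq y m) (seq x n) (seq y n))
        (f m n (ℕ.m⊔n≤o⇒m≤o M N lm) (ℕ.m⊔n≤o⇒m≤o M N ln))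
        (g m n (ℕ.m⊔n≤o⇒n≤o M N lm) (ℕ.m⊔n≤o⇒n≤o M N ln))

  -_ : ℝ → ℝ
  - x = mkℝ (λ n → ℚ.- seq x n) λ ε 0<ε →
    let N , h = cauchy x ε 0<ε in
    N , λ m n lm ln → subst (λ r → ∣ r ∣ ℚ.< ε)
      (diff-neg (seq x m) (seq x n)) (h n m ln lm)

private
  eventually-bounded : ∀ x → ∃ λ N → Σ ℚ λ B → 0ℚ ℚ.< B ×
                       (∀ n → N ℕ.≤ n → ∣ seq x n ∣ ℚ.≤ B)
  eventually-bounded x with N , h ← cauchy x 1ℚ (ℚ.positive⁻¹ 1ℚ) =
    N , 1ℚ ℚ.+ ∣ seq x N ∣ ,
    ℚ.+-mono-<-≤ (ℚ.positive⁻¹ 1ℚ) (ℚ.0≤∣p∣ (seq x N)) ,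
    λ n N≤n → ℚ.≤-trans
      (subst (λ r → ∣ r ∣ ℚ.≤ ∣ seq x n ℚ.- seq x N ∣ ℚ.+ ∣ seq x N ∣)
        (diff-cancel (seq x n) (seq x N))
        (ℚ.∣p+q∣≤∣p∣+∣q∣ (seq x n ℚ.- seq x N) (seq x N)))
      (ℚ.+-monoˡ-≤ ∣ seq x N ∣ (ℚ.<⇒≤ (h n N N≤n ℕ.≤-refl)))

  shrink : ∀ B ε → 0ℚ ℚ.< B → 0ℚ ℚ.< ε → Σ ℚ λ δ → 0ℚ ℚ.< δ ×
           (∀ p q → ∣ p ∣ ℚ.≤ B → ∣ q ∣ ℚ.< δ → ∣ p ℚ.* q ∣ ℚ.< ε)
  shrink B ε 0<B 0<ε = δ , 0<δ , bound
    where
    instance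
      B-pos : ℚ.Positive B
      B-pos = positive 0<B
      B-nz : ℚ.NonZero B
      B-nz = ℚ.pos⇒nonZero B
      B⁻¹-pos : ℚ.Positive (ℚ.1/ B)
      B⁻¹-pos = ℚ.1/pos⇒pos B
    δ : ℚ
    δ = ℚ.1/ B ℚ.* ε
    0<δ : 0ℚ ℚ.< δ
    0<δ = subst (ℚ._< δ) (ℚ.*-zeroʳ (ℚ.1/ B)) (ℚ.*-monoʳ-<-pos (ℚ.1/ B) 0<ε)
    Bδ≡ε : B ℚ.* δ ≡ ε
    Bδ≡ε = ≡.trans (≡.sym (ℚ.*-assoc B (ℚ.1/ B) ε))
             (≡.trans (cong (ℚ._* ε) (ℚ.*-inverseʳ B)) (ℚ.*-identityˡ ε))
    bound : ∀ p q → ∣ p ∣ ℚ.≤ B → ∣ q ∣ ℚ.< δ → ∣ p ℚ.* q ∣ ℚ.< ε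
    bound p q hp hq = subst (ℚ._< ε) (≡.sym (ℚ.∣p*q∣≡∣p∣*∣q∣ p q))
      (ℚ.≤-<-trans (ℚ.*-monoʳ-≤-nonNeg ∣ q ∣ {{ℚ.∣-∣-nonNeg q}} hp)
        (subst (B ℚ.* ∣ q ∣ ℚ.<_) Bδ≡ε (ℚ.*-monoʳ-<-pos B hq)))

private
  split-* : ∀ p q r s ε → ∣ p ℚ.* (q ℚ.- s) ∣ ℚ.< ½ ℚ.* ε →
            ∣ s ℚ.* (p ℚ.- r) ∣ ℚ.< ½ ℚ.* ε → ∣ p ℚ.* q ℚ.- r ℚ.* s ∣ ℚ.< ε
  split-* p q r s ε = split (p ℚ.* q ℚ.- r ℚ.* s) (p ℚ.* (q ℚ.- s)) (s ℚ.* (p ℚ.- r)) ε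
    (diff-* p q r s)

  *-close : ∀ p q r s ε B C δ η →
            (∀ p q → ∣ p ∣ ℚ.≤ B → ∣ q ∣ ℚ.< δ → ∣ p ℚ.* q ∣ ℚ.< ½ ℚ.* ε) →
            (∀ p q → ∣ p ∣ ℚ.≤ C → ∣ q ∣ ℚ.< η → ∣ p ℚ.* q ∣ ℚ.< ½ ℚ.* ε) →
            ∣ p ∣ ℚ.≤ B → ∣ s ∣ ℚ.≤ C → ∣ q ℚ.- s ∣ ℚ.< δ → ∣ p ℚ.- r ∣ ℚ.< η →
            ∣ p ℚ.* q ℚ.- r ℚ.* s ∣ ℚ.< ε
  *-close p q r s ε B C δ η hδ hη hp hs hqs hpr =
    split-* p q r s ε (hδ p (q ℚ.- s) hp hqs) (hη s (p ℚ.- r) hs hpr)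

  *-cauchy : ∀ x y → IsCauchy (λ n → seq x n ℚ.* seq y n)
  *-cauchy x y ε 0<ε = bounds (eventually-bounded x) (eventually-bounded y)
    where
    bounds : (∃ λ K → Σ ℚ λ B → 0ℚ ℚ.< B × (∀ n → K ℕ.≤ n → ∣ seq x n ∣ ℚ.≤ B)) →
             (∃ λ L → Σ ℚ λ C → 0ℚ ℚ.< C × (∀ n → L ℕ.≤ n → ∣ seq y n ∣ ℚ.≤ C)) →
             ∃ λ N → ∀ m n → N ℕ.≤ m → N ℕ.≤ n →
               ∣ seq x m ℚ.* seq y m ℚ.- seq x n ℚ.* seq y n ∣ ℚ.< ε
    bounds (K , B , 0<B , hB) (L , C , 0<C , hC) =
      tolerances (shrink B (½ ℚ.* ε) 0<B (half-pos 0<ε))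
                 (shrink C (½ ℚ.* ε) 0<C (half-pos 0<ε))
      where
      tolerances :
        (Σ ℚ λ δ → 0ℚ ℚ.< δ ×
          (∀ p q → ∣ p ∣ ℚ.≤ B → ∣ q ∣ ℚ.< δ → ∣ p ℚ.* q ∣ ℚ.< ½ ℚ.* ε)) →
        (Σ ℚ λ η → 0ℚ ℚ.< η ×
          (∀ p q → ∣ p ∣ ℚ.≤ C → ∣ q ∣ ℚ.< η → ∣ p ℚ.* q ∣ ℚ.< ½ ℚ.* ε)) →
        ∃ λ N → ∀ m n → N ℕ.≤ m → N ℕ.≤ n →
          ∣ seq x m ℚ.* seq y m ℚ.- seq x n ℚ.* seq y n ∣ ℚ.< ε
      tolerances (δ , 0<δ , hδ) (η , 0<η , hη)
        with M , f ← cauchy y δ 0<δ | N , g ← cauchy x η 0<η =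
        (K ⊔ L) ⊔ (M ⊔ N) , λ m n lm ln →
          let KLm = ℕ.m⊔n≤o⇒m≤o (K ⊔ L) (M ⊔ N) lm
              MNm = ℕ.m⊔n≤o⇒n≤o (K ⊔ L) (M ⊔ N) lm
              KLn = ℕ.m⊔n≤o⇒m≤o (K ⊔ L) (M ⊔ N) ln
              MNn = ℕ.m⊔n≤o⇒n≤o (K ⊔ L) (M ⊔ N) ln
          in *-close (seq x m) (seq y m) (seq x n) (seq y n) ε B C δ η hδ hη
               (hB m (ℕ.m⊔n≤o⇒m≤o K L KLm)) (hC n (ℕ.m⊔n≤o⇒n≤o K L KLn))
               (f m n (ℕ.m⊔n≤o⇒m≤o M N MNm) (ℕ.m⊔n≤o⇒m≤o M N MNn))
               (g m n (ℕ.m⊔n≤o⇒n≤o M N MNm) (ℕ.m⊔n≤o⇒n≤o M N MNn))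

opaque
  _*_ : ℝ → ℝ → ℝ
  x * y = mkℝ (λ n → seq x n ℚ.* seq y n) (*-cauchy x y)

infix 10 ℝ^_

ℝ^_ : ℕ → Set
ℝ^ n = Vector ℝ n

ℝ^-setoid : ℕ → Setoid 0ℓ 0ℓ
ℝ^-setoid n = VecEq.≋-setoid ℝ-setoid n

infix 4 _≋_

_≋_ : ∀ {n} → ℝ^ n → ℝ^ n → Set
_≋_ {n} = Setoid._≈_ (ℝ^-setoid n)

𝟎 : ∀ {n} → ℝ^ n
𝟎 _ = 0ℝ

infixl 6 _⊕_
infixl 7 _∙_ _·_

_⊕_ : ∀ {n} → ℝ^ n → ℝ^ n → ℝ^ n
_⊕_ = zipWith _+_

_∙_ : ∀ {n} → ℝ → ℝ^ n → ℝ^ n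
r ∙ x = map (r *_) x

sum : ∀ {n} → ℝ^ n → ℝ
sum = foldr _+_ 0ℝ

_·_ : ∀ {n} → ℝ^ n → ℝ^ n → ℝ
x · y = sum (zipWith _*_ x y)

combination : ∀ {k n} → ℝ^ k → Vector (ℝ^ n) k → ℝ^ n
combination t v = foldr _⊕_ 𝟎 (zipWith _∙_ t v)

LinearlyIndependent : ∀ {k n} → Vector (ℝ^ n) k → Set
LinearlyIndependent v = ∀ t → combination t v ≋ 𝟎 → t ≋ 𝟎

AffinelyIndependent : ∀ {k n} → Vector (ℝ^ n) k → Set
AffinelyIndependent p = ∀ t → sum t ≈ 0ℝ → combination t p ≋ 𝟎 → t ≋ 𝟎

AffineHull : ∀ {k n} → Vector (ℝ^ n) k → Pred (ℝ^ n) 0ℓ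
AffineHull p x = ∃ λ t → sum t ≈ 1ℝ × combination t p ≋ x

-- S has an affine basis of k + 1 points, i.e. its affine hull has dimension k.
HasDimension : ∀ {n} → Pred (ℝ^ n) 0ℓ → ℕ → Set
HasDimension {n} S k = Σ (Vector (ℝ^ n) (ℕ.suc k)) λ p →
  (∀ i → p i ∈ S) × AffinelyIndependent p × S ⊆ AffineHull p

-- The bounded intersections of finitely many closed half-spaces.  The
-- inequalities may be redundant, so m need not be the number of facets.
record Polytope (n : ℕ) : Set where
  field
    m : ℕ
    A : Vector (ℝ^ n) m
    b : ℝ^ m

  Points : Pred (ℝ^ n) 0ℓ
  Points x = ∀ j → A j · x ≤ b j

  field
    bounded : ∃ λ B → ∀ x → x ∈ Points → ∀ i → x i ≤ B × - x i ≤ B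

open Polytope public using (Points)

module _ {n : ℕ} (P : Polytope n) where

  -- Face 𝟎 is all of P.
  Face : ℝ^ n → Pred (ℝ^ n) 0ℓ
  Face a x = x ∈ Points P × (∀ y → y ∈ Points P → a · y ≤ a · x)

  IsFacet : Pred (ℝ^ n) 0ℓ → Set
  IsFacet F = ∃ λ k → HasDimension (Points P) (ℕ.suc k) × HasDimension F k

  -- A facet is named by a functional exposing it, and two names are identified
  -- when they expose the same set of points.
  Facets : Setoid 0ℓ 0ℓ
  Facets = record
    { Carrier       = Σ (ℝ^ n) λ a → IsFacet (Face a)
    ; isEquivalence = On.isEquivalence (λ f → Face (proj₁ f))
                        (Setoid.isEquivalence (≐-setoid (ℝ^ n) 0ℓ))
    }

  IsVertex : ℝ^ n → Set
  IsVertex v = ∃ λ a → v ∈ Face a × (∀ x → x ∈ Face a → x ≋ v)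

  NormalCone : ℝ^ n → Pred (ℝ^ n) 0ℓ
  NormalCone v a = v ∈ Face a

  IsSolution : (w c v : ℝ^ n) → Set
  IsSolution w c v = IsVertex v × ∃ λ r → (w ⊕ r ∙ c) ∈ NormalCone v

  Solutions : (w c : ℝ^ n) → Setoid 0ℓ 0ℓ
  Solutions w c = record
    { Carrier       = Σ (ℝ^ n) (IsSolution w c)
    ; isEquivalence = On.isEquivalence proj₁ (Setoid.isEquivalence (ℝ^-setoid n))
    }

HasCardinality : Setoid 0ℓ 0ℓ → ℕ → Set
HasCardinality S N = Bijection (≡.setoid (Fin N)) S

HasAtLeast : Setoid 0ℓ 0ℓ → ℕ → Set
HasAtLeast S N = Injection (≡.setoid (Fin N)) S

{-# OPTIONS --safe #-}
-- Modulo w a direction c amounts to d + 1 numbers ĉ with sum zero, and after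
-- replacing c by − c if necessary the objectives w + λ c contain, up to positive
-- factors, the whole ray w + t ĉ with t ≥ 0.  Let i be the index of the largest
-- entry of ĉ.  The polytope is a large simplex cut by d + 1 gadgets, and the
-- i-th gadget is built so that the ray meets the normal cones of 2^(d−1) of its
-- vertices while t is close to ρᵢ.
--
-- A gadget is an affine image of the polyhedron u_{k+1} ≤ 1 − 2 ∣u_k∣, k < d,
-- that is, of an iterated tent map: the points where these inequalities are
-- tight up to level d − 1 and u_{d−1} = 0 are encoded by d − 1 signs.  The
-- functional Σ 4^(d−k) u_k + τ u_0 has such a point as its only maximizer, for a
-- suitable τ, and so has every nearby functional.  The coordinates u_k (k ≥ 1)
-- are so steep in space that all admissible ĉ give nearby functionals.
--
-- The gadgets touch almost the same hyperplane ell = 0 with all their facets,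
-- and the scales ρᵢ grow so fast that gadget j contains the neighbourhood of
-- gadget i in its interior.  Hence every inequality is tight at some point at
-- which all the others are strict, which makes the inequalities the facets.

module Submission where

open import Defs
open import Axiom.ExcludedMiddle using (ExcludedMiddle)
open import Data.Nat.Base as ℕ using (ℕ; suc; _∸_; _^_)
open import Data.Product.Base using (Σ; _×_)
open import Data.Vec.Functional using (_∷_; [])
open import Level using (0ℓ)
open import Relation.Nullary using (¬_)

open import Algebra.Bundles using (CommutativeRing)
open import Algebra.Solver.Ring.AlmostCommutativeRing using (fromCommutativeRing; _-Raw-AlmostCommutative⟶_)
open import Data.Empty using (⊥; ⊥-elim)
open import Data.Fin.Base using (Fin; zero; suc; inject₁; punchIn; punchOut; toℕ; finToFun; funToFin; combine)
open import Data.Fin.Properties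
  using (_≟_; punchIn-punchOut; ¬∀⟶∃¬; toℕ-injective; funToFin-finToFin; +↔⊎; *↔×)
open import Data.Integer.Base using (+_)
open import Data.Maybe.Base using (Maybe; just; nothing)
open import Data.Nat.Base using (zero; _⊔_; z≤n; s≤s)
import Data.Nat.Properties as ℕ
open import Data.Product.Base using (∃; _,_; proj₁; proj₂)
open import Data.Product.Function.NonDependent.Propositional using (_×-↔_)
open import Data.Rational.Base as ℚ using (ℚ; 0ℚ; 1ℚ; ½; ∣_∣)
import Data.Rational.Properties as ℚ
open import Data.Rational.Solver using (module +-*-Solver)
open import Data.Sum.Base using (_⊎_; inj₁; inj₂)
open import Data.Sum.Function.Propositional using (_⊎-↔_)
open import Data.Vec.Functional using (Vector; insertAt)
open import Data.Vec.Functional.Properties using (insertAt-lookup; insertAt-punchIn)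
open import Function.Base using (_∘_)
open import Function.Bundles using (_↔_; module Inverse; module Injection)
open import Function.Construct.Composition using (_↔-∘_)
open import Function.Construct.Identity using (↔-id)
open import Relation.Binary.Definitions using (tri<; tri≈; tri>)
open import Relation.Binary.PropositionalEquality as ≡ using (_≡_; _≢_; refl; cong; subst)
open import Relation.Nullary using (Dec; yes; no)
open import Relation.Unary using (Pred; _∈_; _⊆_; _≐_)

-- The reals as an ordered field

-- The obstacle is that one objective `height` has to serve an open cone of directions: within a
-- sector, the entries of `ĉ` are controlled only up to the factor `B` = d + 1 relative to the
-- largest one. Exactly one chain coefficient is made insensitive to this. At t = `ρ i` + τ the
-- coefficient of u₀ is τ, up to scaling, whatever the direction is, so the parameter t itself
-- selects the vertex. All other coefficients are known only within a quarter of the unit `γ̂`, and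
-- `descending-optimal` is built around that tolerance. The disturbance grows with t, hence with
-- `ρ i`, which forces the stretching `θ` = `Θ` ρ to grow with it.
--
-- The sizes of the chain points (`W`) and of the y-extent of a gadget (`κ`) do not involve `Θ`.
-- Therefore the constants can be fixed in the order `Θ`, `G`, `R`, `ρ`, `S`, `D₂`, `T`, each from
-- the earlier ones. Sectors by largest entry need only d + 1 gadgets, and 2d links per gadget, one
-- side per index and one base give the count of inequalities.

private
  halves : ∀ ε → ½ ℚ.* ε ℚ.+ ½ ℚ.* ε ≡ ε
  halves ε = ≡.trans (≡.sym (ℚ.*-distribʳ-+ ε ½ ½)) (ℚ.*-identityˡ ε)

  half-pos : ∀ {ε} → 0ℚ ℚ.< ε → 0ℚ ℚ.< ½ ℚ.* ε
  half-pos {ε} 0<ε = subst (ℚ._< ½ ℚ.* ε) (ℚ.*-zeroʳ ½) (ℚ.*-monoʳ-<-pos ½ 0<ε)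

  ∣p∣<ε : ∀ {p ε} → p ≡ 0ℚ → 0ℚ ℚ.< ε → ∣ p ∣ ℚ.< ε
  ∣p∣<ε refl 0<ε = 0<ε

  module _ where
    open +-*-Solver

    diff-+ : ∀ p q r s → (p ℚ.+ q) ℚ.- (r ℚ.+ s) ≡ (p ℚ.- r) ℚ.+ (q ℚ.- s)
    diff-+ = solve 4 (λ p q r s → (p :+ q) :- (r :+ s) := (p :- r) :+ (q :- s)) refl

    diff-neg : ∀ p q → ℚ.- p ℚ.- ℚ.- q ≡ ℚ.- (p ℚ.- q)
    diff-neg = solve 2 (λ p q → :- p :- :- q := :- (p :- q)) refl

    diff-cancel : ∀ p q → q ℚ.+ (p ℚ.- q) ≡ p
    diff-cancel = solve 2 (λ p q → q :+ (p :- q) := p) refl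

    mul-diff : ∀ p q r → (p ℚ.- q) ℚ.* r ℚ.- 0ℚ ≡ r ℚ.* (p ℚ.- q)
    mul-diff = solve 3 (λ p q r → (p :- q) :* r :- con 0ℚ := r :* (p :- q)) refl

  product-small : ∀ p q r B δ ε → 0ℚ ℚ.< B → B ℚ.* δ ≡ ε → ∣ r ∣ ℚ.≤ B →
                  ∣ p ℚ.- q ∣ ℚ.< δ → ∣ (p ℚ.- q) ℚ.* r ℚ.- 0ℚ ∣ ℚ.< ε
  product-small p q r B δ ε 0<B Bδ≡ε r≤B d<δ =
    subst (ℚ._< ε) (≡.sym (≡.trans (cong ∣_∣ (mul-diff p q r)) (ℚ.∣p*q∣≡∣p∣*∣q∣ r (p ℚ.- q))))
      (ℚ.≤-<-trans (ℚ.*-monoʳ-≤-nonNeg ∣ p ℚ.- q ∣ {{ℚ.∣-∣-nonNeg (p ℚ.- q)}} r≤B)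
        (subst (B ℚ.* ∣ p ℚ.- q ∣ ℚ.<_) Bδ≡ε (ℚ.*-monoʳ-<-pos B {{ℚ.positive 0<B}} d<δ)))

opaque
  unfolding _≈_ _≤_ _+_ _*_ -_

  ≡⇒≈ : ∀ x y → (∀ n → seq x n ≡ seq y n) → x ≈ y
  ≡⇒≈ x y eq ε 0<ε = 0 , λ n _ →
    ∣p∣<ε (≡.trans (cong (ℚ._- seq y n) (eq n)) (ℚ.+-inverseʳ (seq y n))) 0<ε

  +-cong : ∀ {x x′ y y′} → x ≈ x′ → y ≈ y′ → x + y ≈ x′ + y′
  +-cong {x} {x′} {y} {y′} p q ε 0<ε
    with M , f ← p (½ ℚ.* ε) (half-pos 0<ε) | N , g ← q (½ ℚ.* ε) (half-pos 0<ε) =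
    M ⊔ N , λ n le → subst (ℚ._< ε) (cong ∣_∣ (≡.sym (diff-+ (seq x n) (seq y n) (seq x′ n) (seq y′ n))))
      (ℚ.≤-<-trans (ℚ.∣p+q∣≤∣p∣+∣q∣ (seq x n ℚ.- seq x′ n) (seq y n ℚ.- seq y′ n))
        (subst (∣ seq x n ℚ.- seq x′ n ∣ ℚ.+ ∣ seq y n ℚ.- seq y′ n ∣ ℚ.<_) (halves ε)
          (ℚ.+-mono-< (f n (ℕ.m⊔n≤o⇒m≤o M N le)) (g n (ℕ.m⊔n≤o⇒n≤o M N le)))))

  -‿cong : ∀ {x y} → x ≈ y → - x ≈ - y
  -‿cong {x} {y} p ε 0<ε with N , f ← p ε 0<ε = N , λ n le →
    subst (ℚ._< ε) (≡.sym (≡.trans (cong ∣_∣ (diff-neg (seq x n) (seq y n)))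
      (ℚ.∣-p∣≡∣p∣ (seq x n ℚ.- seq y n)))) (f n le)

  eventually-bounded : ∀ x → ∃ λ N → Σ ℚ λ B → 0ℚ ℚ.< B × (∀ n → N ℕ.≤ n → ∣ seq x n ∣ ℚ.≤ B)
  eventually-bounded x with N , h ← cauchy x 1ℚ (ℚ.positive⁻¹ 1ℚ) =
    N , ∣ seq x N ∣ ℚ.+ 1ℚ , ℚ.+-mono-≤-< (ℚ.0≤∣p∣ (seq x N)) (ℚ.positive⁻¹ 1ℚ) , λ n le →
      subst (λ r → ∣ r ∣ ℚ.≤ ∣ seq x N ∣ ℚ.+ 1ℚ) (diff-cancel (seq x n) (seq x N))
        (ℚ.≤-trans (ℚ.∣p+q∣≤∣p∣+∣q∣ (seq x N) (seq x n ℚ.- seq x N))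
          (ℚ.+-monoʳ-≤ ∣ seq x N ∣ (ℚ.<⇒≤ (h n N le ℕ.≤-refl))))

  shrink : ∀ B ε → 0ℚ ℚ.< B → 0ℚ ℚ.< ε → Σ ℚ λ δ → 0ℚ ℚ.< δ × B ℚ.* δ ≡ ε
  shrink B ε 0<B 0<ε = ℚ.1/ B ℚ.* ε ,
    subst (ℚ._< ℚ.1/ B ℚ.* ε) (ℚ.*-zeroʳ (ℚ.1/ B)) (ℚ.*-monoʳ-<-pos (ℚ.1/ B) 0<ε) ,
    ≡.trans (≡.sym (ℚ.*-assoc B (ℚ.1/ B) ε)) (≡.trans (cong (ℚ._* ε) (ℚ.*-inverseʳ B)) (ℚ.*-identityˡ ε))
    where
    instance
      B-pos : ℚ.Positive B
      B-pos = ℚ.positive 0<B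
      B-nonZero : ℚ.NonZero B
      B-nonZero = ℚ.pos⇒nonZero B
      1/B-pos : ℚ.Positive (ℚ.1/ B)
      1/B-pos = ℚ.1/pos⇒pos B

  -- A null sequence times an eventually bounded one is null. This is the only analytic input to the
  -- congruence of multiplication; the rest is ring identities.
  *-difference-≈0 : ∀ {x x′} y → x ≈ x′ → (x + - x′) * y ≈ 0ℝ
  *-difference-≈0 {x} {x′} y p ε 0<ε =
    let K , B , 0<B , b    = eventually-bounded y
        δ , 0<δ , Bδ≡ε = shrink B ε 0<B 0<ε
        N , f              = p δ 0<δ
    in K ⊔ N , λ n le →
      product-small (seq x n) (seq x′ n) (seq y n) B δ ε 0<B Bδ≡ε
        (b n (ℕ.m⊔n≤o⇒m≤o K N le)) (f n (ℕ.m⊔n≤o⇒n≤o K N le))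

  +-assoc : ∀ x y z → (x + y) + z ≈ x + (y + z)
  +-assoc x y z = ≡⇒≈ ((x + y) + z) (x + (y + z)) λ n → ℚ.+-assoc (seq x n) (seq y n) (seq z n)

  +-comm : ∀ x y → x + y ≈ y + x
  +-comm x y = ≡⇒≈ (x + y) (y + x) λ n → ℚ.+-comm (seq x n) (seq y n)

  +-identityˡ : ∀ x → 0ℝ + x ≈ x
  +-identityˡ x = ≡⇒≈ (0ℝ + x) (x) λ n → ℚ.+-identityˡ (seq x n)

  -‿inverseˡ : ∀ x → - x + x ≈ 0ℝ
  -‿inverseˡ x = ≡⇒≈ (- x + x) (0ℝ) λ n → ℚ.+-inverseˡ (seq x n)

  *-assoc : ∀ x y z → (x * y) * z ≈ x * (y * z)
  *-assoc x y z = ≡⇒≈ ((x * y) * z) (x * (y * z)) λ n → ℚ.*-assoc (seq x n) (seq y n) (seq z n)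

  *-comm : ∀ x y → x * y ≈ y * x
  *-comm x y = ≡⇒≈ (x * y) (y * x) λ n → ℚ.*-comm (seq x n) (seq y n)

  *-identityˡ : ∀ x → 1ℝ * x ≈ x
  *-identityˡ x = ≡⇒≈ (1ℝ * x) (x) λ n → ℚ.*-identityˡ (seq x n)

  *-distribˡ-+ : ∀ x y z → x * (y + z) ≈ x * y + x * z
  *-distribˡ-+ x y z = ≡⇒≈ (x * (y + z)) (x * y + x * z) λ n → ℚ.*-distribˡ-+ (seq x n) (seq y n) (seq z n)

  *-difference : ∀ x x′ y → x * y ≈ x′ * y + (x + - x′) * y
  *-difference x x′ y = ≡⇒≈ (x * y) (x′ * y + (x + - x′) * y) λ n → ident (seq x n) (seq x′ n) (seq y n)
    where
    ident : ∀ p q r → p ℚ.* r ≡ q ℚ.* r ℚ.+ (p ℚ.- q) ℚ.* r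
    ident = solve 3 (λ p q r → p :* r := q :* r :+ (p :- q) :* r) refl
      where open +-*-Solver

  fromℚ-+ : ∀ p q → fromℚ (p ℚ.+ q) ≈ fromℚ p + fromℚ q
  fromℚ-+ p q = ≡⇒≈ (fromℚ (p ℚ.+ q)) (fromℚ p + fromℚ q) λ _ → refl

  fromℚ-* : ∀ p q → fromℚ (p ℚ.* q) ≈ fromℚ p * fromℚ q
  fromℚ-* p q = ≡⇒≈ (fromℚ (p ℚ.* q)) (fromℚ p * fromℚ q) λ _ → refl

  fromℚ-neg : ∀ p → fromℚ (ℚ.- p) ≈ - fromℚ p
  fromℚ-neg p = ≡⇒≈ (fromℚ (ℚ.- p)) (- fromℚ p) λ _ → refl

+-identityʳ : ∀ x → x + 0ℝ ≈ x
+-identityʳ x = ≈-trans (+-comm x 0ℝ) (+-identityˡ x)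

*-congʳ′ : ∀ {x x′} y → x ≈ x′ → x * y ≈ x′ * y
*-congʳ′ {x} {x′} y p = ≈-trans (*-difference x x′ y)
  (≈-trans (+-cong ≈-refl (*-difference-≈0 y p)) (+-identityʳ (x′ * y)))

*-cong : ∀ {x x′ y y′} → x ≈ x′ → y ≈ y′ → x * y ≈ x′ * y′
*-cong {x} {x′} {y} {y′} p q = ≈-trans (*-congʳ′ y p)
  (≈-trans (*-comm x′ y) (≈-trans (*-congʳ′ x′ q) (*-comm y′ x′)))

ℝ-commutativeRing : CommutativeRing 0ℓ 0ℓ
ℝ-commutativeRing = record
  { Carrier = ℝ ; _≈_ = _≈_ ; _+_ = _+_ ; _*_ = _*_ ; -_ = -_ ; 0# = 0ℝ ; 1# = 1ℝ
  ; isCommutativeRing = record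
    { isRing = record
      { +-isAbelianGroup = record
        { isGroup = record
          { isMonoid = record
            { isSemigroup = record
              { isMagma = record { isEquivalence = record { refl = ≈-refl ; sym = ≈-sym ; trans = ≈-trans } ; ∙-cong = +-cong }
              ; assoc = +-assoc }
            ; identity = +-identityˡ , +-identityʳ }
          ; inverse = -‿inverseˡ , λ x → ≈-trans (+-comm x (- x)) (-‿inverseˡ x)
          ; ⁻¹-cong = -‿cong }
        ; comm = +-comm }
      ; *-cong = *-cong
      ; *-assoc = *-assoc
      ; *-identity = *-identityˡ , λ x → ≈-trans (*-comm x 1ℝ) (*-identityˡ x)
      ; distrib = *-distribˡ-+ , λ x y z → ≈-trans (*-comm (y + z) x)
          (≈-trans (*-distribˡ-+ x y z) (+-cong (*-comm x y) (*-comm x z)))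
      }
    ; *-comm = *-comm
    }
  }

-- Rational coefficients let the ring solver normalise constants such as ½ and ¼, which occur in
-- nearly every estimate below.
coefficients : CommutativeRing.rawRing ℚ.+-*-commutativeRing -Raw-AlmostCommutative⟶ fromCommutativeRing ℝ-commutativeRing
coefficients = record
  { ⟦_⟧ = fromℚ ; +-homo = fromℚ-+ ; *-homo = fromℚ-* ; -‿homo = fromℚ-neg ; 0-homo = ≈-refl ; 1-homo = ≈-refl }

coefficient≟ : ∀ p q → Maybe (fromℚ p ≈ fromℚ q)
coefficient≟ p q with p ℚ.≟ q
... | yes refl = just ≈-refl
... | no _ = nothing

module RingSolver where
  open import Algebra.Solver.Ring (CommutativeRing.rawRing ℚ.+-*-commutativeRing)
    (fromCommutativeRing ℝ-commutativeRing) coefficients coefficient≟ public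

-- The rational gap η is kept as data: reciprocals and products of positive reals are computed from
-- it.
Positive : ℝ → Set
Positive x = Σ ℚ λ η → 0ℚ ℚ.< η × (∃ λ N → ∀ n → N ℕ.≤ n → η ℚ.≤ seq x n)

private
  p≤∣p∣ : ∀ p → p ℚ.≤ ∣ p ∣
  p≤∣p∣ p with ℚ.≤-total 0ℚ p
  ... | inj₁ 0≤p = ℚ.≤-reflexive (≡.sym (ℚ.0≤p⇒∣p∣≡p 0≤p))
  ... | inj₂ p≤0 = ℚ.≤-trans p≤0 (ℚ.0≤∣p∣ p)

  module _ where
    open +-*-Solver

    cancel : ∀ p q → q ℚ.+ (p ℚ.- q) ≡ p
    cancel = solve 2 (λ p q → q :+ (p :- q) := p) refl

    neg-diff : ∀ p q → ℚ.- (p ℚ.- q) ≡ q ℚ.- p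
    neg-diff = solve 2 (λ p q → :- (p :- q) := q :- p) refl

    minus-0 : ∀ p → p ℚ.- 0ℚ ≡ p
    minus-0 = solve 1 (λ p → p :- con 0ℚ := p) refl

  ∣-∣-upper : ∀ p q ε → ∣ p ℚ.- q ∣ ℚ.< ε → p ℚ.< q ℚ.+ ε
  ∣-∣-upper p q ε h = subst (ℚ._< q ℚ.+ ε) (cancel p q)
    (ℚ.+-monoʳ-< q (ℚ.≤-<-trans (p≤∣p∣ (p ℚ.- q)) h))

  ∣-∣-lower : ∀ p q ε → ∣ p ℚ.- q ∣ ℚ.< ε → q ℚ.< p ℚ.+ ε
  ∣-∣-lower p q ε h = ∣-∣-upper q p ε (subst (ℚ._< ε)
    (≡.trans (≡.sym (ℚ.∣-p∣≡∣p∣ (p ℚ.- q))) (cong ∣_∣ (neg-diff p q))) h)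

  between : ∀ p q ε → p ℚ.< q ℚ.+ ε → q ℚ.< p ℚ.+ ε → ∣ p ℚ.- q ∣ ℚ.< ε
  between p q ε p<q+ε q<p+ε with ℚ.∣p∣≡p∨∣p∣≡-p (p ℚ.- q)
  ... | inj₁ eq = subst (ℚ._< ε) (≡.sym eq) (drop p q p<q+ε)
    where
    drop : ∀ p q → p ℚ.< q ℚ.+ ε → p ℚ.- q ℚ.< ε
    drop p q h = ℚ.≰⇒> λ ε≤p-q → ℚ.<-irrefl refl (ℚ.<-≤-trans h
      (subst (q ℚ.+ ε ℚ.≤_) (cancel p q) (ℚ.+-monoʳ-≤ q ε≤p-q)))
  ... | inj₂ eq = subst (ℚ._< ε) (≡.sym (≡.trans eq (neg-diff p q)))
    (ℚ.≰⇒> λ ε≤q-p → ℚ.<-irrefl refl (ℚ.<-≤-trans q<p+ε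
      (subst (p ℚ.+ ε ℚ.≤_) (cancel q p) (ℚ.+-monoʳ-≤ p ε≤q-p))))

  near-large : ∀ p q ε → ε ℚ.≤ p → ∣ q ℚ.- p ∣ ℚ.< ½ ℚ.* ε → ½ ℚ.* ε ℚ.≤ q
  near-large p q ε ε≤p h = ℚ.≮⇒≥ λ q<½ε → ℚ.<-irrefl refl
    (ℚ.<-≤-trans (ℚ.<-trans (∣-∣-lower q p (½ ℚ.* ε) h) (ℚ.+-monoˡ-< (½ ℚ.* ε) q<½ε))
      (subst (ℚ._≤ p) (≡.sym (halves ε)) ε≤p))

  near-large-neg : ∀ p q ε → ε ℚ.≤ ℚ.- p → ∣ q ℚ.- p ∣ ℚ.< ½ ℚ.* ε → ½ ℚ.* ε ℚ.≤ ℚ.- q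
  near-large-neg p q ε ε≤-p h = near-large (ℚ.- p) (ℚ.- q) ε ε≤-p
    (subst (ℚ._< ½ ℚ.* ε) (≡.trans (≡.sym (ℚ.∣-p∣≡∣p∣ (q ℚ.- p))) (cong ∣_∣ (neg-sub q p))) h)
    where
    neg-sub : ∀ q p → ℚ.- (q ℚ.- p) ≡ ℚ.- q ℚ.- ℚ.- p
    neg-sub = solve 2 (λ q p → :- (q :- p) := :- q :- :- p) refl
      where open +-*-Solver

  *-mono-≤ : ∀ p q η θ → 0ℚ ℚ.< η → 0ℚ ℚ.< θ → η ℚ.≤ p → θ ℚ.≤ q → η ℚ.* θ ℚ.≤ p ℚ.* q
  *-mono-≤ p q η θ 0<η 0<θ η≤p θ≤q = ℚ.≤-trans
    (ℚ.*-monoˡ-≤-nonNeg η {{ℚ.nonNegative (ℚ.<⇒≤ 0<η)}} θ≤q)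
    (ℚ.*-monoʳ-≤-nonNeg q {{ℚ.nonNegative (ℚ.≤-trans (ℚ.<⇒≤ 0<θ) θ≤q)}} η≤p)

  *-pos : ∀ {p q} → 0ℚ ℚ.< p → 0ℚ ℚ.< q → 0ℚ ℚ.< p ℚ.* q
  *-pos {p} {q} 0<p 0<q = subst (ℚ._< p ℚ.* q) (ℚ.*-zeroʳ p) (ℚ.*-monoʳ-<-pos p {{ℚ.positive 0<p}} 0<q)

  reciprocal : ∀ p → 0ℚ ℚ.< p → Σ ℚ λ r → r ℚ.* p ≡ 1ℚ × 0ℚ ℚ.< r
  reciprocal p 0<p = ℚ.1/ p , ℚ.*-inverseˡ p , ℚ.positive⁻¹ (ℚ.1/ p)
    where
    instance
      p-pos : ℚ.Positive p
      p-pos = ℚ.positive 0<p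
      p-nonZero : ℚ.NonZero p
      p-nonZero = ℚ.pos⇒nonZero p
      1/p-pos : ℚ.Positive (ℚ.1/ p)
      1/p-pos = ℚ.1/pos⇒pos p

  reciprocal-≤ : ∀ p η r c → r ℚ.* p ≡ 1ℚ → 0ℚ ℚ.< r → c ℚ.* η ≡ 1ℚ → 0ℚ ℚ.< c → η ℚ.≤ p → r ℚ.≤ c
  reciprocal-≤ p η r c rp≡1 0<r cη≡1 0<c η≤p = ≡.subst₂ ℚ._≤_
    (≡.trans (cong (ℚ._* r) cη≡1) (ℚ.*-identityˡ r))
    (≡.trans (swap c p r) (≡.trans (cong (c ℚ.*_) rp≡1) (ℚ.*-identityʳ c)))
    (ℚ.*-monoʳ-≤-nonNeg r {{ℚ.nonNegative (ℚ.<⇒≤ 0<r)}} (ℚ.*-monoˡ-≤-nonNeg c {{ℚ.nonNegative (ℚ.<⇒≤ 0<c)}} η≤p))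
    where
    swap : ∀ c p r → (c ℚ.* p) ℚ.* r ≡ c ℚ.* (r ℚ.* p)
    swap = solve 3 (λ c p r → (c :* p) :* r := c :* (r :* p)) refl
      where open +-*-Solver

  reciprocal-close : ∀ p q r s C δ ε → r ℚ.* p ≡ 1ℚ → s ℚ.* q ≡ 1ℚ → 0ℚ ℚ.< r → 0ℚ ℚ.< s →
    r ℚ.≤ C → s ℚ.≤ C → 0ℚ ℚ.< C → (C ℚ.* C) ℚ.* δ ≡ ε → ∣ p ℚ.- q ∣ ℚ.< δ → ∣ r ℚ.- s ∣ ℚ.< ε
  reciprocal-close p q r s C δ ε rp≡1 sq≡1 0<r 0<s r≤C s≤C 0<C CCδ≡ε h =
    subst (ℚ._< ε) (≡.sym abs-eq) (ℚ.≤-<-trans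
      (ℚ.*-monoʳ-≤-nonNeg ∣ p ℚ.- q ∣ {{ℚ.∣-∣-nonNeg (p ℚ.- q)}} (*-mono-≤ C C s r 0<s 0<r s≤C r≤C))
      (subst (C ℚ.* C ℚ.* ∣ p ℚ.- q ∣ ℚ.<_) CCδ≡ε
        (ℚ.*-monoʳ-<-pos (C ℚ.* C) {{ℚ.positive (*-pos 0<C 0<C)}} h)))
    where
    open +-*-Solver
    expand : ∀ p q r s → (s ℚ.* r) ℚ.* (p ℚ.- q) ≡ s ℚ.* (r ℚ.* p) ℚ.- r ℚ.* (s ℚ.* q)
    expand = solve 4 (λ p q r s → (s :* r) :* (p :- q) := s :* (r :* p) :- r :* (s :* q)) refl
    product : (s ℚ.* r) ℚ.* (p ℚ.- q) ≡ s ℚ.- r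
    product = ≡.trans (expand p q r s) (≡.cong₂ ℚ._-_
      (≡.trans (cong (s ℚ.*_) rp≡1) (ℚ.*-identityʳ s)) (≡.trans (cong (r ℚ.*_) sq≡1) (ℚ.*-identityʳ r)))
    abs-eq : ∣ r ℚ.- s ∣ ≡ (s ℚ.* r) ℚ.* ∣ p ℚ.- q ∣
    abs-eq = ≡.trans (≡.trans (≡.sym (ℚ.∣-p∣≡∣p∣ (r ℚ.- s))) (cong ∣_∣ (neg-diff r s)))
      (≡.trans (cong ∣_∣ (≡.sym product)) (≡.trans (ℚ.∣p*q∣≡∣p∣*∣q∣ (s ℚ.* r) (p ℚ.- q))
        (cong (ℚ._* ∣ p ℚ.- q ∣) (ℚ.0≤p⇒∣p∣≡p (ℚ.<⇒≤ (*-pos 0<s 0<r))))))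

  max-close : ∀ p q η ε → ∣ p ℚ.- q ∣ ℚ.< ε → η ℚ.≤ p → η ℚ.≤ q → ∣ (p ℚ.⊔ η) ℚ.- (q ℚ.⊔ η) ∣ ℚ.< ε
  max-close p q η ε h η≤p η≤q = subst (ℚ._< ε)
    (cong ∣_∣ (≡.cong₂ ℚ._-_ (≡.sym (ℚ.p≥q⇒p⊔q≡p η≤p)) (≡.sym (ℚ.p≥q⇒p⊔q≡p η≤q)))) h

  diff-zero : ∀ {p q} → p ≡ q → p ℚ.- q ≡ 0ℚ
  diff-zero {p} refl = ℚ.+-inverseʳ p

  not-below : ∀ p η → p ℚ.< 0ℚ ℚ.+ ½ ℚ.* η → 0ℚ ℚ.< η → η ℚ.≤ p → ⊥
  not-below p η h 0<η η≤p = ℚ.<-irrefl refl (ℚ.<-≤-trans (ℚ.<-trans h (ℚ.+-monoˡ-< (½ ℚ.* η) (half-pos 0<η)))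
    (subst (ℚ._≤ p) (≡.sym (halves η)) η≤p))

opaque
  unfolding _≈_ _≤_ _+_ _*_ -_

  ≈⇒≤ : ∀ {x y} → x ≈ y → x ≤ y
  ≈⇒≤ {x} {y} p ε 0<ε = let N , f = p ε 0<ε in N , λ n le → ∣-∣-upper (seq x n) (seq y n) ε (f n le)

  ≤-trans : ∀ {x y z} → x ≤ y → y ≤ z → x ≤ z
  ≤-trans {x} {y} {z} p q ε 0<ε =
    let M , f = p (½ ℚ.* ε) (half-pos 0<ε)
        N , g = q (½ ℚ.* ε) (half-pos 0<ε)
    in M ⊔ N , λ n le → chain (seq x n) (seq y n) (seq z n) (f n (ℕ.m⊔n≤o⇒m≤o M N le)) (g n (ℕ.m⊔n≤o⇒n≤o M N le))
    where
    chain : ∀ p q r → p ℚ.< q ℚ.+ ½ ℚ.* ε → q ℚ.< r ℚ.+ ½ ℚ.* ε → p ℚ.< r ℚ.+ ε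
    chain p q r h k = ℚ.<-trans h (subst (q ℚ.+ ½ ℚ.* ε ℚ.<_)
      (≡.trans (ℚ.+-assoc r (½ ℚ.* ε) (½ ℚ.* ε)) (cong (r ℚ.+_) (halves ε)))
      (ℚ.+-monoˡ-< (½ ℚ.* ε) k))

  ≤-antisym : ∀ {x y} → x ≤ y → y ≤ x → x ≈ y
  ≤-antisym {x} {y} p q ε 0<ε =
    let M , f = p ε 0<ε
        N , g = q ε 0<ε
    in M ⊔ N , λ n le → between (seq x n) (seq y n) ε (f n (ℕ.m⊔n≤o⇒m≤o M N le)) (g n (ℕ.m⊔n≤o⇒n≤o M N le))

  +-monoʳ-≤ : ∀ {y z} x → y ≤ z → x + y ≤ x + z
  +-monoʳ-≤ {y} {z} x p ε 0<ε = let N , f = p ε 0<ε in N , λ n le →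
    subst (seq x n ℚ.+ seq y n ℚ.<_) (≡.sym (ℚ.+-assoc (seq x n) (seq z n) ε))
      (ℚ.+-monoʳ-< (seq x n) (f n le))

  Positive⇒0≤ : ∀ {x} → Positive x → 0ℝ ≤ x
  Positive⇒0≤ {x} (η , 0<η , N , f) ε 0<ε = N , λ n le →
    ℚ.<-trans 0<ε (subst (ℚ._< seq x n ℚ.+ ε) (ℚ.+-identityˡ ε)
      (ℚ.+-monoˡ-< ε (ℚ.<-≤-trans 0<η (f n le))))

  ≤0⇒¬Positive : ∀ {x} → x ≤ 0ℝ → ¬ Positive x
  ≤0⇒¬Positive {x} p (η , 0<η , N , f) =
    let M , g = p (½ ℚ.* η) (half-pos 0<η)
    in not-below (seq x (M ⊔ N)) η (g (M ⊔ N) (ℕ.m≤m⊔n M N)) 0<η (f (M ⊔ N) (ℕ.m≤n⊔m M N))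

  *-Positive : ∀ {x y} → Positive x → Positive y → Positive (x * y)
  *-Positive {x} {y} (η , 0<η , M , f) (θ , 0<θ , N , g) = η ℚ.* θ , *-pos 0<η 0<θ , M ⊔ N , λ n le →
    *-mono-≤ (seq x n) (seq y n) η θ 0<η 0<θ (f n (ℕ.m⊔n≤o⇒m≤o M N le)) (g n (ℕ.m⊔n≤o⇒n≤o M N le))

  -- Cutting the sequence off from below at η makes every term invertible and changes nothing from N
  -- on. Reciprocals of numbers at least η are bounded by C = 1/η, so they form a Cauchy sequence
  -- with modulus scaled by C².
  Positive-inverse : ∀ {x} → Positive x → Σ ℝ λ y → y * x ≈ 1ℝ
  Positive-inverse {x} (η , 0<η , N , f) = mkℝ inv inv-cauchy , λ ε 0<ε → N , λ n le →
    subst (ℚ._< ε) (cong ∣_∣ (≡.sym (diff-zero (inv-* n le)))) 0<ε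
    where
    η≤ : ∀ n → η ℚ.≤ seq x n ℚ.⊔ η
    η≤ n = ℚ.p≤q⊔p (seq x n) η
    recip : ∀ n → Σ ℚ λ r → r ℚ.* (seq x n ℚ.⊔ η) ≡ 1ℚ × 0ℚ ℚ.< r
    recip n = reciprocal (seq x n ℚ.⊔ η) (ℚ.<-≤-trans 0<η (η≤ n))
    inv : ℕ → ℚ
    inv n = proj₁ (recip n)
    inv-* : ∀ n → N ℕ.≤ n → inv n ℚ.* seq x n ≡ 1ℚ
    inv-* n le = ≡.trans (cong (inv n ℚ.*_) (≡.sym (ℚ.p≥q⇒p⊔q≡p (f n le)))) (proj₁ (proj₂ (recip n)))
    C : ℚ
    C = proj₁ (reciprocal η 0<η)
    Cη≡1 : C ℚ.* η ≡ 1ℚ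
    Cη≡1 = proj₁ (proj₂ (reciprocal η 0<η))
    0<C : 0ℚ ℚ.< C
    0<C = proj₂ (proj₂ (reciprocal η 0<η))
    inv≤C : ∀ n → inv n ℚ.≤ C
    inv≤C n = reciprocal-≤ (seq x n ℚ.⊔ η) η (inv n) C (proj₁ (proj₂ (recip n))) (proj₂ (proj₂ (recip n))) Cη≡1 0<C (η≤ n)
    inv-cauchy : IsCauchy inv
    inv-cauchy ε 0<ε =
      let δ , 0<δ , CCδ≡ε = shrink (C ℚ.* C) ε (*-pos 0<C 0<C) 0<ε
          M , g = cauchy x δ 0<δ
      in M ⊔ N , λ m n lm ln → reciprocal-close (seq x m ℚ.⊔ η) (seq x n ℚ.⊔ η) (inv m) (inv n) C δ ε
           (proj₁ (proj₂ (recip m))) (proj₁ (proj₂ (recip n))) (proj₂ (proj₂ (recip m))) (proj₂ (proj₂ (recip n)))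
           (inv≤C m) (inv≤C n) 0<C CCδ≡ε
           (max-close (seq x m) (seq x n) η δ (g m n (ℕ.m⊔n≤o⇒m≤o M N lm) (ℕ.m⊔n≤o⇒m≤o M N ln))
             (f m (ℕ.m⊔n≤o⇒n≤o M N lm)) (f n (ℕ.m⊔n≤o⇒n≤o M N ln)))

  -- If x is not null, some ε is reached by the absolute values of arbitrarily late terms. Past the
  -- Cauchy index for ½ ε, a single such term fixes the sign of all later ones and keeps them ½ ε
  -- away from zero.
  sign : ExcludedMiddle 0ℓ → ∀ x → x ≈ 0ℝ ⊎ Positive x ⊎ Positive (- x)
  sign em x = decide em
    where
    Away : Set
    Away = Σ ℚ λ ε → 0ℚ ℚ.< ε × (∀ N → ∃ λ n → N ℕ.≤ n × ε ℚ.≤ ∣ seq x n ∣)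
    near : ¬ Away → x ≈ 0ℝ
    near ¬away ε 0<ε with em {∃ λ N → ∀ n → N ℕ.≤ n → ∣ seq x n ℚ.- 0ℚ ∣ ℚ.< ε}
    ... | yes h = h
    ... | no ¬h = ⊥-elim (¬away (ε , 0<ε , often))
      where
      often : ∀ N → ∃ λ n → N ℕ.≤ n × ε ℚ.≤ ∣ seq x n ∣
      often N with em {∃ λ n → N ℕ.≤ n × ε ℚ.≤ ∣ seq x n ∣}
      ... | yes h = h
      ... | no ¬large = ⊥-elim (¬h (N , λ n le → subst (λ p → ∣ p ∣ ℚ.< ε) (≡.sym (minus-0 (seq x n)))
        (ℚ.≰⇒> λ ε≤ → ¬large (n , le , ε≤))))
    away : Away → Positive x ⊎ Positive (- x)
    away (ε , 0<ε , h) =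
      let N , f = cauchy x (½ ℚ.* ε) (half-pos 0<ε)
          n , N≤n , ε≤ = h N
      in at N f n N≤n ε≤ (ℚ.∣p∣≡p∨∣p∣≡-p (seq x n))
      where
      at : ∀ N → (∀ m n → N ℕ.≤ m → N ℕ.≤ n → ∣ seq x m ℚ.- seq x n ∣ ℚ.< ½ ℚ.* ε) → ∀ n → N ℕ.≤ n →
           ε ℚ.≤ ∣ seq x n ∣ → ∣ seq x n ∣ ≡ seq x n ⊎ ∣ seq x n ∣ ≡ ℚ.- seq x n → Positive x ⊎ Positive (- x)
      at N f n N≤n ε≤ (inj₁ eq) = inj₁ (½ ℚ.* ε , half-pos 0<ε , N , λ m le →
        near-large (seq x n) (seq x m) ε (subst (ε ℚ.≤_) eq ε≤) (f m n le N≤n))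
      at N f n N≤n ε≤ (inj₂ eq) = inj₂ (½ ℚ.* ε , half-pos 0<ε , N , λ m le →
        near-large-neg (seq x n) (seq x m) ε (subst (ε ℚ.≤_) eq ε≤) (f m n le N≤n))
    decide : Dec Away → x ≈ 0ℝ ⊎ Positive x ⊎ Positive (- x)
    decide (yes a) = inj₂ (away a)
    decide (no ¬a) = inj₁ (near ¬a)

fromℚ-Positive : ∀ {q} → 0ℚ ℚ.< q → Positive (fromℚ q)
fromℚ-Positive {q} 0<q = q , 0<q , 0 , λ _ _ → ℚ.≤-refl

module ℝR = CommutativeRing ℝ-commutativeRing
open ℝR using (zeroˡ; zeroʳ; +-congˡ; +-congʳ; *-congˡ; *-congʳ; -‿inverseʳ; *-identityʳ; distribˡ; distribʳ)
  renaming (reflexive to ≈-reflexive)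
open import Algebra.Properties.Semiring.Sum ℝR.semiring
  using (sum-cong-≋; sum-remove; ∑-distrib-+; ∑-comm; *-distribˡ-sum; *-distribʳ-sum; sum-replicate-zero)
open import Relation.Binary.Reasoning.Setoid ℝ-setoid
open RingSolver using (solve; _:=_; _:+_; _:*_; _:-_; :-_; con)

infixl 6 _-_
_-_ : ℝ → ℝ → ℝ
x - y = x + - y

2ℚ 4ℚ : ℚ
2ℚ = + 2 ℚ./ 1
4ℚ = + 4 ℚ./ 1

2ℝ 4ℝ ½ℝ : ℝ
2ℝ = fromℚ 2ℚ
4ℝ = fromℚ 4ℚ
½ℝ = fromℚ ½

infix 4 _<_
-- The negated form transports along `_≈_` and composes with `_≤_` immediately; `0<⇒Positive`
-- recovers the rational gap classically.
_<_ : ℝ → ℝ → Set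
x < y = ¬ (y ≤ x)

≤-refl : ∀ {x} → x ≤ x
≤-refl = ≈⇒≤ ≈-refl

≤-respˡ : ∀ {x x′ y} → x ≈ x′ → x ≤ y → x′ ≤ y
≤-respˡ p h = ≤-trans (≈⇒≤ (≈-sym p)) h

≤-respʳ : ∀ {x y y′} → y ≈ y′ → x ≤ y → x ≤ y′
≤-respʳ p h = ≤-trans h (≈⇒≤ p)

<-respˡ : ∀ {x x′ y} → x ≈ x′ → x < y → x′ < y
<-respˡ p h k = h (≤-respʳ (≈-sym p) k)

<-respʳ : ∀ {x y y′} → y ≈ y′ → x < y → x < y′
<-respʳ p h k = h (≤-respˡ (≈-sym p) k)

≤-diff : ∀ {x y} → x ≤ y → 0ℝ ≤ y - x
≤-diff {x} {y} h = ≤-respˡ (solve 1 (λ x → :- x :+ x := con 0ℚ) ≈-refl x)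
  (≤-respʳ (+-comm (- x) y) (+-monoʳ-≤ (- x) h))

diff-≤ : ∀ {x y} → 0ℝ ≤ y - x → x ≤ y
diff-≤ {x} {y} h = ≤-respˡ (+-identityʳ x)
  (≤-respʳ (solve 2 (λ x y → x :+ (y :- x) := y) ≈-refl x y) (+-monoʳ-≤ x h))

<-diff : ∀ {x y} → x < y → 0ℝ < y - x
<-diff {x} {y} h k = h (≤-trans (≤-respˡ (solve 2 (λ x y → x :+ (y :- x) := y) ≈-refl x y) (+-monoʳ-≤ x k))
  (≈⇒≤ (+-identityʳ x)))

diff-< : ∀ {x y} → 0ℝ < y - x → x < y
diff-< {x} {y} h k = h (≤-respʳ (solve 1 (λ x → x :- x := con 0ℚ) ≈-refl x)
  (≤-respˡ (+-comm (- x) y) (≤-respʳ (+-comm (- x) x) (+-monoʳ-≤ (- x) k))))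

≤-via : ∀ {x y} e → y - x ≈ e → 0ℝ ≤ e → x ≤ y
≤-via e p h = diff-≤ (≤-respʳ (≈-sym p) h)

<-via : ∀ {x y} e → y - x ≈ e → 0ℝ < e → x < y
<-via e p h = diff-< (<-respʳ (≈-sym p) h)

0≤+ : ∀ {x y} → 0ℝ ≤ x → 0ℝ ≤ y → 0ℝ ≤ x + y
0≤+ {x} {y} p q = ≤-trans p (≤-respˡ (+-identityʳ x) (+-monoʳ-≤ x q))

+-mono-≤ : ∀ {x x′ y y′} → x ≤ x′ → y ≤ y′ → x + y ≤ x′ + y′
+-mono-≤ {x} {x′} {y} {y′} p q = ≤-via ((x′ - x) + (y′ - y))
  (solve 4 (λ x x′ y y′ → (x′ :+ y′) :- (x :+ y) := (x′ :- x) :+ (y′ :- y)) ≈-refl x x′ y y′)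
  (0≤+ (≤-diff p) (≤-diff q))

neg-≤ : ∀ {x y} → x ≤ y → - y ≤ - x
neg-≤ {x} {y} p = ≤-via (y - x) (solve 2 (λ x y → :- x :- :- y := y :- x) ≈-refl x y) (≤-diff p)

0<+≤ : ∀ {x y} → 0ℝ < x → 0ℝ ≤ y → 0ℝ < x + y
0<+≤ {x} {y} p q k = p (≤-trans (≤-respˡ (+-identityʳ x) (+-monoʳ-≤ x q)) k)

0≤+< : ∀ {x y} → 0ℝ ≤ x → 0ℝ < y → 0ℝ < x + y
0≤+< {x} {y} p q k = q (≤-trans (≤-respʳ (+-comm y x) (≤-respˡ (+-identityʳ y) (+-monoʳ-≤ y p))) k)

<-≤-trans : ∀ {x y z} → x < y → y ≤ z → x < z
<-≤-trans p q k = p (≤-trans q k)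

≤-<-trans : ∀ {x y z} → x ≤ y → y < z → x < z
≤-<-trans p q k = q (≤-trans k p)

Positive⇒0< : ∀ {x} → Positive x → 0ℝ < x
Positive⇒0< p q = ≤0⇒¬Positive q p

fromℚ-< : ∀ {q} → 0ℚ ℚ.< q → 0ℝ < fromℚ q
fromℚ-< 0<q = Positive⇒0< (fromℚ-Positive 0<q)

0<1 : 0ℝ < 1ℝ
0<1 = fromℚ-< (ℚ.positive⁻¹ 1ℚ)

0<2 : 0ℝ < 2ℝ
0<2 = fromℚ-< (ℚ.positive⁻¹ 2ℚ)

0<4 : 0ℝ < 4ℝ
0<4 = fromℚ-< (ℚ.positive⁻¹ 4ℚ)

0<½ : 0ℝ < ½ℝ
0<½ = fromℚ-< (ℚ.positive⁻¹ ½)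

pow : ℝ → ℕ → ℝ
pow x zero    = 1ℝ
pow x (suc n) = x * pow x n

-- Classical order: signs, division and two-sided bounds

module Ordered (em : ExcludedMiddle 0ℓ) where

  data Sign (x : ℝ) : Set where
    zer : x ≈ 0ℝ → Sign x
    pos : Positive x → Sign x
    neg : Positive (- x) → Sign x

  sgn : ∀ x → Sign x
  sgn x with sign em x
  ... | inj₁ h        = zer h
  ... | inj₂ (inj₁ h) = pos h
  ... | inj₂ (inj₂ h) = neg h

  Positive-neg⇒≤0 : ∀ {x} → Positive (- x) → x ≤ 0ℝ
  Positive-neg⇒≤0 {x} h = ≤-via (- x) (+-identityˡ (- x)) (Positive⇒0≤ h)

  0<⇒Positive : ∀ {x} → 0ℝ < x → Positive x
  0<⇒Positive {x} h with sgn x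
  ... | zer p = ⊥-elim (h (≈⇒≤ p))
  ... | pos p = p
  ... | neg p = ⊥-elim (h (Positive-neg⇒≤0 p))

  <⇒≤ : ∀ {x y} → x < y → x ≤ y
  <⇒≤ h = diff-≤ (Positive⇒0≤ (0<⇒Positive (<-diff h)))

  ≮⇒≥ : ∀ {x y} → ¬ (x < y) → y ≤ x
  ≮⇒≥ {x} {y} h with em {y ≤ x}
  ... | yes p = p
  ... | no p  = ⊥-elim (h p)

  ≤-total : ∀ x y → x ≤ y ⊎ y ≤ x
  ≤-total x y with em {x ≤ y}
  ... | yes p = inj₁ p
  ... | no p  = inj₂ (<⇒≤ p)

  ≤∧≉⇒< : ∀ {x y} → x ≤ y → ¬ (x ≈ y) → x < y
  ≤∧≉⇒< p h q = h (≤-antisym p q)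

  0<* : ∀ {x y} → 0ℝ < x → 0ℝ < y → 0ℝ < x * y
  0<* p q = Positive⇒0< (*-Positive (0<⇒Positive p) (0<⇒Positive q))

  0≤* : ∀ {x y} → 0ℝ ≤ x → 0ℝ ≤ y → 0ℝ ≤ x * y
  0≤* {x} {y} p q with em {x ≈ 0ℝ} | em {y ≈ 0ℝ}
  ... | yes h | _ = ≈⇒≤ (≈-sym (≈-trans (*-congʳ h) (zeroˡ y)))
  ... | no _  | yes h = ≈⇒≤ (≈-sym (≈-trans (*-congˡ h) (zeroʳ x)))
  ... | no h  | no k = <⇒≤ (0<* (≤∧≉⇒< p (λ e → h (≈-sym e))) (≤∧≉⇒< q (λ e → k (≈-sym e))))

  0<⇒≉0 : ∀ {x} → 0ℝ < x → ¬ (x ≈ 0ℝ)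
  0<⇒≉0 h p = h (≈⇒≤ p)

  inverse : ∀ {x} → ¬ (x ≈ 0ℝ) → Σ ℝ λ y → y * x ≈ 1ℝ
  inverse {x} h with sgn x
  ... | zer p = ⊥-elim (h p)
  ... | pos p = Positive-inverse p
  ... | neg p = let y , e = Positive-inverse p in
    - y , ≈-trans (solve 2 (λ x y → :- y :* x := y :* :- x) ≈-refl x y) e

  *-cancelˡ-0 : ∀ {x y} → ¬ (x ≈ 0ℝ) → x * y ≈ 0ℝ → y ≈ 0ℝ
  *-cancelˡ-0 {x} {y} h p = let z , e = inverse h in begin
    y           ≈⟨ solve 1 (λ y → y := con 1ℚ :* y) ≈-refl y ⟩
    1ℝ * y      ≈⟨ *-congʳ e ⟨
    z * x * y   ≈⟨ *-assoc z x y ⟩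
    z * (x * y) ≈⟨ *-congˡ p ⟩
    z * 0ℝ      ≈⟨ zeroʳ z ⟩
    0ℝ          ∎

  diff≈0⇒≈ : ∀ {x y} → x - y ≈ 0ℝ → x ≈ y
  diff≈0⇒≈ {x} {y} p = begin
    x           ≈⟨ solve 2 (λ x y → x := (x :- y) :+ y) ≈-refl x y ⟩
    (x - y) + y ≈⟨ +-congʳ p ⟩
    0ℝ + y      ≈⟨ +-identityˡ y ⟩
    y           ∎

  ≈⇒diff≈0 : ∀ {x y} → x ≈ y → x - y ≈ 0ℝ
  ≈⇒diff≈0 {x} {y} p = ≈-trans (+-congʳ p) (-‿inverseʳ y)

  *-cancelˡ : ∀ {x y z} → ¬ (x ≈ 0ℝ) → x * y ≈ x * z → y ≈ z
  *-cancelˡ {x} {y} {z} h p = diff≈0⇒≈ (*-cancelˡ-0 h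
    (≈-trans (solve 3 (λ x y z → x :* (y :- z) := x :* y :- x :* z) ≈-refl x y z) (≈⇒diff≈0 p)))

  *-monoˡ-≤ : ∀ {x y z} → 0ℝ ≤ x → y ≤ z → x * y ≤ x * z
  *-monoˡ-≤ {x} {y} {z} h p = ≤-via (x * (z - y))
    (solve 3 (λ x y z → x :* z :- x :* y := x :* (z :- y)) ≈-refl x y z) (0≤* h (≤-diff p))

  *-cancelˡ-≤ : ∀ {x y z} → 0ℝ < x → x * y ≤ x * z → y ≤ z
  *-cancelˡ-≤ {x} {y} {z} h p = ≮⇒≥ λ z<y → 0<* h (<-diff z<y)
    (≤-via (x * z - x * y) (solve 3 (λ x y z → con 0ℚ :- x :* (y :- z) := x :* z :- x :* y) ≈-refl x y z) (≤-diff p))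

  x²≈0 : ∀ {x} → x * x ≈ 0ℝ → x ≈ 0ℝ
  x²≈0 {x} p with em {x ≈ 0ℝ}
  ... | yes h = h
  ... | no h  = *-cancelˡ-0 h p

  0≤x² : ∀ x → 0ℝ ≤ x * x
  0≤x² x with ≤-total 0ℝ x
  ... | inj₁ h = 0≤* h h
  ... | inj₂ h = ≤-respʳ (solve 1 (λ x → (con 0ℚ :- x) :* (con 0ℚ :- x) := x :* x) ≈-refl x)
    (0≤* (≤-diff h) (≤-diff h))

  sum-0≤ : ∀ {n} {f : Vector ℝ n} → (∀ i → 0ℝ ≤ f i) → 0ℝ ≤ sum f
  sum-0≤ {zero}  h = ≤-refl
  sum-0≤ {suc n} h = 0≤+ (h zero) (sum-0≤ (λ i → h (suc i)))

  sum-mono-≤ : ∀ {n} {f g : Vector ℝ n} → (∀ i → f i ≤ g i) → sum f ≤ sum g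
  sum-mono-≤ {zero}  h = ≤-refl
  sum-mono-≤ {suc n} h = +-mono-≤ (h zero) (sum-mono-≤ (λ i → h (suc i)))

  -- Stands for |x| ≤ D, so that error propagation needs no absolute value on `ℝ`.
  record Within (D x : ℝ) : Set where
    constructor within
    field
      lower : - D ≤ x
      upper : x ≤ D

  open Within public

  within-resp : ∀ {D x y} → x ≈ y → Within D x → Within D y
  within-resp p (within l u) = within (≤-respʳ p l) (≤-respˡ p u)

  within-mono : ∀ {D E x} → D ≤ E → Within D x → Within E x
  within-mono p (within l u) = within (≤-trans (neg-≤ p) l) (≤-trans u p)

  within-0 : ∀ {D} → 0ℝ ≤ D → Within D 0ℝ
  within-0 {D} h = within (≤-via D (solve 1 (λ D → con 0ℚ :- :- D := D) ≈-refl D) h) h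

  within-self : ∀ {D} → 0ℝ ≤ D → Within D D
  within-self {D} h = within (≤-via (D + D) (solve 1 (λ D → D :- :- D := D :+ D) ≈-refl D) (0≤+ h h)) ≤-refl

  within-neg : ∀ {D x} → Within D x → Within D (- x)
  within-neg {D} {x} (within l u) = within (neg-≤ u)
    (≤-respʳ (solve 1 (λ D → :- :- D := D) ≈-refl D) (neg-≤ l))

  within-+ : ∀ {D E x y} → Within D x → Within E y → Within (D + E) (x + y)
  within-+ {D} {E} (within l u) (within l′ u′) = within
    (≤-respˡ (solve 2 (λ D E → :- D :+ :- E := :- (D :+ E)) ≈-refl D E) (+-mono-≤ l l′)) (+-mono-≤ u u′)

  within-- : ∀ {D E x y} → Within D x → Within E y → Within (D + E) (x - y)
  within-- p q = within-+ p (within-neg q)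

  within-bound : ∀ {D x} → Within D x → 0ℝ ≤ D
  within-bound {D} {x} (within l u) = ≤-respʳ
    (solve 2 (λ D x → con ½ :* ((x :- :- D) :+ (D :- x)) := D) ≈-refl D x)
    (0≤* (<⇒≤ 0<½) (0≤+ (≤-diff l) (≤-diff u)))

  -- Both D E - x y and D E + x y are half a sum of two products of the nonnegative numbers D ± x
  -- and E ± y.
  within-* : ∀ {D E x y} → Within D x → Within E y → Within (D * E) (x * y)
  within-* {D} {E} {x} {y} (within l u) (within l′ u′) = within
    (≤-via _ (solve 4 (λ D E x y → x :* y :- :- (D :* E)
        := con ½ :* ((D :- x) :* (E :- y) :+ (x :- :- D) :* (y :- :- E))) ≈-refl D E x y)
      (0≤* (<⇒≤ 0<½) (0≤+ (0≤* (≤-diff u) (≤-diff u′)) (0≤* (≤-diff l) (≤-diff l′)))))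
    (≤-via _ (solve 4 (λ D E x y → D :* E :- x :* y
        := con ½ :* ((D :- x) :* (y :- :- E) :+ (x :- :- D) :* (E :- y))) ≈-refl D E x y)
      (0≤* (<⇒≤ 0<½) (0≤+ (0≤* (≤-diff u) (≤-diff l′)) (0≤* (≤-diff l) (≤-diff u′)))))

  within-sum : ∀ {n} {D f : Vector ℝ n} → (∀ i → Within (D i) (f i)) → Within (sum D) (sum f)
  within-sum {zero}  h = within-0 ≤-refl
  within-sum {suc n} h = within-+ (h zero) (within-sum (λ i → h (suc i)))

-- Linear algebra

sum-0 : ∀ {n} {f : Vector ℝ n} → (∀ i → f i ≈ 0ℝ) → sum f ≈ 0ℝ
sum-0 {n} h = ≈-trans (sum-cong-≋ h) (sum-replicate-zero n)

sum-neg : ∀ {n} (f : Vector ℝ n) → sum (λ i → - f i) ≈ - sum f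
sum-neg {zero}  f = solve 0 (con 0ℚ := :- con 0ℚ) ≈-refl
sum-neg {suc n} f = ≈-trans (+-congˡ (sum-neg (f ∘ suc)))
  (solve 2 (λ x y → :- x :+ :- y := :- (x :+ y)) ≈-refl (f zero) (sum (f ∘ suc)))

dot-cong : ∀ {n} {a b x y : ℝ^ n} → a ≋ b → x ≋ y → a · x ≈ b · y
dot-cong p q = sum-cong-≋ λ i → *-cong (p i) (q i)

dot-congʳ : ∀ {n} (a : ℝ^ n) {x y : ℝ^ n} → x ≋ y → a · x ≈ a · y
dot-congʳ a q = dot-cong {a = a} (λ _ → ≈-refl) q

dot-comm : ∀ {n} (a b : ℝ^ n) → a · b ≈ b · a
dot-comm a b = sum-cong-≋ λ i → *-comm (a i) (b i)

dot-⊕ˡ : ∀ {n} (a b x : ℝ^ n) → (a ⊕ b) · x ≈ a · x + b · x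
dot-⊕ˡ a b x = ≈-trans (sum-cong-≋ λ i → distribʳ (x i) (a i) (b i))
  (∑-distrib-+ (λ i → a i * x i) (λ i → b i * x i))

dot-∙ˡ : ∀ {n} (r : ℝ) (a x : ℝ^ n) → (r ∙ a) · x ≈ r * (a · x)
dot-∙ˡ r a x = ≈-trans (sum-cong-≋ λ i → *-assoc r (a i) (x i))
  (≈-sym (*-distribˡ-sum r (λ i → a i * x i)))

dot-⊕ʳ : ∀ {n} (a x y : ℝ^ n) → a · (x ⊕ y) ≈ a · x + a · y
dot-⊕ʳ a x y = ≈-trans (dot-comm a (x ⊕ y)) (≈-trans (dot-⊕ˡ x y a) (+-cong (dot-comm x a) (dot-comm y a)))

dot-∙ʳ : ∀ {n} (r : ℝ) (a x : ℝ^ n) → a · (r ∙ x) ≈ r * (a · x)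
dot-∙ʳ r a x = ≈-trans (dot-comm a (r ∙ x)) (≈-trans (dot-∙ˡ r x a) (*-congˡ (dot-comm x a)))

dot-𝟎ˡ : ∀ {n} (x : ℝ^ n) → 𝟎 · x ≈ 0ℝ
dot-𝟎ˡ x = sum-0 λ i → zeroˡ (x i)

unit : ∀ {n} → Fin n → ℝ^ n
unit zero    zero    = 1ℝ
unit zero    (suc j) = 0ℝ
unit (suc i) zero    = 0ℝ
unit (suc i) (suc j) = unit i j

unit-same : ∀ {n} (i : Fin n) → unit i i ≡ 1ℝ
unit-same zero    = refl
unit-same (suc i) = unit-same i

unit-punchIn : ∀ {n} (l : Fin (suc n)) j → unit l (punchIn l j) ≡ 0ℝ
unit-punchIn zero    j       = refl
unit-punchIn (suc l) zero    = refl
unit-punchIn (suc l) (suc j) = unit-punchIn l j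

punchIn-unit : ∀ {n} (l : Fin (suc n)) j → unit (punchIn l j) l ≡ 0ℝ
punchIn-unit zero    j       = refl
punchIn-unit (suc l) zero    = refl
punchIn-unit (suc l) (suc j) = punchIn-unit l j

unit-punchIn-punchIn : ∀ {n} (l : Fin (suc n)) j k → unit (punchIn l j) (punchIn l k) ≡ unit j k
unit-punchIn-punchIn zero    j       k       = refl
unit-punchIn-punchIn (suc l) zero    zero    = refl
unit-punchIn-punchIn (suc l) zero    (suc k) = refl
unit-punchIn-punchIn (suc l) (suc j) zero    = refl
unit-punchIn-punchIn (suc l) (suc j) (suc k) = unit-punchIn-punchIn l j k

sum-unit : ∀ {n} (t : ℝ^ n) i → sum (λ k → t k * unit k i) ≈ t i
sum-unit {suc n} t zero = begin
  t zero * 1ℝ + sum (λ k → t (suc k) * 0ℝ) ≈⟨ +-cong (*-identityʳ (t zero)) (sum-0 (λ k → zeroʳ (t (suc k)))) ⟩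
  t zero + 0ℝ                              ≈⟨ +-identityʳ (t zero) ⟩
  t zero                                   ∎
sum-unit {suc n} t (suc i) = begin
  t zero * 0ℝ + sum (λ k → t (suc k) * unit k i) ≈⟨ +-cong (zeroʳ (t zero)) (sum-unit (t ∘ suc) i) ⟩
  0ℝ + t (suc i)                                 ≈⟨ +-identityˡ (t (suc i)) ⟩
  t (suc i)                                      ∎

unit-dot : ∀ {n} (i : Fin n) (x : ℝ^ n) → unit i · x ≈ x i
unit-dot zero    x = ≈-trans (+-cong (*-identityˡ (x zero)) (sum-0 λ k → zeroˡ (x (suc k)))) (+-identityʳ (x zero))
unit-dot (suc i) x = ≈-trans (+-cong (zeroˡ (x zero)) (unit-dot i (x ∘ suc))) (+-identityˡ (x (suc i)))

combination-at : ∀ {k n} (t : ℝ^ k) (v : Vector (ℝ^ n) k) i → combination t v i ≈ sum (λ j → t j * v j i)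
combination-at {zero}  t v i = ≈-refl
combination-at {suc k} t v i = +-congˡ (combination-at (t ∘ suc) (v ∘ suc) i)

dot-combination : ∀ {k n} (a : ℝ^ n) (t : ℝ^ k) v → a · combination t v ≈ sum (λ j → t j * (a · v j))
dot-combination {zero}  a t v = sum-0 λ i → zeroʳ (a i)
dot-combination {suc k} a t v = ≈-trans (dot-⊕ʳ a (t zero ∙ v zero) (combination (t ∘ suc) (v ∘ suc)))
  (+-cong (dot-∙ʳ (t zero) a (v zero)) (dot-combination a (t ∘ suc) (v ∘ suc)))

module LinearAlgebra (em : ExcludedMiddle 0ℓ) where
  open Ordered em

  -- Gaussian elimination without division: if unknown i has coefficient a ≠ 0 in the first
  -- equation, the other unknowns solve the eliminated system M′ and are multiplied by a, and
  -- unknown i is set to -c to satisfy the first equation.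
  kernel : ∀ {k m} → k ℕ.< m → (M : Fin m → Fin k → ℝ) →
           Σ (ℝ^ m) λ t → ¬ (t ≋ 𝟎) × (∀ r → sum (λ i → t i * M i r) ≈ 0ℝ)
  kernel {zero}  {suc m} _ M = (λ _ → 1ℝ) , (λ h → 0<⇒≉0 0<1 (h zero)) , λ ()
  kernel {suc k} {suc m} (ℕ.s≤s k<m) M with em {∃ λ i → ¬ (M i zero ≈ 0ℝ)}
  ... | no ¬pivot =
    let t , t≉𝟎 , ker = kernel (ℕ.m≤n⇒m≤1+n k<m) (λ i r → M i (suc r)) in
    t , t≉𝟎 , λ where
      zero    → sum-0 λ i → ≈-trans (*-congˡ (column i em)) (zeroʳ (t i))
      (suc r) → ker r
    where
    column : ∀ i → Dec (M i zero ≈ 0ℝ) → M i zero ≈ 0ℝ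
    column i (yes p) = p
    column i (no ¬p) = ⊥-elim (¬pivot (i , ¬p))
  ... | yes (i , a≉0) = t , t≉𝟎 , ker
    where
    a = M i zero
    M′ : Fin m → Fin k → ℝ
    M′ j r = a * M (punchIn i j) (suc r) - M (punchIn i j) zero * M i (suc r)
    rec = kernel k<m M′
    s = proj₁ rec
    c = sum (λ j → s j * M (punchIn i j) zero)
    t : ℝ^ (suc m)
    t = insertAt (λ j → a * s j) i (- c)
    tᵢ : t i ≈ - c
    tᵢ = ≈-reflexive (insertAt-lookup (λ j → a * s j) i (- c))
    tⱼ : ∀ j → t (punchIn i j) ≈ a * s j
    tⱼ j = ≈-reflexive (insertAt-punchIn (λ j → a * s j) i (- c) j)
    t≉𝟎 : ¬ (t ≋ 𝟎)
    t≉𝟎 h = proj₁ (proj₂ rec) λ j → *-cancelˡ-0 a≉0 (≈-trans (≈-sym (tⱼ j)) (h (punchIn i j)))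
    expand : ∀ r → sum (λ l → t l * M l r) ≈ - c * M i r + sum (λ j → (a * s j) * M (punchIn i j) r)
    expand r = ≈-trans (sum-remove {i = i} (λ l → t l * M l r))
      (+-cong (*-congʳ tᵢ) (sum-cong-≋ λ j → *-congʳ (tⱼ j)))
    ker : ∀ r → sum (λ l → t l * M l r) ≈ 0ℝ
    ker zero = begin
      sum (λ l → t l * M l zero) ≈⟨ expand zero ⟩
      - c * a + sum (λ j → (a * s j) * M (punchIn i j) zero)
        ≈⟨ +-congˡ (≈-trans (sum-cong-≋ λ j → *-assoc a (s j) (M (punchIn i j) zero)) (≈-sym (*-distribˡ-sum a (λ j → s j * M (punchIn i j) zero)))) ⟩
      - c * a + a * c ≈⟨ solve 2 (λ a c → :- c :* a :+ a :* c := con 0ℚ) ≈-refl a c ⟩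
      0ℝ ∎
    ker (suc r) = begin
      sum (λ l → t l * M l (suc r)) ≈⟨ expand (suc r) ⟩
      - c * M i (suc r) + S ≈⟨ +-congʳ (solve 2 (λ c x → :- c :* x := :- (c :* x)) ≈-refl c (M i (suc r))) ⟩
      - (c * M i (suc r)) + S ≈⟨ +-congʳ (-‿cong (*-distribʳ-sum (M i (suc r)) (λ j → s j * M (punchIn i j) zero))) ⟩
      - sum (λ j → s j * M (punchIn i j) zero * M i (suc r)) + S
        ≈⟨ +-congʳ (sum-neg (λ j → s j * M (punchIn i j) zero * M i (suc r))) ⟨
      sum (λ j → - (s j * M (punchIn i j) zero * M i (suc r))) + S
        ≈⟨ ∑-distrib-+ (λ j → - (s j * M (punchIn i j) zero * M i (suc r))) (λ j → (a * s j) * M (punchIn i j) (suc r)) ⟨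
      sum (λ j → - (s j * M (punchIn i j) zero * M i (suc r)) + (a * s j) * M (punchIn i j) (suc r))
        ≈⟨ sum-cong-≋ (λ j → solve 5 (λ a s p q r → :- (s :* p :* q) :+ (a :* s) :* r := s :* (a :* r :- p :* q)) ≈-refl
             a (s j) (M (punchIn i j) zero) (M i (suc r)) (M (punchIn i j) (suc r))) ⟩
      sum (λ j → s j * M′ j r) ≈⟨ proj₂ (proj₂ rec) r ⟩
      0ℝ ∎
      where S = sum (λ j → (a * s j) * M (punchIn i j) (suc r))

  -- The weights of the p j over q form a matrix with fewer columns than rows. A vector annihilating
  -- its columns annihilates the combination, and also the sum, because the weights of each p j add
  -- up to 1.
  affinely-dependent : ∀ {k m n} (q : Vector (ℝ^ n) k) (p : Vector (ℝ^ n) m) → k ℕ.< m →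
    (∀ i → p i ∈ AffineHull q) → Σ (ℝ^ m) λ t → ¬ (t ≋ 𝟎) × sum t ≈ 0ℝ × combination t p ≋ 𝟎
  affinely-dependent q p k<m hull = t , t≉𝟎 , Σt≈0 , λ i → begin
      combination t p i ≈⟨ combination-at t p i ⟩
      sum (λ j → t j * p j i) ≈⟨ sum-cong-≋ (λ j → *-congˡ (≈-trans (≈-sym (proj₂ (proj₂ (hull j)) i)) (combination-at (M j) q i))) ⟩
      sum (λ j → t j * sum (λ r → M j r * q r i)) ≈⟨ swap (λ r → q r i) ⟩
      sum (λ r → sum (λ j → t j * M j r) * q r i) ≈⟨ sum-0 (λ r → ≈-trans (*-congʳ (ker r)) (zeroˡ _)) ⟩
      0ℝ ∎
    where
    M = λ i → proj₁ (hull i)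
    ker′ = kernel k<m M
    t = proj₁ ker′
    t≉𝟎 = proj₁ (proj₂ ker′)
    ker = proj₂ (proj₂ ker′)
    swap : ∀ f → sum (λ j → t j * sum (λ r → M j r * f r)) ≈ sum (λ r → sum (λ j → t j * M j r) * f r)
    swap f = begin
      sum (λ j → t j * sum (λ r → M j r * f r)) ≈⟨ sum-cong-≋ (λ j → *-distribˡ-sum (t j) (λ r → M j r * f r)) ⟩
      sum (λ j → sum (λ r → t j * (M j r * f r))) ≈⟨ ∑-comm (λ j r → t j * (M j r * f r)) ⟩
      sum (λ r → sum (λ j → t j * (M j r * f r)))
        ≈⟨ sum-cong-≋ (λ r → ≈-trans (sum-cong-≋ λ j → ≈-sym (*-assoc (t j) (M j r) (f r)))
             (≈-sym (*-distribʳ-sum (f r) (λ j → t j * M j r)))) ⟩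
      sum (λ r → sum (λ j → t j * M j r) * f r) ∎
    Σt≈0 : sum t ≈ 0ℝ
    Σt≈0 = begin
      sum t ≈⟨ sum-cong-≋ (λ j → ≈-trans (≈-sym (*-identityʳ (t j))) (*-congˡ (≈-sym
                 (≈-trans (sum-cong-≋ λ r → *-identityʳ (M j r)) (proj₁ (proj₂ (hull j))))))) ⟩
      sum (λ j → t j * sum (λ r → M j r * 1ℝ)) ≈⟨ swap (λ _ → 1ℝ) ⟩
      sum (λ r → sum (λ j → t j * M j r) * 1ℝ) ≈⟨ sum-0 (λ r → ≈-trans (*-congʳ (ker r)) (zeroˡ 1ℝ)) ⟩
      0ℝ ∎

  dimension-≤ : ∀ {n k l} {S : Pred (ℝ^ n) 0ℓ} → HasDimension S k → HasDimension S l → ¬ (k ℕ.< l)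
  dimension-≤ (p , p∈S , _ , S⊆p) (q , q∈S , q-indep , _) k<l =
    let t , t≉𝟎 , Σt≈0 , comb = affinely-dependent p q (ℕ.s≤s k<l) (λ i → S⊆p (q∈S i))
    in t≉𝟎 (q-indep t Σt≈0 comb)

  dimension-unique : ∀ {n k l} {S : Pred (ℝ^ n) 0ℓ} → HasDimension S k → HasDimension S l → k ≡ l
  dimension-unique {k = k} {l} P Q with ℕ.<-cmp k l
  ... | tri< k<l _ _ = ⊥-elim (dimension-≤ P Q k<l)
  ... | tri≈ _ k≡l _ = k≡l
  ... | tri> _ _ l<k = ⊥-elim (dimension-≤ Q P l<k)

  -- A vanishing coefficient at x would leave a dependence among the p alone, so that coefficient
  -- can be divided by.
  dependence-spans : ∀ {n k} (x : ℝ^ n) (p : Vector (ℝ^ n) k) (t : ℝ^ (suc k)) → AffinelyIndependent p →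
    ¬ (t ≋ 𝟎) → sum t ≈ 0ℝ → combination t (x ∷ p) ≋ 𝟎 → x ∈ AffineHull p
  dependence-spans x p t p-indep t≉𝟎 Σt≈0 comb = (λ i → - u * t (suc i)) , sum≈1 , at
    where
    t₀≉0 : ¬ (t zero ≈ 0ℝ)
    t₀≉0 h = t≉𝟎 λ { zero → h ; (suc i) → tail i }
      where
      tail = p-indep (t ∘ suc)
        (≈-trans (≈-sym (≈-trans (+-congʳ h) (+-identityˡ _))) Σt≈0)
        (λ i → ≈-trans (≈-sym (≈-trans (+-congʳ (≈-trans (*-congʳ h) (zeroˡ (x i)))) (+-identityˡ _))) (comb i))
    u = proj₁ (inverse t₀≉0)
    ut₀≈1 = proj₂ (inverse t₀≉0)
    scaled : ∀ X R → t zero * X + R ≈ 0ℝ → - u * R ≈ X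
    scaled X R h = begin
      - u * R ≈⟨ solve 4 (λ u t X R → :- u :* R := u :* t :* X :- u :* (t :* X :+ R)) ≈-refl u (t zero) X R ⟩
      u * t zero * X - u * (t zero * X + R) ≈⟨ +-cong (*-congʳ ut₀≈1) (-‿cong (*-congˡ h)) ⟩
      1ℝ * X - u * 0ℝ ≈⟨ solve 2 (λ u X → con 1ℚ :* X :- u :* con 0ℚ := X) ≈-refl u X ⟩
      X ∎
    sum≈1 : sum (λ i → - u * t (suc i)) ≈ 1ℝ
    sum≈1 = ≈-trans (≈-sym (*-distribˡ-sum (- u) (t ∘ suc)))
      (scaled 1ℝ (sum (t ∘ suc)) (≈-trans (+-congʳ (*-identityʳ (t zero))) Σt≈0))
    at : combination (λ i → - u * t (suc i)) p ≋ x
    at i = begin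
      combination (λ i → - u * t (suc i)) p i ≈⟨ combination-at (λ i → - u * t (suc i)) p i ⟩
      sum (λ j → - u * t (suc j) * p j i) ≈⟨ sum-cong-≋ (λ j → *-assoc (- u) (t (suc j)) (p j i)) ⟩
      sum (λ j → - u * (t (suc j) * p j i)) ≈⟨ *-distribˡ-sum (- u) (λ j → t (suc j) * p j i) ⟨
      - u * sum (λ j → t (suc j) * p j i)
        ≈⟨ scaled (x i) _ (≈-trans (+-congˡ (≈-sym (combination-at (t ∘ suc) p i))) (comb i)) ⟩
      x i ∎

  -- Adjoining any x of S gives k + 2 points in the hull of k + 1, hence a dependence, which must
  -- involve x.
  independent-spans : ∀ {n k} {S : Pred (ℝ^ n) 0ℓ} → HasDimension S k → (p : Vector (ℝ^ n) (suc k)) →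
    (∀ i → p i ∈ S) → AffinelyIndependent p → S ⊆ AffineHull p
  independent-spans (q , q∈S , _ , S⊆q) p p∈S p-indep {x} x∈S =
    let t , t≉𝟎 , Σt≈0 , comb = affinely-dependent q (x ∷ p) ℕ.≤-refl (λ { zero → S⊆q x∈S ; (suc i) → S⊆q (p∈S i) })
    in dependence-spans x p t p-indep t≉𝟎 Σt≈0 comb

  dimension-from-frame : ∀ {n k} {S : Pred (ℝ^ n) 0ℓ} (z : ℝ^ n) (v : Vector (ℝ^ n) k) →
    LinearlyIndependent v → z ∈ S → (∀ i → (z ⊕ v i) ∈ S) →
    (∀ {x} → x ∈ S → ∃ λ t → combination t v ≋ x ⊕ (- 1ℝ) ∙ z) → HasDimension S k
  dimension-from-frame {n} {k} {S} z v v-indep z∈S zv∈S span = p , p∈S , p-indep , spans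
    where
    p : Vector (ℝ^ n) (suc k)
    p zero    = z
    p (suc i) = z ⊕ v i
    p∈S : ∀ i → p i ∈ S
    p∈S zero    = z∈S
    p∈S (suc i) = zv∈S i
    comb-p : ∀ t i → combination t p i ≈ sum t * z i + combination (t ∘ suc) v i
    comb-p t i = begin
      combination t p i ≈⟨ combination-at t p i ⟩
      t zero * z i + sum (λ j → t (suc j) * (z i + v j i))
        ≈⟨ +-congˡ (≈-trans (sum-cong-≋ λ j → distribˡ (t (suc j)) (z i) (v j i))
             (≈-trans (∑-distrib-+ (λ j → t (suc j) * z i) (λ j → t (suc j) * v j i))
             (+-cong (≈-sym (*-distribʳ-sum (z i) (t ∘ suc))) (≈-sym (combination-at (t ∘ suc) v i))))) ⟩
      t zero * z i + (sum (t ∘ suc) * z i + combination (t ∘ suc) v i)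
        ≈⟨ solve 4 (λ t s z c → t :* z :+ (s :* z :+ c) := (t :+ s) :* z :+ c) ≈-refl
             (t zero) (sum (t ∘ suc)) (z i) (combination (t ∘ suc) v i) ⟩
      sum t * z i + combination (t ∘ suc) v i ∎
    p-indep : AffinelyIndependent p
    p-indep t Σt≈0 comb = λ { zero → t₀ ; (suc i) → tail i }
      where
      tail : t ∘ suc ≋ 𝟎
      tail = v-indep (t ∘ suc) λ i → begin
        combination (t ∘ suc) v i ≈⟨ solve 2 (λ z c → c := con 0ℚ :* z :+ c) ≈-refl (z i) (combination (t ∘ suc) v i) ⟩
        0ℝ * z i + combination (t ∘ suc) v i ≈⟨ +-congʳ (*-congʳ Σt≈0) ⟨
        sum t * z i + combination (t ∘ suc) v i ≈⟨ comb-p t i ⟨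
        combination t p i ≈⟨ comb i ⟩
        0ℝ ∎
      t₀ : t zero ≈ 0ℝ
      t₀ = begin
        t zero ≈⟨ +-identityʳ (t zero) ⟨
        t zero + 0ℝ ≈⟨ +-congˡ (sum-0 tail) ⟨
        sum t ≈⟨ Σt≈0 ⟩
        0ℝ ∎
    spans : S ⊆ AffineHull p
    spans {x} x∈S = let t , e = span x∈S
                        t₀ = 1ℝ - sum t
                        Σ≈1 = solve 1 (λ s → con 1ℚ :- s :+ s := con 1ℚ) ≈-refl (sum t)
      in (t₀ ∷ t) , Σ≈1 , λ i → begin
        combination (t₀ ∷ t) p i ≈⟨ comb-p (t₀ ∷ t) i ⟩
        (t₀ + sum t) * z i + combination t v i ≈⟨ +-cong (*-congʳ Σ≈1) (e i) ⟩
        1ℝ * z i + (x i + - 1ℝ * z i)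
          ≈⟨ solve 2 (λ z x → con 1ℚ :* z :+ (x :+ :- con 1ℚ :* z) := x) ≈-refl (z i) (x i) ⟩
        x i ∎

-- Facets of an irredundant system of inequalities

module Irredundancy (em : ExcludedMiddle 0ℓ) where
  open Ordered em
  open LinearAlgebra em

  positive-lower-bound : ∀ {n} {f : Vector ℝ n} → (∀ i → 0ℝ < f i) → Σ ℝ λ δ → 0ℝ < δ × (∀ i → δ ≤ f i)
  positive-lower-bound {zero}      h = 1ℝ , 0<1 , λ ()
  positive-lower-bound {suc n} {f} h with positive-lower-bound (h ∘ suc)
  ... | δ , 0<δ , δ≤ with ≤-total δ (f zero)
  ...   | inj₁ p = δ , 0<δ , λ { zero → p ; (suc i) → δ≤ i }
  ...   | inj₂ p = f zero , h zero , λ { zero → ≤-refl ; (suc i) → ≤-trans p (δ≤ i) }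

  small-multiple : ∀ {s} e → 0ℝ < s → Σ ℝ λ δ → 0ℝ < δ × (∀ {ε} → 0ℝ < ε → ε ≤ δ → ε * e ≤ s)
  small-multiple {s} e 0<s with ≤-total e 0ℝ
  ... | inj₁ e≤0 = 1ℝ , 0<1 , λ {ε} 0<ε _ → ≤-trans
    (≤-respʳ (zeroʳ ε) (*-monoˡ-≤ (<⇒≤ 0<ε) e≤0)) (<⇒≤ 0<s)
  ... | inj₂ 0≤e with em {e ≈ 0ℝ}
  ...   | yes e≈0 = 1ℝ , 0<1 , λ {ε} _ _ → ≤-trans (≈⇒≤ (≈-trans (*-congˡ e≈0) (zeroʳ ε))) (<⇒≤ 0<s)
  ...   | no e≉0 = let u , ue≈1 = inverse e≉0
                       δe≈s = ≈-trans (*-assoc s u e) (≈-trans (*-congˡ ue≈1) (*-identityʳ s))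
                       0<e = ≤∧≉⇒< 0≤e (e≉0 ∘ ≈-sym)
    in s * u , (λ δ≤0 → 0<s (≤-respˡ δe≈s (≤-respˡ (*-comm e (s * u)) (≤-respʳ (zeroʳ e) (*-monoˡ-≤ 0≤e δ≤0)))))
     , λ {ε} _ ε≤δ → ≤-respʳ δe≈s (≤-respʳ (*-comm e (s * u)) (≤-respˡ (*-comm e ε) (*-monoˡ-≤ 0≤e ε≤δ)))

  dot-self-0 : ∀ {n} (a : ℝ^ n) → a · a ≤ 0ℝ → a ≋ 𝟎
  dot-self-0 {suc n} a h = λ where
      zero    → x²≈0 (≤-antisym (≤-trans (≤-via (tail²) (solve 2 (λ x y → (x :+ y) :- x := y) ≈-refl (a zero * a zero) tail²) 0≤tail²) h) (0≤x² (a zero)))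
      (suc i) → dot-self-0 (a ∘ suc) (≤-trans (≤-via (a zero * a zero) (solve 2 (λ x y → (x :+ y) :- y := x) ≈-refl (a zero * a zero) tail²) (0≤x² (a zero))) h) i
    where
    tail² = (a ∘ suc) · (a ∘ suc)
    0≤tail² : 0ℝ ≤ tail²
    0≤tail² = sum-0≤ (λ i → 0≤x² (a (suc i)))

  module _ {n} (P : Polytope n) where
    open Polytope P using (m; A; b)

    -- Each inequality either has room at x or is unaffected by moving along v; both guarantee a
    -- positive step length.
    FeasibleDirection : ℝ^ n → ℝ^ n → Set
    FeasibleDirection x v = ∀ j → A j · x ≤ b j × (A j · x < b j ⊎ A j · v ≈ 0ℝ)

    feasible-step : ∀ {x v} → FeasibleDirection x v →
      Σ ℝ λ δ → 0ℝ < δ × (∀ {ε} → 0ℝ < ε → ε ≤ δ → (x ⊕ ε ∙ v) ∈ Points P)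
    feasible-step {x} {v} h =
      let δ , 0<δ , δ≤ = positive-lower-bound (λ j → proj₁ (proj₂ (each j)))
      in δ , 0<δ , λ 0<ε ε≤δ j → proj₂ (proj₂ (each j)) 0<ε (≤-trans ε≤δ (δ≤ j))
      where
      value : ∀ ε j → A j · (x ⊕ ε ∙ v) ≈ A j · x + ε * (A j · v)
      value ε j = ≈-trans (dot-⊕ʳ (A j) x (ε ∙ v)) (+-congˡ (dot-∙ʳ ε (A j) v))
      each : ∀ j → Σ ℝ λ δ → 0ℝ < δ × (∀ {ε} → 0ℝ < ε → ε ≤ δ → A j · (x ⊕ ε ∙ v) ≤ b j)
      each j with h j
      ... | _ , inj₁ slack = let δ , 0<δ , small = small-multiple (A j · v) (<-diff slack)
        in δ , 0<δ , λ {ε} 0<ε ε≤δ → ≤-respˡ (≈-sym (value ε j)) (≤-via (b j - A j · x - ε * (A j · v))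
          (solve 3 (λ b x y → b :- (x :+ y) := b :- x :- y) ≈-refl (b j) (A j · x) (ε * (A j · v)))
          (≤-diff (small 0<ε ε≤δ)))
      ... | tight , inj₂ A·v≈0 = 1ℝ , 0<1 , λ {ε} _ _ → ≤-respˡ (≈-sym (≈-trans (value ε j)
        (≈-trans (+-congˡ (≈-trans (*-congˡ A·v≈0) (zeroʳ ε))) (+-identityʳ (A j · x))))) tight

    feasible-steps : ∀ {k x} {v : Vector (ℝ^ n) k} → (∀ i → FeasibleDirection x (v i)) →
      Σ ℝ λ ε → 0ℝ < ε × (∀ i → (x ⊕ ε ∙ v i) ∈ Points P)
    feasible-steps h =
      let ε , 0<ε , ε≤ = positive-lower-bound (λ i → proj₁ (proj₂ (feasible-step (h i))))
      in ε , 0<ε , λ i → proj₂ (proj₂ (feasible-step (h i))) 0<ε (ε≤ i)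

  -- A certificate by points: tight at one inequality and strict at all others. It suffices to
  -- identify the facets with the inequalities, without computing any face explicitly.
  record Irredundant {n} (P : Polytope n) : Set where
    open Polytope P using (m; A; b)
    field
      interior         : ℝ^ n
      interior-slack   : ∀ j → A j · interior < b j
      facet-point      : Fin m → ℝ^ n
      facet-point-tight : ∀ j → A j · facet-point j ≈ b j
      facet-point-slack : ∀ {i j} → i ≢ j → A i · facet-point j < b i

  scaled-comb : ∀ {n k} ε (t : ℝ^ k) (v : Vector (ℝ^ n) k) i →
    combination t (λ j → ε ∙ v j) i ≈ ε * sum (λ j → t j * v j i)
  scaled-comb ε t v i = begin
    combination t (λ j → ε ∙ v j) i ≈⟨ combination-at t (λ j → ε ∙ v j) i ⟩
    sum (λ j → t j * (ε * v j i))
      ≈⟨ sum-cong-≋ (λ j → solve 3 (λ t ε v → t :* (ε :* v) := ε :* (t :* v)) ≈-refl (t j) ε (v j i)) ⟩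
    sum (λ j → ε * (t j * v j i)) ≈⟨ *-distribˡ-sum ε (λ j → t j * v j i) ⟨
    ε * sum (λ j → t j * v j i) ∎

  module _ {d} {P : Polytope (suc d)} (irr : Irredundant P) where
    open Polytope P using (m; A; b)
    open Irredundant irr

    facet-point∈ : ∀ j → facet-point j ∈ Points P
    facet-point∈ j i with i ≟ j
    ... | yes refl = ≈⇒≤ (facet-point-tight i)
    ... | no i≢j   = <⇒≤ (facet-point-slack i≢j)

    full-dimensional : HasDimension (Points P) (suc d)
    full-dimensional =
      let ε , 0<ε , steps = feasible-steps P {x = interior} {v = unit} (λ i j → <⇒≤ (interior-slack j) , inj₁ (interior-slack j))
          ε≉0 = 0<⇒≉0 0<ε
          u , uε≈1 = inverse ε≉0
          comb : ∀ t i → combination t (λ j → ε ∙ unit j) i ≈ ε * t i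
          comb t i = ≈-trans (scaled-comb ε t unit i) (*-congˡ (sum-unit t i))
      in dimension-from-frame interior (λ i → ε ∙ unit i)
        (λ t h i → *-cancelˡ-0 ε≉0 (≈-trans (≈-sym (comb t i)) (h i)))
        (λ j → <⇒≤ (interior-slack j)) steps
        (λ {x} _ → (λ i → u * (x i + - 1ℝ * interior i)) , λ i → ≈-trans (comb (λ i → u * (x i + - 1ℝ * interior i)) i)
          (≈-trans (solve 3 (λ ε u y → ε :* (u :* y) := u :* ε :* y) ≈-refl ε u (x i + - 1ℝ * interior i))
            (≈-trans (*-congʳ uε≈1) (*-identityˡ _))))

    Face-tight : ∀ j x → x ∈ Face P (A j) → A j · x ≈ b j
    Face-tight j x (x∈P , max) = ≤-antisym (x∈P j)
      (≤-respˡ (facet-point-tight j) (max (facet-point j) (facet-point∈ j)))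

    tight-Face : ∀ j x → x ∈ Points P → A j · x ≈ b j → x ∈ Face P (A j)
    tight-Face j x x∈P tight = x∈P , λ y y∈P → ≤-respʳ (≈-sym tight) (y∈P j)

    -- An inequality with zero normal could not be tight at one point and strict at another.
    normal≉𝟎 : ∀ j → ¬ (A j ≋ 𝟎)
    normal≉𝟎 j h = interior-slack j (≈⇒≤ (≈-trans (≈-sym (facet-point-tight j))
      (≈-trans (zero-value (facet-point j)) (≈-sym (zero-value interior)))))
      where
      zero-value : ∀ x → A j · x ≈ 0ℝ
      zero-value x = ≈-trans (dot-cong {a = A j} {b = 𝟎} {x = x} {y = x} h (λ _ → ≈-refl)) (dot-𝟎ˡ x)

    -- At the facet point only inequality j is tight, so every direction orthogonal to A j can be
    -- followed a little in P without leaving the face.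
    face-dimension : ∀ j → HasDimension (Face P (A j)) d
    face-dimension j =
      let l , pivot≉0 = ¬∀⟶∃¬ (suc d) (λ i → A j i ≈ 0ℝ) (λ _ → em) (normal≉𝟎 j) in at l pivot≉0
      where
      at : ∀ l → ¬ (A j l ≈ 0ℝ) → HasDimension (Face P (A j)) d
      at l pivot≉0 =
        let ε , 0<ε , steps = feasible-steps P {x = z} {v = v} feasible
            εp≉0 = λ e → pivot≉0 (*-cancelˡ-0 (0<⇒≉0 0<ε) e)
            u , uεp≈1 = inverse εp≉0
        in dimension-from-frame z (λ i → ε ∙ v i)
          (λ t h i → *-cancelˡ-0 εp≉0 (≈-trans (≈-sym (comb-off ε t i)) (h (punchIn l i))))
          (tight-Face j z (facet-point∈ j) (facet-point-tight j))
          (λ i → tight-Face j (z ⊕ ε ∙ v i) (steps i) (≈-trans (dot-⊕ʳ (A j) z (ε ∙ v i))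
            (≈-trans (+-cong (facet-point-tight j) (≈-trans (dot-∙ʳ ε (A j) (v i)) (≈-trans (*-congˡ (normal-v i)) (zeroʳ ε))))
              (+-identityʳ (b j)))))
          (λ {x} x∈F → (λ i → u * off (x ⊕ - 1ℝ ∙ z) i) , span ε u uεp≈1 x x∈F)
        where
        z = facet-point j
        a = A j l
        off : ℝ^ (suc d) → ℝ^ d
        off y i = y (punchIn l i)
        -- Trading coordinate l against another one keeps A j constant. Away from l these vectors
        -- form a multiple of the identity matrix, which shows independence; coordinate l of a
        -- displacement in the face is then forced by A j · y = 0.
        v : Vector (ℝ^ (suc d)) d
        v i = a ∙ unit (punchIn l i) ⊕ (- A j (punchIn l i)) ∙ unit l
        normal-v : ∀ i → A j · v i ≈ 0ℝ
        normal-v i = begin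
          A j · v i ≈⟨ dot-⊕ʳ (A j) (a ∙ unit (punchIn l i)) ((- A j (punchIn l i)) ∙ unit l) ⟩
          A j · (a ∙ unit (punchIn l i)) + A j · ((- A j (punchIn l i)) ∙ unit l)
            ≈⟨ +-cong (dot-∙ʳ a (A j) (unit (punchIn l i))) (dot-∙ʳ (- A j (punchIn l i)) (A j) (unit l)) ⟩
          a * (A j · unit (punchIn l i)) + - A j (punchIn l i) * (A j · unit l)
            ≈⟨ +-cong (*-congˡ (dot-unit (punchIn l i))) (*-congˡ (dot-unit l)) ⟩
          a * A j (punchIn l i) + - A j (punchIn l i) * a
            ≈⟨ solve 2 (λ a b → a :* b :+ :- b :* a := con 0ℚ) ≈-refl a (A j (punchIn l i)) ⟩
          0ℝ ∎
          where
          dot-unit : ∀ k → A j · unit k ≈ A j k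
          dot-unit k = ≈-trans (dot-comm (A j) (unit k)) (unit-dot k (A j))
        feasible : ∀ i → FeasibleDirection P z (v i)
        feasible i k with k ≟ j
        ... | yes refl = ≈⇒≤ (facet-point-tight k) , inj₂ (normal-v i)
        ... | no k≢j = <⇒≤ (facet-point-slack k≢j) , inj₁ (facet-point-slack k≢j)
        comb-off : ∀ ε t i → combination t (λ i → ε ∙ v i) (punchIn l i) ≈ ε * a * t i
        comb-off ε t i = begin
          combination t (λ i → ε ∙ v i) (punchIn l i) ≈⟨ scaled-comb ε t v (punchIn l i) ⟩
          ε * sum (λ k → t k * (a * unit (punchIn l k) (punchIn l i) + - A j (punchIn l k) * unit l (punchIn l i)))
            ≈⟨ *-congˡ (sum-cong-≋ λ k → *-congˡ (+-cong (*-congˡ (≈-reflexive (unit-punchIn-punchIn l k i)))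
                 (*-congˡ (≈-reflexive (unit-punchIn l i))))) ⟩
          ε * sum (λ k → t k * (a * unit k i + - A j (punchIn l k) * 0ℝ))
            ≈⟨ *-congˡ (sum-cong-≋ λ k → solve 4 (λ t a u b → t :* (a :* u :+ :- b :* con 0ℚ) := a :* (t :* u)) ≈-refl
                 (t k) a (unit k i) (A j (punchIn l k))) ⟩
          ε * sum (λ k → a * (t k * unit k i)) ≈⟨ *-congˡ (*-distribˡ-sum a (λ k → t k * unit k i)) ⟨
          ε * (a * sum (λ k → t k * unit k i)) ≈⟨ *-congˡ (*-congˡ (sum-unit t i)) ⟩
          ε * (a * t i) ≈⟨ *-assoc ε a (t i) ⟨
          ε * a * t i ∎
        comb-at : ∀ ε t → combination t (λ i → ε ∙ v i) l ≈ - (ε * sum (λ k → t k * A j (punchIn l k)))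
        comb-at ε t = begin
          combination t (λ i → ε ∙ v i) l ≈⟨ scaled-comb ε t v l ⟩
          ε * sum (λ k → t k * (a * unit (punchIn l k) l + - A j (punchIn l k) * unit l l))
            ≈⟨ *-congˡ (sum-cong-≋ λ k → *-congˡ (+-cong (*-congˡ (≈-reflexive (punchIn-unit l k)))
                 (*-congˡ (≈-reflexive (unit-same l))))) ⟩
          ε * sum (λ k → t k * (a * 0ℝ + - A j (punchIn l k) * 1ℝ))
            ≈⟨ *-congˡ (sum-cong-≋ λ k → solve 3 (λ t a b → t :* (a :* con 0ℚ :+ :- b :* con 1ℚ) := :- (t :* b)) ≈-refl
                 (t k) a (A j (punchIn l k))) ⟩
          ε * sum (λ k → - (t k * A j (punchIn l k))) ≈⟨ *-congˡ (sum-neg (λ k → t k * A j (punchIn l k))) ⟩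
          ε * - sum (λ k → t k * A j (punchIn l k)) ≈⟨ solve 2 (λ x y → x :* :- y := :- (x :* y)) ≈-refl ε _ ⟩
          - (ε * sum (λ k → t k * A j (punchIn l k))) ∎
        span : ∀ ε u → u * (ε * a) ≈ 1ℝ → ∀ x → x ∈ Face P (A j) →
               combination (λ i → u * off (x ⊕ - 1ℝ ∙ z) i) (λ i → ε ∙ v i) ≋ x ⊕ - 1ℝ ∙ z
        span ε u uεa≈1 x x∈F = split
          where
          y = x ⊕ - 1ℝ ∙ z
          t : ℝ^ d
          t i = u * off y i
          off-case : ∀ i → combination t (λ i → ε ∙ v i) (punchIn l i) ≈ y (punchIn l i)
          off-case i = begin
            combination t (λ i → ε ∙ v i) (punchIn l i) ≈⟨ comb-off ε t i ⟩
            ε * a * (u * y (punchIn l i)) ≈⟨ solve 3 (λ ea u y → ea :* (u :* y) := u :* ea :* y) ≈-refl (ε * a) u (y (punchIn l i)) ⟩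
            u * (ε * a) * y (punchIn l i) ≈⟨ *-congʳ uεa≈1 ⟩
            1ℝ * y (punchIn l i) ≈⟨ *-identityˡ _ ⟩
            y (punchIn l i) ∎
          A·y≈0 : a * y l + sum (λ k → A j (punchIn l k) * y (punchIn l k)) ≈ 0ℝ
          A·y≈0 = begin
            a * y l + sum (λ k → A j (punchIn l k) * y (punchIn l k)) ≈⟨ sum-remove {i = l} (λ k → A j k * y k) ⟨
            A j · y ≈⟨ dot-⊕ʳ (A j) x (- 1ℝ ∙ z) ⟩
            A j · x + A j · (- 1ℝ ∙ z) ≈⟨ +-cong (Face-tight j x x∈F) (≈-trans (dot-∙ʳ (- 1ℝ) (A j) z) (*-congˡ (facet-point-tight j))) ⟩
            b j + - 1ℝ * b j ≈⟨ solve 1 (λ b → b :+ :- con 1ℚ :* b := con 0ℚ) ≈-refl (b j) ⟩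
            0ℝ ∎
          S = sum (λ k → A j (punchIn l k) * y (punchIn l k))
          at-case : combination t (λ i → ε ∙ v i) l ≈ y l
          at-case = begin
            combination t (λ i → ε ∙ v i) l ≈⟨ comb-at ε t ⟩
            - (ε * sum (λ k → u * y (punchIn l k) * A j (punchIn l k)))
              ≈⟨ -‿cong (*-congˡ (≈-trans (sum-cong-≋ λ k → solve 3 (λ u y b → u :* y :* b := u :* (b :* y)) ≈-refl
                   u (y (punchIn l k)) (A j (punchIn l k))) (≈-sym (*-distribˡ-sum u (λ k → A j (punchIn l k) * y (punchIn l k)))))) ⟩
            - (ε * (u * S)) ≈⟨ solve 5 (λ ε u a y S → :- (ε :* (u :* S)) := u :* (ε :* a) :* y :- ε :* u :* (a :* y :+ S)) ≈-refl ε u a (y l) S ⟩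
            u * (ε * a) * y l - ε * u * (a * y l + S) ≈⟨ +-cong (*-congʳ uεa≈1) (-‿cong (*-congˡ A·y≈0)) ⟩
            1ℝ * y l - ε * u * 0ℝ ≈⟨ solve 2 (λ y e → con 1ℚ :* y :- e :* con 0ℚ := y) ≈-refl (y l) (ε * u) ⟩
            y l ∎
          split : combination t (λ i → ε ∙ v i) ≋ y
          split k with l ≟ k
          ... | yes refl = at-case
          ... | no l≢k = ≡.subst (λ k → combination t (λ i → ε ∙ v i) k ≈ y k) (punchIn-punchOut l≢k) (off-case _)

  HasDimension-resp : ∀ {n k} {S T : Pred (ℝ^ n) 0ℓ} → S ⊆ T → T ⊆ S → HasDimension S k → HasDimension T k
  HasDimension-resp S⊆T T⊆S (p , p∈S , indep , hull) = p , (λ i → S⊆T {p i} (p∈S i)) , indep , λ {x} x∈T → hull {x} (T⊆S {x} x∈T)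

  dot-constant-on-hull : ∀ {n k} (a : ℝ^ n) M (p : Vector (ℝ^ n) k) → (∀ i → a · p i ≈ M) →
                         ∀ x → x ∈ AffineHull p → a · x ≈ M
  dot-constant-on-hull a M p const x (t , Σt≈1 , comb) = begin
    a · x                         ≈⟨ dot-congʳ a comb ⟨
    a · combination t p           ≈⟨ dot-combination a t p ⟩
    sum (λ i → t i * (a · p i))   ≈⟨ sum-cong-≋ (λ i → *-congˡ (const i)) ⟩
    sum (λ i → t i * M)           ≈⟨ *-distribʳ-sum M t ⟨
    sum t * M                     ≈⟨ *-congʳ Σt≈1 ⟩
    1ℝ * M                        ≈⟨ *-identityˡ M ⟩
    M                             ∎

  midpoint : ∀ {n} → ℝ^ n → ℝ^ n → ℝ^ n
  midpoint x y = ½ℝ ∙ x ⊕ ½ℝ ∙ y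

  dot-midpoint : ∀ {n} (a x y : ℝ^ n) → a · midpoint x y ≈ ½ℝ * (a · x) + ½ℝ * (a · y)
  dot-midpoint a x y = ≈-trans (dot-⊕ʳ a (½ℝ ∙ x) (½ℝ ∙ y)) (+-cong (dot-∙ʳ ½ℝ a x) (dot-∙ʳ ½ℝ a y))

  average-≤ : ∀ {x y z} → x ≤ z → y ≤ z → ½ℝ * x + ½ℝ * y ≤ z
  average-≤ {x} {y} {z} p q = ≤-via (½ℝ * ((z - x) + (z - y)))
    (solve 3 (λ x y z → z :- (con ½ :* x :+ con ½ :* y) := con ½ :* ((z :- x) :+ (z :- y))) ≈-refl x y z)
    (0≤* (<⇒≤ 0<½) (0≤+ (≤-diff p) (≤-diff q)))

  ≤-average : ∀ {x y z} → z ≤ x → z ≤ y → z ≤ ½ℝ * x + ½ℝ * y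
  ≤-average {x} {y} {z} p q = ≤-via (½ℝ * ((x - z) + (y - z)))
    (solve 3 (λ x y z → (con ½ :* x :+ con ½ :* y) :- z := con ½ :* ((x :- z) :+ (y :- z))) ≈-refl x y z)
    (0≤* (<⇒≤ 0<½) (0≤+ (≤-diff p) (≤-diff q)))

  average-< : ∀ {x y z} → x < z → y ≤ z → ½ℝ * x + ½ℝ * y < z
  average-< {x} {y} {z} p q = <-via (½ℝ * ((z - x) + (z - y)))
    (solve 3 (λ x y z → z :- (con ½ :* x :+ con ½ :* y) := con ½ :* ((z :- x) :+ (z :- y))) ≈-refl x y z)
    (0<* 0<½ (0<+≤ (<-diff p) (≤-diff q)))

  module _ {n} (P : Polytope n) where
    open Polytope P using (m; A; b)

    midpoint∈Face : ∀ a x y → x ∈ Face P a → y ∈ Face P a → midpoint x y ∈ Face P a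
    midpoint∈Face a x y (x∈P , x-max) (y∈P , y-max) =
      (λ j → ≤-respˡ (≈-sym (dot-midpoint (A j) x y)) (average-≤ (x∈P j) (y∈P j))) ,
      λ z z∈P → ≤-respʳ (≈-sym (dot-midpoint a x y)) (≤-average (x-max z z∈P) (y-max z z∈P))

    -- A midpoint is strict wherever one of its endpoints is, so the separate witnesses merge into
    -- one point of the face.
    common-slack : ∀ a x → x ∈ Face P a → ∀ {k} (f : Fin k → Fin m) →
      (∀ i → ∃ λ y → y ∈ Face P a × A (f i) · y < b (f i)) →
      ∃ λ y → y ∈ Face P a × (∀ i → A (f i) · y < b (f i))
    common-slack a x x∈F {zero}  f h = x , x∈F , λ ()
    common-slack a x x∈F {suc k} f h =
      let y , y∈F , y-slack = common-slack a x x∈F (f ∘ suc) (h ∘ suc)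
          z , z∈F , z-slack = h zero
      in midpoint z y , midpoint∈Face a z y z∈F y∈F , λ where
        zero    → <-respˡ (≈-sym (dot-midpoint (A (f zero)) z y)) (average-< z-slack (proj₁ y∈F (f zero)))
        (suc i) → <-respˡ (≈-sym (≈-trans (dot-midpoint (A (f (suc i))) z y) (+-comm _ _)))
                    (average-< (y-slack i) (proj₁ z∈F (f (suc i))))

    -- A step of length δ along a itself raises the objective by δ (a · a), and the maximum forbids
    -- a positive gain.
    interior-maximizer⇒𝟎 : ∀ a x → x ∈ Face P a → (∀ j → A j · x < b j) → a ≋ 𝟎
    interior-maximizer⇒𝟎 a x (x∈P , x-max) slack =
      let δ , 0<δ , step = feasible-step P {x = x} {v = a} (λ j → x∈P j , inj₁ (slack j))
          value = ≈-trans (dot-⊕ʳ a x (δ ∙ a)) (+-congˡ (dot-∙ʳ δ a a))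
      in dot-self-0 a (*-cancelˡ-≤ 0<δ (≤-respʳ (≈-sym (zeroʳ δ))
        (≤-via (a · x - (a · x + δ * (a · a)))
          (solve 2 (λ x y → con 0ℚ :- y := x :- (x :+ y)) ≈-refl (a · x) (δ * (a · a)))
          (≤-diff (≤-respˡ value (x-max (x ⊕ δ ∙ a) (step 0<δ ≤-refl)))))))

    Face-𝟎 : ∀ a → a ≋ 𝟎 → Points P ⊆ Face P a
    Face-𝟎 a a≋𝟎 {x} x∈P = x∈P , λ y _ → ≈⇒≤ (≈-trans (value y) (≈-sym (value x)))
      where
      value : ∀ y → a · y ≈ 0ℝ
      value y = ≈-trans (dot-cong {a = a} {b = 𝟎} {x = y} {y = y} a≋𝟎 (λ _ → ≈-refl)) (dot-𝟎ˡ y)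

  module _ {d} {P : Polytope (suc d)} (irr : Irredundant P) where
    open Polytope P using (m; A; b)
    open Irredundant irr

    -- Otherwise each inequality is strict somewhere on the face, hence all are strict at one common
    -- point. Then a vanishes, the face is all of P, and its dimension would be both k and k + 1.
    facet⊆some : ∀ a → IsFacet P (Face P a) → ∃ λ j → ∀ x → x ∈ Face P a → A j · x ≈ b j
    facet⊆some a (k , dimP , dimF) with em {∃ λ j → ∀ x → x ∈ Face P a → A j · x ≈ b j}
    ... | yes h = h
    ... | no ¬h = ⊥-elim (ℕ.1+n≢n (dimension-unique dimP (HasDimension-resp (λ {x} x∈F → proj₁ x∈F) (λ {x} x∈P → Face-𝟎 P a a≋𝟎 {x} x∈P) dimF)))
      where
      slack : ∀ j → ∃ λ x → x ∈ Face P a × A j · x < b j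
      slack j with em {∃ λ x → x ∈ Face P a × A j · x < b j}
      ... | yes s = s
      ... | no ¬s = ⊥-elim (¬h (j , λ x x∈F → ≤-antisym (proj₁ x∈F j) (≮⇒≥ λ lt → ¬s (x , x∈F , lt))))
      interior-max : ∃ λ y → y ∈ Face P a × (∀ i → A i · y < b i)
      interior-max = common-slack P a (proj₁ dimF zero) (proj₁ (proj₂ dimF) zero) (λ i → i) slack
      a≋𝟎 : a ≋ 𝟎
      a≋𝟎 = interior-maximizer⇒𝟎 P a (proj₁ interior-max) (proj₁ (proj₂ interior-max)) (proj₂ (proj₂ interior-max))

    -- Both faces have dimension d and one contains the other, so an affine basis p of the smaller
    -- spans the larger; a is constant on p and therefore on its hull.
    tight-facet⊆ : ∀ a j → HasDimension (Face P a) d → (∀ x → x ∈ Face P a → A j · x ≈ b j) →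
                   Face P (A j) ⊆ Face P a
    tight-facet⊆ a j (p , p∈F , p-indep , _) tight {x} x∈Fj = proj₁ x∈Fj , λ y y∈P →
      ≤-respʳ (≈-sym (dot-constant-on-hull a (a · p zero) p const x hull)) (proj₂ (p∈F zero) y y∈P)
      where
      const : ∀ i → a · p i ≈ a · p zero
      const i = ≤-antisym (proj₂ (p∈F zero) (p i) (proj₁ (p∈F i))) (proj₂ (p∈F i) (p zero) (proj₁ (p∈F zero)))
      hull : x ∈ AffineHull p
      hull = independent-spans (face-dimension irr j) p
        (λ i → tight-Face irr j (p i) (proj₁ (p∈F i)) (tight (p i) (p∈F i))) p-indep {x} x∈Fj

    facet-name : Fin m → Σ (ℝ^ (suc d)) λ a → IsFacet P (Face P a)
    facet-name j = A j , d , full-dimensional irr , face-dimension irr j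

    facets : HasCardinality (Facets P) m
    facets = record
      { to        = facet-name
      ; cong      = λ { refl → (λ {x} x∈F → x∈F) , (λ {x} x∈F → x∈F) }
      ; bijective = injective , surjective
      }
      where
      injective : ∀ {i j} → Face P (A i) ≐ Face P (A j) → i ≡ j
      injective {i} {j} (i⊆j , _) with j ≟ i
      ... | yes refl = refl
      ... | no j≢i = ⊥-elim (facet-point-slack j≢i (≈⇒≤ (≈-sym (Face-tight irr j (facet-point i)
        (i⊆j {facet-point i} (tight-Face irr i (facet-point i) (facet-point∈ irr i) (facet-point-tight i)))))))
      surjective : ∀ F → ∃ λ j → ∀ {i} → i ≡ j → Face P (A i) ≐ Face P (proj₁ F)
      surjective (a , k , dimP , dimF) = at (facet⊆some a (k , dimP , dimF)) (ℕ.suc-injective (dimension-unique dimP (full-dimensional irr)))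
        where
        at : (∃ λ j → ∀ x → x ∈ Face P a → A j · x ≈ b j) → k ≡ d → ∃ λ j → ∀ {i} → i ≡ j → Face P (A i) ≐ Face P a
        at (j , tight) refl = j , λ { refl → (λ {x} x∈F → tight-facet⊆ a j dimF tight {x} x∈F) , λ {x} x∈F → tight-Face irr j x (proj₁ x∈F) (tight x x∈F) }

¼ : ℚ
¼ = + 1 ℚ./ 4

¼ℝ : ℝ
¼ℝ = fromℚ ¼

0<¼ : 0ℝ < ¼ℝ
0<¼ = fromℚ-< (ℚ.positive⁻¹ ¼)

-- The chain of tent maps

-- The weights 4^(m-1), ..., 4, 1. The ratio 4 matches the recursion of `target`, which doubles the
-- sum of a weight and the previous target.
ω : ∀ m → ℝ^ m
ω (suc m) zero    = pow 4ℝ m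
ω (suc m) (suc k) = ω m k

sg : Fin 2 → ℝ
sg zero    = 1ℝ
sg (suc _) = - 1ℝ

sg² : ∀ σ → sg σ * sg σ ≈ 1ℝ
sg² zero    = solve 0 (con 1ℚ :* con 1ℚ := con 1ℚ) ≈-refl
sg² (suc _) = solve 0 (:- con 1ℚ :* :- con 1ℚ := con 1ℚ) ≈-refl

-- Both inequalities link u k σ ≤ 1 together say u_{k+1} ≤ 1 − 2 ∣u_k∣.
link : ∀ {d} → ℝ^ (suc d) → Fin d → Fin 2 → ℝ
link u k σ = u (suc k) + 2ℝ * sg σ * u (inject₁ k)

-- Built backwards from u_{d-1} = 0, u_d = 1 at the apex of the last tent: each sign picks one of
-- the two preimages under the tent map.
chain-vertex : ∀ n → (Fin n → Fin 2) → ℝ^ (suc (suc n))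
chain-vertex zero    b = 0ℝ ∷ 1ℝ ∷ []
chain-vertex (suc n) b = sg (b zero) * (½ℝ * (1ℝ - chain-vertex n (b ∘ suc) zero)) ∷ chain-vertex n (b ∘ suc)

down : ∀ m → ℝ → ℝ^ m
down (suc m) c zero    = - c
down (suc m) c (suc k) = down m (2ℝ * c) k

-- At level k the entries σ/4 and ½ give ½ + ½ = 1 for the chosen sign and ½ - ½ = 0 for the other.
-- The tail -1, -2, -4, ... cancels the doubled absolute value of its predecessor, and the zeros
-- before level k leave the earlier links below 1.
chain-facet-point : ∀ d → Fin d → Fin 2 → ℝ^ (suc d)
chain-facet-point (suc m) zero    σ = sg σ * ¼ℝ ∷ ½ℝ ∷ down m 1ℝ
chain-facet-point (suc m) (suc k) σ = 0ℝ ∷ chain-facet-point m k σ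

-- The coefficient of u₀ for which the vertex with signs b maximizes
-- target n b * u₀ + Σ 4^(n−k) u_{k+1}, with multiplier 0 for the difference of
-- the two inequalities of the last level.
target : ∀ n → (Fin n → Fin 2) → ℝ
target zero    b = 0ℝ
target (suc n) b = 2ℝ * sg (b zero) * (pow 4ℝ (suc n) - target n (b ∘ suc))

module Chain (em : ExcludedMiddle 0ℓ) where
  open Ordered em

  0≤1 : 0ℝ ≤ 1ℝ
  0≤1 = <⇒≤ 0<1

  ¼<1 : ¼ℝ < 1ℝ
  ¼<1 = <-via (fromℚ (1ℚ ℚ.- ¼)) (≈-sym (≈-trans (fromℚ-+ 1ℚ (ℚ.- ¼)) (+-congˡ (fromℚ-neg ¼)))) (fromℚ-< (ℚ.positive⁻¹ (1ℚ ℚ.- ¼)))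

  within-sg : ∀ σ → Within 1ℝ (sg σ)
  within-sg zero    = within-self 0≤1
  within-sg (suc _) = within-neg (within-self 0≤1)

  within-sg* : ∀ {D x} σ → Within D x → Within D (sg σ * x)
  within-sg* {D} {x} zero    h = within-resp (≈-sym (*-identityˡ x)) h
  within-sg* {D} {x} (suc _) h = within-resp (solve 1 (λ x → :- x := :- con 1ℚ :* x) ≈-refl x) (within-neg h)

  sg-injective : ∀ {σ τ x y} → 0ℝ < x → x ≈ y → sg σ * x ≈ sg τ * y → σ ≡ τ
  sg-injective {zero}     {zero}     _ _ _ = refl
  sg-injective {suc zero} {suc zero} _ _ _ = refl
  sg-injective {zero} {suc zero} {x} {y} 0<x x≈y e = ⊥-elim (0<⇒≉0 (0<* 0<2 0<x)
    (≈-trans (solve 1 (λ x → con 2ℚ :* x := con 1ℚ :* x :- :- con 1ℚ :* x) ≈-refl x)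
      (≈⇒diff≈0 (≈-trans e (*-congˡ (≈-sym x≈y))))))
  sg-injective {suc zero} {zero} {x} {y} 0<x x≈y e = ⊥-elim (0<⇒≉0 (0<* 0<2 0<x)
    (≈-trans (solve 1 (λ x → con 2ℚ :* x := con 1ℚ :* x :- :- con 1ℚ :* x) ≈-refl x)
      (≈⇒diff≈0 (≈-sym (≈-trans e (*-congˡ (≈-sym x≈y)))))))

  -- Strictness below 1 makes 1 - v positive, so the two preimages differ and the signs can be read
  -- off; strictness above -1 keeps the preimages strictly inside the interval again.
  chain-vertex-head : ∀ n b → - 1ℝ < chain-vertex n b zero × chain-vertex n b zero < 1ℝ
  chain-vertex-head zero b = <-via 1ℝ (solve 0 (con 0ℚ :- :- con 1ℚ := con 1ℚ) ≈-refl) 0<1 , 0<1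
  chain-vertex-head (suc n) b = signed (b zero)
    where
    v = chain-vertex n (b ∘ suc) zero
    -1<v = proj₁ (chain-vertex-head n (b ∘ suc))
    v<1 = proj₂ (chain-vertex-head n (b ∘ suc))
    x = ½ℝ * (1ℝ - v)
    0<x : 0ℝ < x
    0<x = 0<* 0<½ (<-diff v<1)
    x<1 : 0ℝ < ½ℝ * (v - - 1ℝ)
    x<1 = 0<* 0<½ (<-diff -1<v)
    signed : ∀ σ → - 1ℝ < sg σ * x × sg σ * x < 1ℝ
    signed zero =
      <-via (1ℝ + x) (solve 1 (λ x → con 1ℚ :* x :- :- con 1ℚ := con 1ℚ :+ x) ≈-refl x) (0≤+< 0≤1 0<x) ,
      <-via (½ℝ * (v - - 1ℝ)) (solve 1 (λ v → con 1ℚ :- con 1ℚ :* (con ½ :* (con 1ℚ :- v)) := con ½ :* (v :- :- con 1ℚ)) ≈-refl v) x<1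
    signed (suc _) =
      <-via (½ℝ * (v - - 1ℝ)) (solve 1 (λ v → :- con 1ℚ :* (con ½ :* (con 1ℚ :- v)) :- :- con 1ℚ := con ½ :* (v :- :- con 1ℚ)) ≈-refl v) x<1 ,
      <-via (1ℝ + x) (solve 1 (λ x → con 1ℚ :- :- con 1ℚ :* x := con 1ℚ :+ x) ≈-refl x) (0≤+< 0≤1 0<x)

  chain-vertex-within : ∀ n b k → Within 1ℝ (chain-vertex n b k)
  chain-vertex-within zero    b zero       = within-0 0≤1
  chain-vertex-within zero    b (suc zero) = within-self 0≤1
  chain-vertex-within (suc n) b zero       =
    within (<⇒≤ (proj₁ (chain-vertex-head (suc n) b))) (<⇒≤ (proj₂ (chain-vertex-head (suc n) b)))
  chain-vertex-within (suc n) b (suc k)    = chain-vertex-within n (b ∘ suc) k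

  within-link : ∀ {D} σ {x y} → Within D x → y + 2ℝ * D ≤ 1ℝ → y + 2ℝ * sg σ * x ≤ 1ℝ
  within-link {D} σ {x} {y} h p = ≤-trans (+-monoʳ-≤ y (≤-respˡ (≈-sym (*-assoc 2ℝ (sg σ) x))
    (*-monoˡ-≤ (<⇒≤ 0<2) (upper (within-sg* σ h))))) p

  chain-vertex-link : ∀ n b k σ → link (chain-vertex n b) k σ ≤ 1ℝ
  chain-vertex-link zero b zero σ = within-link σ (within-0 ≤-refl)
    (≈⇒≤ (solve 0 (con 1ℚ :+ con 2ℚ :* con 0ℚ := con 1ℚ) ≈-refl))
  chain-vertex-link (suc n) b zero σ = within-link σ (within-sg* (b zero) (within-self (<⇒≤ (0<* 0<½ (<-diff v<1)))))
    (≈⇒≤ (solve 1 (λ v → v :+ con 2ℚ :* (con ½ :* (con 1ℚ :- v)) := con 1ℚ) ≈-refl (chain-vertex n (b ∘ suc) zero)))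
    where v<1 = proj₂ (chain-vertex-head n (b ∘ suc))
  chain-vertex-link (suc n) b (suc k) σ = chain-vertex-link n (b ∘ suc) k σ

  chain-vertex-injective : ∀ n b b′ → chain-vertex n b ≋ chain-vertex n b′ → ∀ k → b k ≡ b′ k
  chain-vertex-injective (suc n) b b′ e zero = sg-injective
    (0<* 0<½ (<-diff (proj₂ (chain-vertex-head n (b ∘ suc)))))
    (*-congˡ (+-congˡ (-‿cong (e (suc zero))))) (e zero)
  chain-vertex-injective (suc n) b b′ e (suc k) = chain-vertex-injective n (b ∘ suc) (b′ ∘ suc) (e ∘ suc) k

  pow-pos : ∀ {x} n → 0ℝ < x → 0ℝ < pow x n
  pow-pos zero    h = 0<1
  pow-pos (suc n) h = 0<* h (pow-pos n h)

  1≤pow : ∀ {x} → 1ℝ ≤ x → ∀ m → 1ℝ ≤ pow x m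
  1≤pow h zero = ≤-refl
  1≤pow {x} h (suc m) = ≤-trans h (≤-respˡ (*-identityʳ x) (*-monoˡ-≤ (≤-trans 0≤1 h) (1≤pow h m)))

  pow-mono : ∀ {x} → 1ℝ ≤ x → ∀ {a b} → a ℕ.≤ b → pow x a ≤ pow x b
  pow-mono h {b = b} z≤n = 1≤pow h b
  pow-mono h (s≤s a≤b)   = *-monoˡ-≤ (≤-trans 0≤1 h) (pow-mono h a≤b)

  1≤2 : 1ℝ ≤ 2ℝ
  1≤2 = ≤-via 1ℝ (solve 0 (con 2ℚ :- con 1ℚ := con 1ℚ) ≈-refl) 0≤1

  pow2-step : ∀ m → pow 2ℝ m ≤ pow 2ℝ (suc m)
  pow2-step m = pow-mono 1≤2 (ℕ.n≤1+n m)

  down-within : ∀ m {c} → 0ℝ ≤ c → ∀ k → Within (pow 2ℝ m * c) (down m c k)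
  down-within (suc m) {c} 0≤c zero = within-neg (within-mono
    (≤-via ((2ℝ * pow 2ℝ m - 1ℝ) * c) (solve 2 (λ p c → con 2ℚ :* p :* c :- c := (con 2ℚ :* p :- con 1ℚ) :* c) ≈-refl (pow 2ℝ m) c)
      (0≤* (≤-diff (1≤pow 1≤2 (suc m))) 0≤c)) (within-self 0≤c))
  down-within (suc m) {c} 0≤c (suc k) = within-mono
    (≈⇒≤ (solve 2 (λ p c → p :* (con 2ℚ :* c) := con 2ℚ :* p :* c) ≈-refl (pow 2ℝ m) c))
    (down-within m (0≤* (<⇒≤ 0<2) 0≤c) k)

  chain-facet-point-within : ∀ d k σ j → Within (pow 2ℝ d) (chain-facet-point d k σ j)
  chain-facet-point-within (suc m) zero σ zero = within-mono
    (≤-trans (<⇒≤ ¼<1) (1≤pow 1≤2 (suc m)))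
    (within-sg* σ (within-self (<⇒≤ 0<¼)))
  chain-facet-point-within (suc m) zero σ (suc zero) = within-mono
    (≤-trans (≤-via ½ℝ (solve 0 (con 1ℚ :- con ½ := con ½) ≈-refl) (<⇒≤ 0<½)) (1≤pow 1≤2 (suc m)))
    (within-self (<⇒≤ 0<½))
  chain-facet-point-within (suc m) zero σ (suc (suc j)) = within-mono
    (≤-trans (≈⇒≤ (*-identityʳ (pow 2ℝ m))) (pow2-step m)) (down-within m 0≤1 j)
  chain-facet-point-within (suc m) (suc k) σ zero = within-0 (<⇒≤ (pow-pos (suc m) 0<2))
  chain-facet-point-within (suc m) (suc k) σ (suc j) = within-mono (pow2-step m) (chain-facet-point-within m k σ j)

  chain-facet-point-tight : ∀ d k σ → link (chain-facet-point d k σ) k σ ≈ 1ℝ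
  chain-facet-point-tight (suc m) zero σ = begin
    ½ℝ + 2ℝ * sg σ * (sg σ * ¼ℝ) ≈⟨ solve 1 (λ s → con ½ :+ con 2ℚ :* s :* (s :* con ¼) := con ½ :+ con ½ :* (s :* s)) ≈-refl (sg σ) ⟩
    ½ℝ + ½ℝ * (sg σ * sg σ)      ≈⟨ +-congˡ (*-congˡ (sg² σ)) ⟩
    ½ℝ + ½ℝ * 1ℝ                 ≈⟨ solve 0 (con ½ :+ con ½ :* con 1ℚ := con 1ℚ) ≈-refl ⟩
    1ℝ                           ∎
  chain-facet-point-tight (suc m) (suc k) σ = chain-facet-point-tight m k σ

  within-link-< : ∀ {D} σ {x y} → Within D x → y + 2ℝ * D ≤ 0ℝ → y + 2ℝ * sg σ * x < 1ℝ
  within-link-< {D} σ {x} {y} h p = ≤-<-trans (≤-trans (+-monoʳ-≤ y (≤-respˡ (≈-sym (*-assoc 2ℝ (sg σ) x))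
    (*-monoˡ-≤ (<⇒≤ 0<2) (upper (within-sg* σ h))))) p) 0<1

  down-link : ∀ m {c} → 0ℝ ≤ c → ∀ k σ → link (down (suc m) c) k σ < 1ℝ
  down-link (suc m) {c} 0≤c zero σ = within-link-< σ (within-neg (within-self 0≤c))
    (≈⇒≤ (solve 1 (λ c → :- (con 2ℚ :* c) :+ con 2ℚ :* c := con 0ℚ) ≈-refl c))
  down-link (suc m) {c} 0≤c (suc k) σ = down-link m (0≤* (<⇒≤ 0<2) 0≤c) k σ

  chain-facet-point-head : ∀ d k σ → chain-facet-point d k σ zero < 1ℝ
  chain-facet-point-head (suc m) (suc k) σ = 0<1
  chain-facet-point-head (suc m) zero σ = ≤-<-trans (upper (within-sg* σ (within-self (<⇒≤ 0<¼)))) ¼<1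

  chain-facet-point-slack : ∀ d k σ k′ σ′ → (k , σ) ≢ (k′ , σ′) → link (chain-facet-point d k σ) k′ σ′ < 1ℝ
  chain-facet-point-slack (suc m) zero σ zero σ′ ne = opposite σ σ′ (λ { refl → ne refl })
    where
    zero-value : ½ℝ + 2ℝ * 1ℝ * (- 1ℝ * ¼ℝ) ≈ 0ℝ
    zero-value = solve 0 (con ½ :+ con 2ℚ :* con 1ℚ :* (:- con 1ℚ :* con ¼) := con 0ℚ) ≈-refl
    opposite : ∀ σ σ′ → σ ≢ σ′ → ½ℝ + 2ℝ * sg σ′ * (sg σ * ¼ℝ) < 1ℝ
    opposite zero zero ne = ⊥-elim (ne refl)
    opposite (suc zero) (suc zero) ne = ⊥-elim (ne refl)
    opposite zero (suc zero) ne = <-respˡ (≈-sym (solve 0 (con ½ :+ con 2ℚ :* :- con 1ℚ :* (con 1ℚ :* con ¼) := con 0ℚ) ≈-refl)) 0<1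
    opposite (suc zero) zero ne = <-respˡ (≈-sym zero-value) 0<1
  chain-facet-point-slack (suc (suc m)) zero σ (suc zero) σ′ ne = within-link-< σ′ (within-self (<⇒≤ 0<½))
    (≈⇒≤ (solve 0 (:- con 1ℚ :+ con 2ℚ :* con ½ := con 0ℚ) ≈-refl))
  chain-facet-point-slack (suc (suc m)) zero σ (suc (suc k)) σ′ ne = down-link m 0≤1 k σ′
  chain-facet-point-slack (suc m) (suc k) σ zero σ′ ne = <-respˡ
    (solve 2 (λ x s → x := x :+ con 2ℚ :* s :* con 0ℚ) ≈-refl (chain-facet-point m k σ zero) (sg σ′))
    (chain-facet-point-head m k σ)
  chain-facet-point-slack (suc m) (suc k) σ (suc k′) σ′ ne =
    chain-facet-point-slack m k σ k′ σ′ (λ { refl → ne refl })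

  -- The conditions on a displacement E from the vertex imposed by the n + 2 = d + 1 inequalities
  -- tight there: one per sign and both at the last level.
  Descending : ∀ n → (Fin n → Fin 2) → ℝ^ (suc (suc n)) → Set
  Descending zero    b E = ∀ σ → link E zero σ ≤ 0ℝ
  Descending (suc n) b E = link E zero (b zero) ≤ 0ℝ × Descending n (b ∘ suc) (E ∘ suc)

  descending : ∀ n b s U → (∀ k σ → link U k σ ≤ s) → Descending n b (λ k → U k - s * chain-vertex n b k)
  descending zero b s U h σ = ≤-via (s - link U zero σ)
    (solve 4 (λ s u₀ u₁ σ → con 0ℚ :- ((u₁ :- s :* con 1ℚ) :+ con 2ℚ :* σ :* (u₀ :- s :* con 0ℚ))
       := s :- (u₁ :+ con 2ℚ :* σ :* u₀)) ≈-refl s (U zero) (U (suc zero)) (sg σ)) (≤-diff (h zero σ))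
  descending (suc n) b s U h = ≤-via (s - link U zero (b zero)) value (≤-diff (h zero (b zero))) ,
    descending n (b ∘ suc) s (U ∘ suc) (h ∘ suc)
    where
    v = chain-vertex n (b ∘ suc) zero
    σ = sg (b zero)
    value : 0ℝ - ((U (suc zero) - s * v) + 2ℝ * σ * (U zero - s * (σ * (½ℝ * (1ℝ - v))))) ≈ s - (U (suc zero) + 2ℝ * σ * U zero)
    value = begin
      0ℝ - ((U (suc zero) - s * v) + 2ℝ * σ * (U zero - s * (σ * (½ℝ * (1ℝ - v)))))
        ≈⟨ solve 5 (λ s v σ u₀ u₁ → con 0ℚ :- ((u₁ :- s :* v) :+ con 2ℚ :* σ :* (u₀ :- s :* (σ :* (con ½ :* (con 1ℚ :- v)))))
             := σ :* σ :* (s :* (con 1ℚ :- v)) :+ s :* v :- (u₁ :+ con 2ℚ :* σ :* u₀)) ≈-refl s v σ (U zero) (U (suc zero)) ⟩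
      σ * σ * (s * (1ℝ - v)) + s * v - (U (suc zero) + 2ℝ * σ * U zero) ≈⟨ +-congʳ (+-congʳ (*-congʳ (sg² (b zero)))) ⟩
      1ℝ * (s * (1ℝ - v)) + s * v - (U (suc zero) + 2ℝ * σ * U zero)
        ≈⟨ +-congʳ (solve 2 (λ s v → con 1ℚ :* (s :* (con 1ℚ :- v)) :+ s :* v := s) ≈-refl s v) ⟩
      s - (U (suc zero) + 2ℝ * σ * U zero) ∎

  -- With P = 4^(n+1), one level turns the bound P - 4 into 2 (P + P - 4) = 4 P - 8, below the next
  -- bound 4 P - 4. The margin 4 is what keeps the multipliers positive under perturbation.
  target-within : ∀ n b → Within (4ℝ * pow 4ℝ n - 4ℝ) (target n b)
  target-within zero b = within-mono (≈⇒≤ (solve 0 (con 0ℚ := con 4ℚ :* con 1ℚ :- con 4ℚ) ≈-refl)) (within-0 ≤-refl)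
  target-within (suc n) b = within-mono
    (≤-via (4ℝ) (solve 1 (λ p → (con 4ℚ :* (con 4ℚ :* p) :- con 4ℚ) :- con 2ℚ :* con 1ℚ :* (con 4ℚ :* p :+ (con 4ℚ :* p :- con 4ℚ)) := con 4ℚ) ≈-refl (pow 4ℝ n)) (<⇒≤ 0<4))
    (within-* (within-* (within-self (<⇒≤ 0<2)) (within-sg (b zero)))
      (within-- (within-self (<⇒≤ (pow-pos (suc n) 0<4))) (target-within n (b ∘ suc))))

  nonpos-product : ∀ {x y} → 0ℝ < x → y ≤ 0ℝ → x * y ≤ 0ℝ
  nonpos-product {x} h p = ≤-respʳ (zeroʳ x) (*-monoˡ-≤ (<⇒≤ h) p)

  nonpos-sum : ∀ {x y} → x ≤ 0ℝ → y ≤ 0ℝ → x + y ≤ 0ℝ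
  nonpos-sum p q = ≤-respʳ (+-identityˡ 0ℝ) (+-mono-≤ p q)

  nonpos-sum-0 : ∀ {x y} → x ≤ 0ℝ → y ≤ 0ℝ → 0ℝ ≤ x + y → x ≈ 0ℝ × y ≈ 0ℝ
  nonpos-sum-0 {x} {y} p q h =
    ≤-antisym p (≤-trans h (≤-respʳ (+-identityʳ x) (+-monoʳ-≤ x q))) ,
    ≤-antisym q (≤-trans h (≤-respˡ (+-comm y x) (≤-respʳ (+-identityʳ y) (+-monoʳ-≤ y p))))

  -- The multipliers of the tight constraints are found from the first
  -- coordinate on: the coefficient g of E₀ is absorbed by σg/2 times the first
  -- tight constraint, which changes the coefficient of E₁ by −σg/2.
  descending-optimal : ∀ n b (E o : ℝ^ (suc (suc n))) γ → 0ℝ < γ → Descending n b E →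
    Within γ (o zero - target n b * γ) →
    (∀ k → Within (¼ℝ * γ) (o (suc k) - ω (suc n) k * γ)) →
    o · E ≤ 0ℝ × (0ℝ ≤ o · E → E ≋ 𝟎)
  descending-optimal zero b E o γ 0<γ desc head tail =
    ≤-respˡ (≈-sym value) (nonpos-sum (nonpos-product 0<p S₊≤0) (nonpos-product 0<q S₋≤0)) , λ h →
      let pS₊≈0 , qS₋≈0 = nonpos-sum-0 (nonpos-product 0<p S₊≤0) (nonpos-product 0<q S₋≤0) (≤-respʳ value h)
          S₊≈0 = *-cancelˡ-0 (0<⇒≉0 0<p) pS₊≈0
          S₋≈0 = *-cancelˡ-0 (0<⇒≉0 0<q) qS₋≈0
      in λ where
        zero → ≈-trans (solve 2 (λ x y → x := con ¼ :* ((y :+ con 2ℚ :* con 1ℚ :* x) :- (y :+ con 2ℚ :* :- con 1ℚ :* x))) ≈-refl E₀ E₁)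
          (≈-trans (*-congˡ (+-cong S₊≈0 (-‿cong S₋≈0))) (solve 0 (con ¼ :* (con 0ℚ :- con 0ℚ) := con 0ℚ) ≈-refl))
        (suc zero) → ≈-trans (solve 2 (λ x y → y := con ½ :* ((y :+ con 2ℚ :* con 1ℚ :* x) :+ (y :+ con 2ℚ :* :- con 1ℚ :* x))) ≈-refl E₀ E₁)
          (≈-trans (*-congˡ (+-cong S₊≈0 S₋≈0)) (solve 0 (con ½ :* (con 0ℚ :+ con 0ℚ) := con 0ℚ) ≈-refl))
    where
    E₀ = E zero
    E₁ = E (suc zero)
    o₀ = o zero
    o₁ = o (suc zero)
    -- The multipliers of the last two inequalities solve p + q = o₁ and 2 (p - q) = o₀. Since o₁ ≥
    -- ¾ γ and |o₀| ≤ γ, both are at least γ/8.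
    p = ½ℝ * (o₁ + ½ℝ * o₀)
    q = ½ℝ * (o₁ - ½ℝ * o₀)
    S₊≤0 = desc zero
    S₋≤0 = desc (suc zero)
    o₀-within : Within γ o₀
    o₀-within = within-resp (solve 2 (λ o g → o :- con 0ℚ :* g := o) ≈-refl o₀ γ) head
    o₁-lower : - (¼ℝ * γ) ≤ o₁ - 1ℝ * γ
    o₁-lower = lower (tail zero)
    0<p : 0ℝ < p
    0<p = 0<* 0<½ (<-respʳ (solve 3 (λ o₀ o₁ g → con ¼ :* g :+ (((o₁ :- con 1ℚ :* g) :- :- (con ¼ :* g)) :+ con ½ :* (o₀ :- :- g)) := o₁ :+ con ½ :* o₀) ≈-refl o₀ o₁ γ)
      (0<+≤ (0<* 0<¼ 0<γ) (0≤+ (≤-diff o₁-lower) (0≤* (<⇒≤ 0<½) (≤-diff (lower o₀-within))))))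
    0<q : 0ℝ < q
    0<q = 0<* 0<½ (<-respʳ (solve 3 (λ o₀ o₁ g → con ¼ :* g :+ (((o₁ :- con 1ℚ :* g) :- :- (con ¼ :* g)) :+ con ½ :* (g :- o₀)) := o₁ :- con ½ :* o₀) ≈-refl o₀ o₁ γ)
      (0<+≤ (0<* 0<¼ 0<γ) (0≤+ (≤-diff o₁-lower) (0≤* (<⇒≤ 0<½) (≤-diff (upper o₀-within))))))
    value : o · E ≈ p * link E zero zero + q * link E zero (suc zero)
    value = solve 4 (λ o₀ o₁ x y → o₀ :* x :+ (o₁ :* y :+ con 0ℚ)
        := con ½ :* (o₁ :+ con ½ :* o₀) :* (y :+ con 2ℚ :* con 1ℚ :* x) :+ con ½ :* (o₁ :- con ½ :* o₀) :* (y :+ con 2ℚ :* :- con 1ℚ :* x))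
      ≈-refl o₀ o₁ E₀ E₁
  descending-optimal (suc n) b E o γ 0<γ (S≤0 , desc) head tail =
    ≤-respˡ (≈-sym value) (nonpos-sum (nonpos-product 0<Γ S≤0) (proj₁ rec)) , λ h →
      let ΓS≈0 , _ = nonpos-sum-0 (nonpos-product 0<Γ S≤0) (proj₁ rec) (≤-respʳ value h)
          S≈0 = *-cancelˡ-0 (0<⇒≉0 0<Γ) ΓS≈0
          rest = proj₂ rec (≤-trans (≤-respʳ value h) (≤-respʳ (+-identityˡ (o′ · (E ∘ suc))) (+-mono-≤ (nonpos-product 0<Γ S≤0) ≤-refl)))
      in λ { zero → E₀≈0 S≈0 (rest zero) ; (suc k) → rest k }
    where
    σ = sg (b zero)
    τ = target n (b ∘ suc)
    P = pow 4ℝ (suc n)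
    E₀ = E zero
    E₁ = E (suc zero)
    o₀ = o zero
    o₁ = o (suc zero)
    Γ = σ * (½ℝ * o₀)
    o′ : ℝ^ (suc (suc n))
    o′ = (o₁ - Γ) ∷ λ k → o (suc (suc k))
    Γ-near : Within (½ℝ * γ) (Γ - (P - τ) * γ)
    Γ-near = within-resp (begin
        σ * (½ℝ * (o₀ - 2ℝ * σ * (P - τ) * γ))
          ≈⟨ solve 5 (λ s o P t g → s :* (con ½ :* (o :- con 2ℚ :* s :* (P :- t) :* g)) := s :* (con ½ :* o) :- s :* s :* ((P :- t) :* g)) ≈-refl σ o₀ P τ γ ⟩
        Γ - σ * σ * ((P - τ) * γ) ≈⟨ +-congˡ (-‿cong (≈-trans (*-congʳ (sg² (b zero))) (*-identityˡ _))) ⟩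
        Γ - (P - τ) * γ ∎)
      (within-sg* (b zero) (within-* (within-self (<⇒≤ 0<½)) head))
    -- `Γ` is within ½ γ of (P - τ) γ, and P - τ ≥ 4 by `target-within`.
    0<Γ : 0ℝ < Γ
    0<Γ = <-respʳ (solve 4 (λ G P t g → con 2ℚ :* g :+ (con ½ :* (con 2ℚ :* (con ½ :* g)) :+ (g :+ ((G :- (P :- t) :* g :- :- (con ½ :* g)) :+ (P :- con 4ℚ :- t) :* g))) := G) ≈-refl Γ P τ γ)
      (0<+≤ (0<* 0<2 0<γ) (0≤+ (0≤* (<⇒≤ 0<½) (0≤* (<⇒≤ 0<2) (0≤* (<⇒≤ 0<½) (<⇒≤ 0<γ))))
        (0≤+ (<⇒≤ 0<γ) (0≤+ (≤-diff (lower Γ-near)) (0≤* (≤-diff (upper (target-within n (b ∘ suc)))) (<⇒≤ 0<γ))))))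
    -- The error budget closes: ¼ γ from o₁ and ½ γ from `Γ` make ¾ γ, within the tolerance γ
    -- allowed for the next leading coefficient.
    rec = descending-optimal n (b ∘ suc) (E ∘ suc) o′ γ 0<γ desc
      (within-mono (≤-via (¼ℝ * γ) (solve 1 (λ g → g :- (con ¼ :* g :+ con ½ :* g) := con ¼ :* g) ≈-refl γ) (<⇒≤ (0<* 0<¼ 0<γ)))
        (within-resp (solve 5 (λ o G P t g → (o :- P :* g) :- (G :- (P :- t) :* g) := (o :- G) :- t :* g) ≈-refl o₁ Γ P τ γ)
          (within-- (tail zero) Γ-near)))
      (tail ∘ suc)
    value : o · E ≈ Γ * link E zero (b zero) + o′ · (E ∘ suc)
    value = begin
      o₀ * E₀ + (o₁ * E₁ + R) ≈⟨ +-congʳ (≈-trans (≈-sym (*-identityˡ (o₀ * E₀))) (*-congʳ (≈-sym (sg² (b zero))))) ⟩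
      σ * σ * (o₀ * E₀) + (o₁ * E₁ + R)
        ≈⟨ solve 6 (λ s o₀ o₁ x y R → s :* s :* (o₀ :* x) :+ (o₁ :* y :+ R)
             := s :* (con ½ :* o₀) :* (y :+ con 2ℚ :* s :* x) :+ ((o₁ :- s :* (con ½ :* o₀)) :* y :+ R)) ≈-refl σ o₀ o₁ E₀ E₁ R ⟩
      Γ * (E₁ + 2ℝ * σ * E₀) + ((o₁ - Γ) * E₁ + R) ∎
      where R = (λ k → o (suc (suc k))) · (λ k → E (suc (suc k)))
    E₀≈0 : link E zero (b zero) ≈ 0ℝ → E₁ ≈ 0ℝ → E₀ ≈ 0ℝ
    E₀≈0 S≈0 E₁≈0 = begin
      E₀ ≈⟨ ≈-trans (≈-sym (*-identityˡ E₀)) (*-congʳ (≈-sym (sg² (b zero)))) ⟩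
      σ * σ * E₀ ≈⟨ solve 3 (λ s x y → s :* s :* x := con ½ :* s :* ((y :+ con 2ℚ :* s :* x) :- y)) ≈-refl σ E₀ E₁ ⟩
      ½ℝ * σ * ((E₁ + 2ℝ * σ * E₀) - E₁) ≈⟨ *-congˡ (+-cong S≈0 (-‿cong E₁≈0)) ⟩
      ½ℝ * σ * (0ℝ - 0ℝ) ≈⟨ solve 1 (λ s → con ½ :* s :* (con 0ℚ :- con 0ℚ) := con 0ℚ) ≈-refl σ ⟩
      0ℝ ∎

-- A single gadget

3ℚ : ℚ
3ℚ = + 3 ℚ./ 1

8ℚ : ℚ
8ℚ = + 8 ℚ./ 1

8ℝ : ℝ
8ℝ = fromℚ 8ℚ

3ℝ : ℝ
3ℝ = fromℚ 3ℚ

0<3 : 0ℝ < 3ℝ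
0<3 = fromℚ-< (ℚ.positive⁻¹ 3ℚ)

6ℚ 12ℚ 32ℚ 36ℚ : ℚ
6ℚ  = + 6 ℚ./ 1
12ℚ = + 12 ℚ./ 1
32ℚ = + 32 ℚ./ 1
36ℚ = + 36 ℚ./ 1

6ℝ 12ℝ 32ℝ 36ℝ : ℝ
6ℝ  = fromℚ 6ℚ
12ℝ = fromℚ 12ℚ
32ℝ = fromℚ 32ℚ
36ℝ = fromℚ 36ℚ

0<6 : 0ℝ < 6ℝ
0<6 = fromℚ-< (ℚ.positive⁻¹ 6ℚ)

0<8 : 0ℝ < 8ℝ
0<8 = fromℚ-< (ℚ.positive⁻¹ 8ℚ)

0<12 : 0ℝ < 12ℝ
0<12 = fromℚ-< (ℚ.positive⁻¹ 12ℚ)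

0<32 : 0ℝ < 32ℝ
0<32 = fromℚ-< (ℚ.positive⁻¹ 32ℚ)

0<36 : 0ℝ < 36ℝ
0<36 = fromℚ-< (ℚ.positive⁻¹ 36ℚ)

geometric : ∀ m → ℝ → ℝ^ m
geometric (suc m) c zero    = c
geometric (suc m) c (suc k) = geometric m (3ℝ * c) k

slope : ∀ m → ℝ^ m
slope m = geometric m 1ℝ

module Gadget (em : ExcludedMiddle 0ℓ) (n : ℕ) where
  open Ordered em
  open Chain em

  d : ℕ
  d = suc n

  -- `Q` is the leading weight; `L` is the factor with which `ell` appears in the weighted sum of
  -- chain coordinates; `Ω` and `Λ` bound sums over weights and slopes. `W` bounds all chain points
  -- used, and `κ` the resulting y-coordinates.
  Q L Ω Λ W κ : ℝ
  Q = pow 4ℝ n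
  L = ω d · slope d
  Ω = sum (ω d)
  Λ = sum (slope d)
  W = pow 2ℝ d
  κ = L * W + Λ * (Ω * W)

  1≤geometric : ∀ m {c} → 1ℝ ≤ c → ∀ k → 1ℝ ≤ geometric m c k
  1≤triple : ∀ {c} → 1ℝ ≤ c → 1ℝ ≤ 3ℝ * c
  1≤triple {c} h = ≤-trans h (≤-via (2ℝ * c) (solve 1 (λ c → con 3ℚ :* c :- c := con 2ℚ :* c) ≈-refl c)
    (0≤* (<⇒≤ 0<2) (≤-trans 0≤1 h)))
  1≤geometric (suc m) h zero    = h
  1≤geometric (suc m) h (suc k) = 1≤geometric m (1≤triple h) k

  -- The slopes are powers of 3, and 3 c - 2 c = c ≥ 1. This surplus lets a very negative `ell`
  -- outweigh the doubled previous coordinate in every link.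
  geometric-growth : ∀ m {c} → 1ℝ ≤ c → ∀ k →
    1ℝ ≤ geometric (suc m) c (suc k) - 2ℝ * geometric (suc m) c (inject₁ k)
  geometric-growth (suc m) {c} h zero = ≤-respʳ (solve 1 (λ c → c := con 3ℚ :* c :- con 2ℚ :* c) ≈-refl c) h
  geometric-growth (suc m) {c} h (suc k) = geometric-growth m (1≤triple h) k

  1≤slope : ∀ k → 1ℝ ≤ slope d k
  1≤slope = 1≤geometric d ≤-refl

  0≤slope : ∀ k → 0ℝ ≤ slope d k
  0≤slope k = ≤-trans 0≤1 (1≤slope k)

  0<ω : ∀ m k → 0ℝ < ω m k
  0<ω (suc m) zero    = pow-pos m 0<4
  0<ω (suc m) (suc k) = 0<ω m k

  term≤sum : ∀ {m} {f : ℝ^ m} → (∀ i → 0ℝ ≤ f i) → ∀ i → f i ≤ sum f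
  term≤sum {suc m} {f} h zero = ≤-via (sum (f ∘ suc)) (solve 2 (λ x y → (x :+ y) :- x := y) ≈-refl (f zero) (sum (f ∘ suc))) (sum-0≤ (h ∘ suc))
  term≤sum {suc m} {f} h (suc i) = ≤-trans (term≤sum (h ∘ suc) i)
    (≤-via (f zero) (solve 2 (λ x y → (x :+ y) :- y := x) ≈-refl (f zero) (sum (f ∘ suc))) (h zero))

  1≤4 : 1ℝ ≤ 4ℝ
  1≤4 = ≤-via 3ℝ (solve 0 (con 4ℚ :- con 1ℚ := con 3ℚ) ≈-refl) (<⇒≤ 0<3)

  ω≤pow : ∀ m k → ω (suc m) k ≤ pow 4ℝ m
  ω≤pow m zero = ≤-refl
  ω≤pow (suc m) (suc k) = ≤-trans (ω≤pow m k) (pow-mono 1≤4 (ℕ.n≤1+n m))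

  within-ω : ∀ k → Within Q (ω d k)
  within-ω k = within-mono (ω≤pow n k) (within-self (<⇒≤ (0<ω d k)))

  0<Q : 0ℝ < Q
  0<Q = pow-pos n 0<4

  0<W : 0ℝ < W
  0<W = pow-pos d 0<2

  0≤W : 0ℝ ≤ W
  0≤W = <⇒≤ 0<W

  0<L : 0ℝ < L
  0<L = 0<+≤ (0<* 0<Q 0<1) (sum-0≤ λ k → 0≤* (<⇒≤ (0<ω n k)) (≤-trans 0≤1 (1≤geometric n (1≤triple ≤-refl) k)))

  0≤Ω : 0ℝ ≤ Ω
  0≤Ω = sum-0≤ λ k → <⇒≤ (0<ω d k)

  0≤Λ : 0ℝ ≤ Λ
  0≤Λ = sum-0≤ 0≤slope

  0≤κ : 0ℝ ≤ κ
  0≤κ = 0≤+ (0≤* (<⇒≤ 0<L) 0≤W) (0≤* 0≤Λ (0≤* 0≤Ω 0≤W))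

  within-weighted : ∀ {m D} {x : ℝ^ m} → (∀ k → Within D (x k)) → Within (sum (ω m) * D) (ω m · x)
  within-weighted {m} {D} {x} h = within-mono (≈⇒≤ (≈-sym (*-distribʳ-sum D (ω m))))
    (within-sum {D = λ k → ω m k * D} λ k → within-* (within-self (<⇒≤ (0<ω m k))) (h k))

  -- The first entry makes weighted-lift hold, so that ell is recovered from U as
  -- L * ell = Σ ω_k U_{k+1}.
  lift : ℝ^ n → ℝ^ d
  lift y = - (ω n · y) ∷ λ k → Q * y k

  within-lift : ∀ {D y} → 0ℝ ≤ D → (∀ k → Within D (y k)) → ∀ k → Within (Ω * D) (lift y k)
  within-lift {D} 0≤D h zero = within-mono
    (≤-via (Q * D) (solve 3 (λ q s D → (q :+ s) :* D :- s :* D := q :* D) ≈-refl Q (sum (ω n)) D) (0≤* (<⇒≤ 0<Q) 0≤D))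
    (within-neg (within-weighted h))
  within-lift {D} 0≤D h (suc k) = within-mono
    (≤-via (sum (ω n) * D) (solve 3 (λ q s D → (q :+ s) :* D :- q :* D := s :* D) ≈-refl Q (sum (ω n)) D)
      (0≤* (sum-0≤ λ k → <⇒≤ (0<ω n k)) 0≤D))
    (within-* (within-self (<⇒≤ 0<Q)) (h k))

  weighted-lift : ∀ y → ω d · lift y ≈ 0ℝ
  weighted-lift y = begin
    Q * - (ω n · y) + sum (λ k → ω n k * (Q * y k))
      ≈⟨ +-congˡ (≈-trans (sum-cong-≋ λ k → solve 3 (λ w q y → w :* (q :* y) := q :* (w :* y)) ≈-refl (ω n k) Q (y k))
           (≈-sym (*-distribˡ-sum Q (λ k → ω n k * y k)))) ⟩
    Q * - (ω n · y) + Q * (ω n · y) ≈⟨ solve 2 (λ q s → q :* :- s :+ q :* s := con 0ℚ) ≈-refl Q (ω n · y) ⟩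
    0ℝ ∎

  bilinear-sum : ∀ {m} (a b s Y : ℝ^ m) F c e θ →
    sum (λ k → (a k * F + c * b k) * (s k * e + θ * Y k)) ≈
    F * e * (a · s) + F * θ * (a · Y) + (c * e * (b · s) + c * θ * (b · Y))
  bilinear-sum {zero} a b s Y F c e θ = solve 4
    (λ F c e t → con 0ℚ := F :* e :* con 0ℚ :+ F :* t :* con 0ℚ :+ (c :* e :* con 0ℚ :+ c :* t :* con 0ℚ)) ≈-refl F c e θ
  bilinear-sum {suc m} a b s Y F c e θ = ≈-trans (+-congˡ (bilinear-sum (a ∘ suc) (b ∘ suc) (s ∘ suc) (Y ∘ suc) F c e θ))
    (≈-trans (+-cong (expand (a zero) (b zero) (s zero) (Y zero)) ≈-refl)
      (solve 12 (λ A B C D p q r w as aY bs bY →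
          p :* as :+ q :* aY :+ (r :* bs :+ w :* bY) :+ (p :* A :+ q :* B :+ (r :* C :+ w :* D))
          := p :* (as :+ A) :+ q :* (aY :+ B) :+ (r :* (bs :+ C) :+ w :* (bY :+ D))) ≈-refl
        ((a ∘ suc) · (s ∘ suc)) ((a ∘ suc) · (Y ∘ suc)) ((b ∘ suc) · (s ∘ suc)) ((b ∘ suc) · (Y ∘ suc))
        (F * e) (F * θ) (c * e) (c * θ) (a zero * s zero) (a zero * Y zero) (b zero * s zero) (b zero * Y zero)))
    where
    expand : ∀ a b s Y → (a * F + c * b) * (s * e + θ * Y) ≈
      F * e * (a * s) + F * θ * (a * Y) + (c * e * (b * s) + c * θ * (b * Y))
    expand a b s Y = solve 8 (λ a b s Y F c e t → (a :* F :+ c :* b) :* (s :* e :+ t :* Y) :=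
      F :* e :* (a :* s) :+ F :* t :* (a :* Y) :+ (c :* e :* (b :* s) :+ c :* t :* (b :* Y))) ≈-refl a b s Y F c e θ

  module At (G Θ ρ : ℝ) where

    -- The influence of the direction on the chain coefficients is proportional to t ≤ 2 ρ; taking
    -- `θ` proportional to ρ makes the relative error the same for all gadgets. The stretching
    -- affects x and `ell` but not the extent in y. Dividing `U` by `scale` gives the coordinates of
    -- the chain.
    θ centre scale : ℝ
    θ = Θ * ρ
    centre = 2ℝ * (G * ρ)
    scale = θ * Q * L

    -- h ≤ − ρ x + G ρ² is tangent to the parabola h = − x² / 4 G at x = centre.
    ell : ℝ → ℝ → ℝ
    ell h x = h + ρ * x - G * (ρ * ρ)

    -- The multiples of ell shear the coordinates: slope d grows faster than
    -- 2 ^ k, so points well below ell = 0 satisfy all the inequalities.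
    U : ℝ → ℝ → ℝ^ n → ℝ^ (suc d)
    U h x y zero    = L * (x - centre)
    U h x y (suc k) = slope d k * ell h x + θ * lift y k

    -- From the second link on, the slopes contribute at most `ell` itself and the lifts at most Z +
    -- 2 Z. In the first link U₀ contains no `ell`, and its doubled value is covered by the term
    -- with L (D + centre).
    deep-slack : ∀ {D h x y} → 0ℝ < θ → 0ℝ ≤ G * ρ → Within D x → (∀ k → Within D (y k)) →
      3ℝ * (θ * (Ω * D)) + 2ℝ * (L * (D + centre)) < - ell h x → ∀ k σ → link (U h x y) k σ < 0ℝ
    deep-slack {D} {h} {x} {y} 0<θ 0≤Gρ x-within y-within deep = slack
      where
      e = ell h x
      V = - e
      0≤D = within-bound x-within
      Z = θ * (Ω * D)
      0≤Z : 0ℝ ≤ Z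
      0≤Z = 0≤* (<⇒≤ 0<θ) (0≤* 0≤Ω 0≤D)
      0≤C : 0ℝ ≤ L * (D + centre)
      0≤C = 0≤* (<⇒≤ 0<L) (0≤+ 0≤D (0≤* (<⇒≤ 0<2) 0≤Gρ))
      0≤V : 0ℝ ≤ V
      0≤V = ≤-trans (0≤+ (0≤* (<⇒≤ 0<3) 0≤Z) (0≤* (<⇒≤ 0<2) 0≤C)) (<⇒≤ deep)
      Y-within : ∀ k → Within Z (θ * lift y k)
      Y-within k = within-* (within-self (<⇒≤ 0<θ)) (within-lift 0≤D y-within k)
      e-within : Within V e
      e-within = within (≈⇒≤ (solve 1 (λ e → :- :- e := e) ≈-refl e))
        (≤-via (V + V) (solve 1 (λ e → :- e :- e := :- e :+ :- e) ≈-refl e) (0≤+ 0≤V 0≤V))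
      twice : ∀ σ {x D} → Within D x → 2ℝ * sg σ * x ≤ 2ℝ * D
      twice σ {x} p = ≤-respˡ (≈-sym (*-assoc 2ℝ (sg σ) x)) (*-monoˡ-≤ (<⇒≤ 0<2) (upper (within-sg* σ p)))
      slack : ∀ k σ → link (U h x y) k σ < 0ℝ
      slack zero σ = ≤-<-trans
        (+-mono-≤ (+-mono-≤ (≈⇒≤ (*-identityˡ e)) (upper (Y-within zero)))
          (twice σ (within-* (within-self (<⇒≤ 0<L)) (within-- x-within (within-self (0≤* (<⇒≤ 0<2) 0≤Gρ))))))
        (<-via ((- e - (3ℝ * Z + 2ℝ * (L * (D + centre)))) + 2ℝ * Z)
          (solve 3 (λ e Z C → con 0ℚ :- (e :+ Z :+ con 2ℚ :* C) := (:- e :- (con 3ℚ :* Z :+ con 2ℚ :* C)) :+ con 2ℚ :* Z) ≈-refl e Z (L * (D + centre)))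
          (0<+≤ (<-diff deep) (0≤* (<⇒≤ 0<2) 0≤Z)))
      slack (suc k) σ = ≤-<-trans
        (+-mono-≤ (+-monoʳ-≤ (a * e) (upper (Y-within (suc k))))
          (twice σ (within-+ (within-* (within-self (0≤slope (inject₁ k))) e-within) (Y-within (inject₁ k)))))
        (<-via ((- e - (3ℝ * Z + 2ℝ * C)) + (2ℝ * C + (a - 2ℝ * c - 1ℝ) * - e))
          (solve 5 (λ a c e Z C → con 0ℚ :- (a :* e :+ Z :+ con 2ℚ :* (c :* :- e :+ Z))
             := (:- e :- (con 3ℚ :* Z :+ con 2ℚ :* C)) :+ (con 2ℚ :* C :+ (a :- con 2ℚ :* c :- con 1ℚ) :* :- e)) ≈-refl a c e Z C)
          (0<+≤ (<-diff deep) (0≤+ (0≤* (<⇒≤ 0<2) 0≤C) (0≤* (≤-diff (geometric-growth n ≤-refl k)) 0≤V))))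
        where
        a = slope d (suc k)
        c = slope d (inject₁ k)
        C = L * (D + centre)

    total : ℝ^ (suc d) → ℝ
    total u = ω d · (u ∘ suc)

    -- With `point-h` and `point-y` this inverts `U` up to the factor `scale`: U₀ gives x, the
    -- weighted sum gives `ell` and so h, and what remains of the other coordinates gives y.
    point-x : ℝ^ (suc d) → ℝ
    point-x u = centre + θ * Q * u zero

    point-h : ℝ^ (suc d) → ℝ
    point-h u = θ * Q * total u + G * (ρ * ρ) - ρ * point-x u

    point-y : ℝ^ (suc d) → ℝ^ n
    point-y u k = L * u (suc (suc k)) - slope d (suc k) * total u

    ell-point : ∀ u → ell (point-h u) (point-x u) ≈ θ * Q * total u
    ell-point u = solve 4 (λ s g r x → ((s :+ g) :- r :* x) :+ r :* x :- g := s) ≈-refl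
      (θ * Q * total u) (G * (ρ * ρ)) ρ (point-x u)

    lift-point : ∀ u k → lift (point-y u) k ≈ Q * (L * u (suc k) - slope d k * total u)
    lift-point u (suc k) = ≈-refl
    lift-point u zero = begin
      - sum (λ k → ω n k * (L * u (suc (suc k)) - slope d (suc k) * S))
        ≈⟨ -‿cong (≈-trans (sum-cong-≋ λ k → solve 5 (λ w L u s S → w :* (L :* u :- s :* S) := L :* (w :* u) :+ :- S :* (w :* s)) ≈-refl
             (ω n k) L (u (suc (suc k))) (slope d (suc k)) S)
             (≈-trans (∑-distrib-+ (λ k → L * (ω n k * u (suc (suc k)))) (λ k → - S * (ω n k * slope d (suc k))))
               (+-cong (≈-sym (*-distribˡ-sum L (λ k → ω n k * u (suc (suc k)))))
                 (≈-sym (*-distribˡ-sum (- S) (λ k → ω n k * slope d (suc k))))))) ⟩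
      -- `L` unfolds to Q + C and S to Q u₁ + A, and the product A C cancels.
      - (L * A + - S * C)
        ≈⟨ solve 4 (λ q u A C → :- ((q :* con 1ℚ :+ C) :* A :+ :- (q :* u :+ A) :* C)
             := q :* ((q :* con 1ℚ :+ C) :* u :- con 1ℚ :* (q :* u :+ A))) ≈-refl Q (u (suc zero)) A C ⟩
      Q * (L * u (suc zero) - 1ℝ * S) ∎
      where
      S = total u
      A = sum (λ k → ω n k * u (suc (suc k)))
      C = sum (λ k → ω n k * slope d (suc k))

    U-point : ∀ u j → U (point-h u) (point-x u) (point-y u) j ≈ scale * u j
    U-point u zero = solve 5 (λ L c t q u → L :* (c :+ t :* q :* u :- c) := t :* q :* L :* u) ≈-refl L centre θ Q (u zero)
    U-point u (suc k) = begin
      slope d k * ell (point-h u) (point-x u) + θ * lift (point-y u) k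
        ≈⟨ +-cong (*-congˡ (ell-point u)) (*-congˡ (lift-point u k)) ⟩
      slope d k * (θ * Q * total u) + θ * (Q * (L * u (suc k) - slope d k * total u))
        ≈⟨ solve 6 (λ s t q S L u → s :* (t :* q :* S) :+ t :* (q :* (L :* u :- s :* S)) := t :* q :* L :* u) ≈-refl
             (slope d k) θ Q (total u) L (u (suc k)) ⟩
      scale * u (suc k) ∎

    within-total : ∀ {u} → (∀ j → Within W (u j)) → Within (Ω * W) (total u)
    within-total h = within-weighted (h ∘ suc)

    within-point-y : ∀ {u} → (∀ j → Within W (u j)) → ∀ k → Within κ (point-y u k)
    within-point-y h k = within-- (within-* (within-self (<⇒≤ 0<L)) (h (suc (suc k))))
      (within-* (within-mono (term≤sum 0≤slope (suc k)) (within-self (0≤slope (suc k)))) (within-total h))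

    objective : ℝ → ℝ^ n → ℝ → ℝ → ℝ → ℝ^ n → ℝ
    objective γ β t h x y = γ * h + t * (γ * x + β · y)

    module Objective (γ : ℝ) (β : ℝ^ n) (τ : ℝ) where
      t γ̂ tilt : ℝ
      t    = ρ + τ
      γ̂    = θ * Q * γ
      tilt = sum (λ k → β k * slope d (suc k))

      -- The first coefficient carries only τ = t - ρ because `ell` already contains ρ x. The
      -- direction enters the others through the entries of β and through `tilt`, which compensates
      -- for the multiples of `ell` inside the coordinates `U`.
      o : ℝ^ (suc d)
      o zero    = γ̂ * τ
      o (suc k) = ω d k * (γ̂ - t * tilt) + t * L * (0ℝ ∷ β) k

      constant : ℝ
      constant = scale * γ * (G * (ρ * ρ)) + γ̂ * τ * (L * centre)

      objective-chain : ∀ h x y → scale * objective γ β t h x y ≈ o · U h x y + constant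
      objective-chain h x y = ≈-sym (begin
        γ̂ * τ * (L * (x - centre)) + sum (λ k → (ω d k * F + t * L * (0ℝ ∷ β) k) * (slope d k * e + θ * lift y k)) + constant
          ≈⟨ +-congʳ (+-congˡ (bilinear-sum (ω d) (0ℝ ∷ β) (slope d) (lift y) F (t * L) e θ)) ⟩
        γ̂ * τ * (L * (x - centre)) + (F * e * L + F * θ * (ω d · lift y) + (t * L * e * ((0ℝ ∷ β) · slope d) + t * L * θ * ((0ℝ ∷ β) · lift y))) + constant
          ≈⟨ +-congʳ (+-congˡ (+-cong (+-congˡ (*-congˡ (weighted-lift y))) (+-cong (*-congˡ (≈-trans (+-congʳ (zeroˡ 1ℝ)) (+-identityˡ tilt)))
               (*-congˡ (≈-trans (+-congʳ (zeroˡ (- (ω n · y)))) (≈-trans (+-identityˡ _) scaled)))))) ⟩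
        γ̂ * τ * (L * (x - centre)) + (F * e * L + F * θ * 0ℝ + (t * L * e * tilt + t * L * θ * (Q * (β · y)))) + constant
          ≈⟨ final h x (β · y) ⟩
        scale * objective γ β t h x y ∎)
        where
        e = ell h x
        F = γ̂ - t * tilt
        scaled : sum (λ k → β k * (Q * y k)) ≈ Q * (β · y)
        scaled = ≈-trans (sum-cong-≋ λ k → solve 3 (λ b q y → b :* (q :* y) := q :* (b :* y)) ≈-refl (β k) Q (y k))
          (≈-sym (*-distribˡ-sum Q (λ k → β k * y k)))
        final : ∀ h x s → γ̂ * τ * (L * (x - centre)) + (F * (h + ρ * x - G * (ρ * ρ)) * L + F * θ * 0ℝ
                  + (t * L * (h + ρ * x - G * (ρ * ρ)) * tilt + t * L * θ * (Q * s))) + constant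
                ≈ scale * (γ * h + t * (γ * x + s))
        final h x s = solve 12 (λ h x s γ τ ρ θ Q L g tilt →
          let t = ρ :+ τ ; ĝ = θ :* Q :* γ ; F = ĝ :- t :* tilt ; e = h :+ ρ :* x :- g
          in λ c → ĝ :* τ :* (L :* (x :- c)) :+ (F :* e :* L :+ F :* θ :* con 0ℚ :+ (t :* L :* e :* tilt :+ t :* L :* θ :* (Q :* s)))
               :+ (θ :* Q :* L :* γ :* g :+ ĝ :* τ :* (L :* c))
             := θ :* Q :* L :* (γ :* h :+ t :* (γ :* x :+ s))) ≈-refl
          h x s γ τ ρ θ Q L (G * (ρ * ρ)) tilt centre

      module _ {B} (0<γ : 0ℝ < γ) (0<ρ : 0ℝ < ρ) (0≤B : 0ℝ ≤ B) (β-within : ∀ k → Within (B * γ) (β k))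
               (t-within : Within (2ℝ * ρ) t) (Θ-large : 8ℝ * (B * (Λ + L)) ≤ Θ) where

        tilt-within : Within (B * γ * Λ) tilt
        tilt-within = within-mono
          (≤-trans (≈⇒≤ (≈-sym (*-distribˡ-sum (B * γ) (λ k → slope d (suc k)))))
            (*-monoˡ-≤ (0≤* 0≤B (<⇒≤ 0<γ)) (≤-via 1ℝ (solve 1 (λ s → (con 1ℚ :+ s) :- s := con 1ℚ) ≈-refl (sum (λ k → slope d (suc k)))) 0≤1)))
          (within-sum {D = λ k → B * γ * slope d (suc k)} λ k → within-* (β-within k) (within-self (0≤slope (suc k))))

        -- The disturbance is at most 2 ρ B γ (Q Λ + L) ≤ 2 ρ B γ Q (Λ + L), and Θ ≥ 8 B (Λ + L)
        -- makes this a quarter of `γ̂` = Θ ρ Q γ.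
        coefficient-near : ∀ k → Within (¼ℝ * γ̂) (o (suc k) - ω d k * γ̂)
        coefficient-near k = within-mono
          (≤-via (¼ℝ * (ρ * Q * γ) * (Θ - 8ℝ * (B * (Λ + L))) + 2ℝ * ρ * (B * γ) * L * (Q - 1ℝ))
            (solve 7 (λ Θ ρ Q γ B Λ L → con ¼ :* (Θ :* ρ :* Q :* γ) :- (Q :* (con 2ℚ :* ρ :* (B :* γ :* Λ)) :+ con 2ℚ :* ρ :* L :* (B :* γ))
              := con ¼ :* (ρ :* Q :* γ) :* (Θ :- con 8ℚ :* (B :* (Λ :+ L))) :+ con 2ℚ :* ρ :* (B :* γ) :* L :* (Q :- con 1ℚ)) ≈-refl Θ ρ Q γ B Λ L)
            (0≤+ (0≤* (0≤* (<⇒≤ 0<¼) (<⇒≤ (0<* (0<* 0<ρ 0<Q) 0<γ))) (≤-diff Θ-large))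
              (0≤* (0≤* (0≤* (<⇒≤ (0<* 0<2 0<ρ)) 0≤Bγ) (<⇒≤ 0<L)) (≤-diff (1≤pow 1≤4 n)))))
          (within-resp (solve 5 (λ w g T tL β → :- (w :* T) :+ tL :* β := w :* (g :- T) :+ tL :* β :- w :* g) ≈-refl
              (ω d k) γ̂ (t * tilt) (t * L) ((0ℝ ∷ β) k))
            (within-+ (within-neg (within-* (within-ω k) (within-* t-within tilt-within)))
              (within-* (within-* t-within (within-self (<⇒≤ 0<L))) (extended k))))
          where
          0≤Bγ : 0ℝ ≤ B * γ
          0≤Bγ = 0≤* 0≤B (<⇒≤ 0<γ)
          extended : ∀ k → Within (B * γ) ((0ℝ ∷ β) k)
          extended zero    = within-0 0≤Bγ
          extended (suc k) = β-within k

    module _ {B γ} (β : ℝ^ n) (b : Fin n → Fin 2)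
             (0<γ : 0ℝ < γ) (0<ρ : 0ℝ < ρ) (0<Θ : 0ℝ < Θ) (0≤B : 0ℝ ≤ B) (β-within : ∀ k → Within (B * γ) (β k))
             (t-within : Within (2ℝ * ρ) (ρ + target n b)) (Θ-large : 8ℝ * (B * (Λ + L)) ≤ Θ) where
      open Objective γ β (target n b)

      private
        v = chain-vertex n b

      0<scale : 0ℝ < scale
      0<scale = 0<* (0<* (0<* 0<Θ 0<ρ) 0<Q) 0<L

      vertex-optimal : ∀ h x y → (∀ k σ → link (U h x y) k σ ≤ scale) →
        objective γ β t h x y ≤ objective γ β t (point-h v) (point-x v) (point-y v) ×
        (objective γ β t (point-h v) (point-x v) (point-y v) ≤ objective γ β t h x y →
          ∀ j → U h x y j ≈ scale * v j)
      vertex-optimal h x y links =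
        *-cancelˡ-≤ 0<scale (≤-via (- (o · E)) (swap-diff difference)
          (≤-respʳ (+-identityˡ (- (o · E))) (≤-diff (proj₁ optimal)))) ,
        λ h≤ j → diff≈0⇒≈ (proj₂ optimal (≤-respʳ difference (≤-diff (*-monoˡ-≤ (<⇒≤ 0<scale) h≤))) j)
        where
        E : ℝ^ (suc d)
        E j = U h x y j - scale * v j
        Uv = U (point-h v) (point-x v) (point-y v)
        X = objective γ β t h x y
        V = objective γ β t (point-h v) (point-x v) (point-y v)
        optimal = descending-optimal n b E o γ̂ (0<* (0<* (0<* 0<Θ 0<ρ) 0<Q) 0<γ)
          (descending n b scale (U h x y) links)
          -- The leading coefficient is exact here; its tolerance is consumed only by the recursion.
          (within-resp (solve 2 (λ g t → con 0ℚ := g :* t :- t :* g) ≈-refl γ̂ (target n b)) (within-0 (<⇒≤ (0<* (0<* (0<* 0<Θ 0<ρ) 0<Q) 0<γ))))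
          (coefficient-near {B} 0<γ 0<ρ 0≤B β-within t-within Θ-large)
        swap-diff : ∀ {x y z} → x - y ≈ z → y - x ≈ - z
        swap-diff {x} {y} {z} e = ≈-trans (solve 2 (λ x y → y :- x := :- (x :- y)) ≈-refl x y) (-‿cong e)
        o·E : o · E ≈ o · U h x y - o · Uv
        o·E = ≈-trans (sum-cong-≋ λ j → ≈-trans (*-congˡ (+-congˡ (-‿cong (≈-sym (U-point v j)))))
              (solve 3 (λ o x y → o :* (x :- y) := o :* x :+ :- (o :* y)) ≈-refl (o j) (U h x y j) (Uv j)))
          (≈-trans (∑-distrib-+ (λ j → o j * U h x y j) (λ j → - (o j * Uv j))) (+-congˡ (sum-neg (λ j → o j * Uv j))))
        difference : scale * X - scale * V ≈ o · E
        difference = begin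
          scale * X - scale * V ≈⟨ +-cong (objective-chain h x y) (-‿cong (objective-chain (point-h v) (point-x v) (point-y v))) ⟩
          (o · U h x y + constant) - (o · Uv + constant) ≈⟨ solve 3 (λ a b c → (a :+ c) :- (b :+ c) := a :- b) ≈-refl (o · U h x y) (o · Uv) constant ⟩
          o · U h x y - o · Uv ≈⟨ o·E ⟨
          o · E ∎

    weighted-U : ∀ h x y → ω d · (U h x y ∘ suc) ≈ L * ell h x
    weighted-U h x y = begin
      sum (λ k → ω d k * (slope d k * e + θ * lift y k))
        ≈⟨ sum-cong-≋ (λ k → solve 5 (λ w s e t Y → w :* (s :* e :+ t :* Y) := w :* s :* e :+ t :* (w :* Y)) ≈-refl
             (ω d k) (slope d k) e θ (lift y k)) ⟩
      sum (λ k → ω d k * slope d k * e + θ * (ω d k * lift y k))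
        ≈⟨ ∑-distrib-+ (λ k → ω d k * slope d k * e) (λ k → θ * (ω d k * lift y k)) ⟩
      sum (λ k → ω d k * slope d k * e) + sum (λ k → θ * (ω d k * lift y k))
        ≈⟨ +-cong (*-distribʳ-sum e (λ k → ω d k * slope d k)) (*-distribˡ-sum θ (λ k → ω d k * lift y k)) ⟨
      L * e + θ * (ω d · lift y) ≈⟨ +-congˡ (≈-trans (*-congˡ (weighted-lift y)) (zeroʳ θ)) ⟩
      L * e + 0ℝ ≈⟨ +-identityʳ (L * e) ⟩
      L * e ∎
      where e = ell h x

    -- U₀ determines x, the weighted sum determines `ell` and hence h, and after removing the
    -- multiples of `ell` the remaining coordinates determine y.
    U-injective : 0ℝ < θ → ∀ h x y h′ x′ y′ → U h x y ≋ U h′ x′ y′ → h ≈ h′ × x ≈ x′ × y ≋ y′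
    U-injective 0<θ h x y h′ x′ y′ e = h≈ , x≈ , y≈
      where
      shift : ∀ {a b c} → a - c ≈ b - c → a ≈ b
      shift {a} {b} {c} p = diff≈0⇒≈ (≈-trans (solve 3 (λ a b c → a :- b := (a :- c) :- (b :- c)) ≈-refl a b c) (≈⇒diff≈0 p))
      x≈ : x ≈ x′
      x≈ = shift (*-cancelˡ (0<⇒≉0 0<L) (e zero))
      ell≈ : ell h x ≈ ell h′ x′
      ell≈ = *-cancelˡ (0<⇒≉0 0<L) (≈-trans (≈-sym (weighted-U h x y))
        (≈-trans (dot-congʳ (ω d) (e ∘ suc)) (weighted-U h′ x′ y′)))
      h≈ : h ≈ h′
      h≈ = begin
        h ≈⟨ solve 4 (λ h x r g → h := (h :+ r :* x :- g) :- r :* x :+ g) ≈-refl h x ρ (G * (ρ * ρ)) ⟩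
        ell h x - ρ * x + G * (ρ * ρ) ≈⟨ +-congʳ (+-cong ell≈ (-‿cong (*-congˡ x≈))) ⟩
        ell h′ x′ - ρ * x′ + G * (ρ * ρ) ≈⟨ solve 4 (λ h x r g → h := (h :+ r :* x :- g) :- r :* x :+ g) ≈-refl h′ x′ ρ (G * (ρ * ρ)) ⟨
        h′ ∎
      y≈ : y ≋ y′
      y≈ k = *-cancelˡ (0<⇒≉0 (0<* 0<θ 0<Q)) (begin
        θ * Q * y k ≈⟨ solve 4 (λ t q y s → t :* q :* y := (s :+ t :* (q :* y)) :- s) ≈-refl θ Q (y k) (slope d (suc k) * ell h x) ⟩
        U h x y (suc (suc k)) - slope d (suc k) * ell h x ≈⟨ +-cong (e (suc (suc k))) (-‿cong (*-congˡ ell≈)) ⟩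
        U h′ x′ y′ (suc (suc k)) - slope d (suc k) * ell h′ x′ ≈⟨ solve 4 (λ t q y s → t :* q :* y := (s :+ t :* (q :* y)) :- s) ≈-refl θ Q (y′ k) (slope d (suc k) * ell h′ x′) ⟨
        θ * Q * y′ k ∎)

    U-cong : ∀ {h x y h′ x′ y′} → h ≈ h′ → x ≈ x′ → y ≋ y′ → U h x y ≋ U h′ x′ y′
    U-cong h≈ x≈ y≈ zero = *-congˡ (+-congʳ x≈)
    U-cong {y = y} {y′ = y′} h≈ x≈ y≈ (suc k) = +-cong (*-congˡ (+-congʳ (+-cong h≈ (*-congˡ x≈)))) (*-congˡ (lift-cong k))
      where
      lift-cong : lift y ≋ lift y′
      lift-cong zero    = -‿cong (dot-congʳ (ω n) y≈)
      lift-cong (suc k) = *-congˡ (y≈ k)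

    -- The gadget surrounds the tangent point x = 2 G ρ, h = -G ρ². The bound on G makes its extent,
    -- θ Q W in x and θ Q Ω W in `ell`, small against these values.
    module Estimates (u : ℝ^ (suc d)) (0≤Θ : 0ℝ ≤ Θ) (1≤ρ : 1ℝ ≤ ρ) (G-large : 2ℝ * (Θ * Q * W * (Ω + 1ℝ)) ≤ G)
                     (u-within : ∀ j → Within W (u j)) where

      private
        K = Θ * Q * W
        0≤ρ : 0ℝ ≤ ρ
        0≤ρ = ≤-trans 0≤1 1≤ρ
        0≤K : 0ℝ ≤ K
        0≤K = 0≤* (0≤* 0≤Θ (<⇒≤ 0<Q)) 0≤W
        offset-within : Within (θ * Q * W) (θ * Q * u zero)
        offset-within = within-* (within-self (0≤* (0≤* 0≤Θ 0≤ρ) (<⇒≤ 0<Q))) (u-within zero)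
        total-part : Within (θ * Q * (Ω * W)) (θ * Q * total u)
        total-part = within-* (within-self (0≤* (0≤* 0≤Θ 0≤ρ) (<⇒≤ 0<Q))) (within-total {u = u} u-within)

      point-x-lower : 0ℝ ≤ point-x u
      point-x-lower = ≤-trans (≤-via (centre - θ * Q * W) (+-identityʳ-neg (centre - θ * Q * W)) below)
        (≤-respˡ (solve 2 (λ c t → c :+ :- t := c :- t) ≈-refl centre (θ * Q * W)) (+-monoʳ-≤ centre (lower offset-within)))
        where
        +-identityʳ-neg : ∀ x → x - 0ℝ ≈ x
        +-identityʳ-neg = solve 1 (λ x → x :- con 0ℚ := x) ≈-refl
        below : 0ℝ ≤ centre - θ * Q * W
        below = ≤-respʳ (solve 6 (λ G Θ Q W Ω ρ → con 2ℚ :* ρ :* (G :- con 2ℚ :* (Θ :* Q :* W :* (Ω :+ con 1ℚ))) :+ ρ :* (Θ :* Q :* W) :* (con 4ℚ :* Ω :+ con 3ℚ)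
            := con 2ℚ :* (G :* ρ) :- Θ :* ρ :* Q :* W) ≈-refl G Θ Q W Ω ρ)
          (0≤+ (0≤* (0≤* (<⇒≤ 0<2) 0≤ρ) (≤-diff G-large)) (0≤* (0≤* 0≤ρ 0≤K) (0≤+ (0≤* (<⇒≤ 0<4) 0≤Ω) (<⇒≤ 0<3))))

      point-x-upper : point-x u ≤ 3ℝ * (G * ρ)
      point-x-upper = ≤-trans (+-monoʳ-≤ centre (upper offset-within))
        (≤-via _ (solve 6 (λ G Θ Q W Ω ρ → con 3ℚ :* (G :* ρ) :- (con 2ℚ :* (G :* ρ) :+ Θ :* ρ :* Q :* W)
            := ρ :* (G :- con 2ℚ :* (Θ :* Q :* W :* (Ω :+ con 1ℚ))) :+ ρ :* (Θ :* Q :* W) :* (con 2ℚ :* Ω :+ con 1ℚ)) ≈-refl G Θ Q W Ω ρ)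
          (0≤+ (0≤* 0≤ρ (≤-diff G-large)) (0≤* (0≤* 0≤ρ 0≤K) (0≤+ (0≤* (<⇒≤ 0<2) 0≤Ω) 0≤1))))

      private
        spread = θ * Q * (Ω * W) + ρ * (θ * Q * W)
        deviation-within : Within spread (θ * Q * total u - ρ * (θ * Q * u zero))
        deviation-within = within-- total-part (within-* (within-self 0≤ρ) offset-within)
        point-h-value : point-h u ≈ - (G * (ρ * ρ)) + (θ * Q * total u - ρ * (θ * Q * u zero))
        point-h-value = solve 4 (λ G r s o → (s :+ G :* (r :* r)) :- r :* (con 2ℚ :* (G :* r) :+ o) := :- (G :* (r :* r)) :+ (s :- r :* o)) ≈-refl
          G ρ (θ * Q * total u) (θ * Q * u zero)
        small : 0ℝ ≤ ½ℝ * (G * (ρ * ρ)) - spread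
        small = ≤-respʳ (solve 6 (λ G Θ Q W Ω ρ → con ½ :* (ρ :* ρ) :* (G :- con 2ℚ :* (Θ :* Q :* W :* (Ω :+ con 1ℚ))) :+ Θ :* Q :* W :* Ω :* ρ :* (ρ :- con 1ℚ)
            := con ½ :* (G :* (ρ :* ρ)) :- (Θ :* ρ :* Q :* (Ω :* W) :+ ρ :* (Θ :* ρ :* Q :* W))) ≈-refl G Θ Q W Ω ρ)
          (0≤+ (0≤* (0≤* (<⇒≤ 0<½) (0≤* 0≤ρ 0≤ρ)) (≤-diff G-large)) (0≤* (0≤* (0≤* 0≤K 0≤Ω) 0≤ρ) (≤-diff 1≤ρ)))

      point-h-upper : point-h u ≤ - (½ℝ * (G * (ρ * ρ)))
      point-h-upper = ≤-respˡ (≈-sym point-h-value) (≤-trans (+-monoʳ-≤ (- (G * (ρ * ρ))) (upper deviation-within))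
        (≤-via _ (solve 2 (λ g s → :- (con ½ :* g) :- (:- g :+ s) := con ½ :* g :- s) ≈-refl (G * (ρ * ρ)) spread) small))

      point-h-lower : 0ℝ < G → - (2ℝ * (G * (ρ * ρ))) < point-h u
      point-h-lower 0<G = <-respʳ (≈-sym point-h-value) (<-≤-trans
        (<-via (½ℝ * (G * (ρ * ρ)) + (½ℝ * (G * (ρ * ρ)) - spread))
          (solve 2 (λ g s → (:- g :+ :- s) :- :- (con 2ℚ :* g) := con ½ :* g :+ (con ½ :* g :- s)) ≈-refl (G * (ρ * ρ)) spread)
          (0<+≤ (0<* 0<½ (0<* 0<G (0<* 0<ρ 0<ρ))) small))
        (+-monoʳ-≤ (- (G * (ρ * ρ))) (lower deviation-within)))
        where
        0<ρ : 0ℝ < ρ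
        0<ρ = <-≤-trans 0<1 1≤ρ

    -- As ρ₀, ρ ≥ 1, the left side is at most (18 Θ Ω + 16 L) G ρ₀ ρ, whence the doubled constants
    -- 36 and 32. On the right, h supplies ½ G ρ₀² and the offset of `ell` supplies G ρ², half of
    -- which pays for ρ x ≤ 2 κ ρ.
    separated : ∀ {ρ₀ h x} → 1ℝ ≤ ρ₀ → 1ℝ ≤ ρ → 0ℝ < G → 4ℝ * κ ≤ G → (36ℝ * (Θ * Ω) + 32ℝ * L) * (ρ₀ * ρ) < ρ₀ * ρ₀ + ρ * ρ →
      h ≤ - (½ℝ * (G * (ρ₀ * ρ₀))) → x ≤ 2ℝ * κ →
      3ℝ * (θ * (Ω * (6ℝ * (G * ρ₀)))) + 2ℝ * (L * (6ℝ * (G * ρ₀) + centre)) < - ell h x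
    separated {ρ₀} {h} {x} 1≤ρ₀ 1≤ρ 0<G 4κ≤G ratio h≤ x≤ = <-via _
      (solve 9 (λ G Θ ρ r κ h x Ω L →
         :- (h :+ ρ :* x :- G :* (ρ :* ρ)) :- (con 3ℚ :* (Θ :* ρ :* (Ω :* (con 6ℚ :* (G :* r)))) :+ con 2ℚ :* (L :* (con 6ℚ :* (G :* r) :+ con 2ℚ :* (G :* ρ))))
         := con ½ :* G :* (r :* r :+ ρ :* ρ :- (con 36ℚ :* (Θ :* Ω) :+ con 32ℚ :* L) :* (r :* ρ))
            :+ ((:- (con ½ :* (G :* (r :* r))) :- h) :+ (ρ :* (con 2ℚ :* κ :- x) :+ (con ½ :* ρ :* (G :* (ρ :- con 1ℚ) :+ (G :- con 4ℚ :* κ))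
            :+ (con 12ℚ :* (L :* G :* r) :* (ρ :- con 1ℚ) :+ con 4ℚ :* (L :* G :* ρ) :* (r :- con 1ℚ)))))) ≈-refl G Θ ρ ρ₀ κ h x Ω L)
      (0<+≤ (0<* (0<* 0<½ 0<G) (<-diff ratio)) (0≤+ (≤-diff h≤) (0≤+ (0≤* 0≤ρ (≤-diff x≤))
        (0≤+ (0≤* (0≤* (<⇒≤ 0<½) 0≤ρ) (0≤+ (0≤* (<⇒≤ 0<G) (≤-diff 1≤ρ)) (≤-diff 4κ≤G)))
          (0≤+ (0≤* (0≤* (<⇒≤ 0<12) (0≤* (0≤* (<⇒≤ 0<L) (<⇒≤ 0<G)) (≤-trans 0≤1 1≤ρ₀))) (≤-diff 1≤ρ))
            (0≤* (0≤* (<⇒≤ 0<4) (0≤* (0≤* (<⇒≤ 0<L) (<⇒≤ 0<G)) 0≤ρ)) (≤-diff 1≤ρ₀)))))))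
      where
      0≤ρ : 0ℝ ≤ ρ
      0≤ρ = ≤-trans 0≤1 1≤ρ

-- The polytope

-- The nesting mirrors (2 d + 1)(d + 1) + 1, so that `index` is a composition of standard
-- bijections.
Constraint : ℕ → Set
Constraint d = (((Fin 2 × Fin d) ⊎ Fin 1) × Fin (suc d)) ⊎ Fin 1

pattern link-at i k σ = inj₁ (inj₁ (σ , k) , i)
pattern side-at e     = inj₁ (inj₂ zero , e)
pattern base          = inj₂ zero

module Construction (em : ExcludedMiddle 0ℓ) (n : ℕ) where
  open Ordered em
  open Chain em
  open Gadget em n
  open Irredundancy em

  ê : Fin (suc d) → ℝ^ (suc d)
  ê zero    = 𝟎
  ê (suc k) = unit (suc k)

  height : ℝ^ (suc d)
  height = unit zero

  -- X zero is the height; the remaining d coordinates are completed by a zero,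
  -- and only differences of entries of x̂ are used.
  x̂ : ℝ^ (suc d) → ℝ^ (suc d)
  x̂ X zero    = 0ℝ
  x̂ X (suc k) = X (suc k)

  ê-dot : ∀ a X → ê a · X ≈ x̂ X a
  ê-dot zero    X = dot-𝟎ˡ X
  ê-dot (suc k) X = unit-dot (suc k) X

  -- One entry other than i serves as origin for the differences, leaving n = d - 1 of them for y.
  -- Thus all d + 1 gadgets are treated alike, although one entry of `x̂` is artificial.
  reference : Fin (suc d) → Fin (suc d)
  reference i = punchIn i zero

  other : Fin (suc d) → Fin n → Fin (suc d)
  other i k = punchIn i (suc k)

  xs : Fin (suc d) → ℝ^ (suc d) → ℝ
  xs i X = x̂ X i - x̂ X (reference i)

  ys : Fin (suc d) → ℝ^ (suc d) → ℝ^ n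
  ys i X k = x̂ X (other i k) - x̂ X (reference i)

  difference : Fin (suc d) → Fin (suc d) → ℝ^ (suc d)
  difference a c = ê a ⊕ (- 1ℝ) ∙ ê c

  difference-dot : ∀ a c X → difference a c · X ≈ x̂ X a - x̂ X c
  difference-dot a c X = ≈-trans (dot-⊕ˡ (ê a) ((- 1ℝ) ∙ ê c) X)
    (+-cong (ê-dot a X) (≈-trans (dot-∙ˡ (- 1ℝ) (ê c) X) (≈-trans (*-congˡ (ê-dot c X))
      (solve 1 (λ x → :- con 1ℚ :* x := :- x) ≈-refl (x̂ X c)))))

  combination-dot : ∀ {k} (t : ℝ^ k) (v : Vector (ℝ^ (suc d)) k) X → combination t v · X ≈ sum (λ j → t j * (v j · X))
  combination-dot t v X = ≈-trans (dot-comm (combination t v) X)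
    (≈-trans (dot-combination X t v) (sum-cong-≋ λ j → *-congˡ (dot-comm X (v j))))

  -- The vector x matters only up to a constant; subtracting its first entry selects the
  -- representative that has the form of an `x̂`.
  point : ℝ → ℝ^ (suc d) → ℝ^ (suc d)
  point h x zero    = h
  point h x (suc k) = x (suc k) - x zero

  x̂-point : ∀ h x a → x̂ (point h x) a ≈ x a - x zero
  x̂-point h x zero    = ≈-sym (-‿inverseʳ (x zero))
  x̂-point h x (suc k) = ≈-refl

  difference-point : ∀ h x a c → x̂ (point h x) a - x̂ (point h x) c ≈ x a - x c
  difference-point h x a c = ≈-trans (+-cong (x̂-point h x a) (-‿cong (x̂-point h x c)))
    (solve 3 (λ a c z → (a :- z) :- (c :- z) := a :- c) ≈-refl (x a) (x c) (x zero))

  gadget-x : Fin (suc d) → ℝ → ℝ^ n → ℝ^ (suc d)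
  gadget-x i x y = insertAt (0ℝ ∷ y) i x

  gadget-x-at : ∀ i x y → gadget-x i x y i ≈ x
  gadget-x-at i x y = ≈-reflexive (insertAt-lookup (0ℝ ∷ y) i x)

  gadget-x-punchIn : ∀ i x y k → gadget-x i x y (punchIn i k) ≈ (0ℝ ∷ y) k
  gadget-x-punchIn i x y k = ≈-reflexive (insertAt-punchIn (0ℝ ∷ y) i x k)

  xs-gadget : ∀ h i x y → xs i (point h (gadget-x i x y)) ≈ x
  xs-gadget h i x y = ≈-trans (difference-point h (gadget-x i x y) i (reference i))
    (≈-trans (+-cong (gadget-x-at i x y) (-‿cong (gadget-x-punchIn i x y zero)))
      (solve 1 (λ x → x :- con 0ℚ := x) ≈-refl x))

  ys-gadget : ∀ h i x y → ys i (point h (gadget-x i x y)) ≋ y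
  ys-gadget h i x y k = ≈-trans (difference-point h (gadget-x i x y) (other i k) (reference i))
    (≈-trans (+-cong (gadget-x-punchIn i x y (suc k)) (-‿cong (gadget-x-punchIn i x y zero)))
      (solve 1 (λ x → x :- con 0ℚ := x) ≈-refl (y k)))

  punchIn-cases : ∀ (i : Fin (suc d)) (F : Fin (suc d) → Set) → F i → (∀ k → F (punchIn i k)) → ∀ a → F a
  punchIn-cases i F at away a with i ≟ a
  ... | yes refl = at
  ... | no i≢a   = ≡.subst F (punchIn-punchOut i≢a) (away (punchOut i≢a))

  coordinates-determine : ∀ i X Y → X zero ≈ Y zero → xs i X ≈ xs i Y → ys i X ≋ ys i Y → X ≋ Y
  coordinates-determine i X Y h≈ x≈ y≈ zero    = h≈
  coordinates-determine i X Y h≈ x≈ y≈ (suc k) = begin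
    X (suc k) ≈⟨ solve 2 (λ x r → x := (x :- r) :- (con 0ℚ :- r)) ≈-refl (X (suc k)) (x̂ X r) ⟩
    (x̂ X (suc k) - x̂ X r) - (x̂ X zero - x̂ X r) ≈⟨ +-cong (relative (suc k)) (-‿cong (relative zero)) ⟩
    (x̂ Y (suc k) - x̂ Y r) - (x̂ Y zero - x̂ Y r) ≈⟨ solve 2 (λ x r → x := (x :- r) :- (con 0ℚ :- r)) ≈-refl (Y (suc k)) (x̂ Y r) ⟨
    Y (suc k) ∎
    where
    r = reference i
    relative : ∀ a → x̂ X a - x̂ X r ≈ x̂ Y a - x̂ Y r
    relative = punchIn-cases i (λ a → x̂ X a - x̂ X r ≈ x̂ Y a - x̂ Y r) x≈ λ where
      zero    → ≈-trans (-‿inverseʳ (x̂ X r)) (≈-sym (-‿inverseʳ (x̂ Y r)))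
      (suc k) → y≈ k

  -- Outer normals of a simplex in the d horizontal coordinates; they add up to zero.
  side : Fin (suc d) → ℝ^ (suc d)
  side zero    = 0ℝ ∷ λ _ → 1ℝ
  side (suc k) = (- 1ℝ) ∙ unit (suc k)

  -- The inequalities, their slacks and boundedness

  module Normals (G Θ D₂ T : ℝ) (ρ : Fin (suc d) → ℝ) where
    module Γ (i : Fin (suc d)) = At G Θ (ρ i)

    Û : Fin (suc d) → ℝ^ (suc d) → ℝ^ (suc d)
    Û i X = Γ.U i (X zero) (xs i X) (ys i X)

    lift-normal : Fin (suc d) → Fin d → ℝ^ (suc d)
    lift-normal i zero    = combination (λ k → - ω n k) (λ k → difference (other i k) (reference i))
    lift-normal i (suc k) = Q ∙ difference (other i k) (reference i)

    U-normal : Fin (suc d) → Fin (suc d) → ℝ^ (suc d)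
    U-normal i zero    = L ∙ difference i (reference i)
    U-normal i (suc k) = slope d k ∙ (height ⊕ ρ i ∙ difference i (reference i)) ⊕ Γ.θ i ∙ lift-normal i k

    U-offset : Fin (suc d) → ℝ^ (suc d)
    U-offset i zero    = L * Γ.centre i
    U-offset i (suc k) = slope d k * (G * (ρ i * ρ i))

    lift-normal-dot : ∀ i k X → lift-normal i k · X ≈ lift (ys i X) k
    lift-normal-dot i (suc k) X = ≈-trans (dot-∙ˡ Q (difference (other i k) (reference i)) X)
      (*-congˡ (difference-dot (other i k) (reference i) X))
    lift-normal-dot i zero X = begin
      combination (λ k → - ω n k) (λ k → difference (other i k) (reference i)) · X
        ≈⟨ combination-dot (λ k → - ω n k) (λ k → difference (other i k) (reference i)) X ⟩
      sum (λ k → - ω n k * (difference (other i k) (reference i) · X))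
        ≈⟨ sum-cong-≋ (λ k → ≈-trans (*-congˡ (difference-dot (other i k) (reference i) X))
             (solve 2 (λ w y → :- w :* y := :- (w :* y)) ≈-refl (ω n k) (ys i X k))) ⟩
      sum (λ k → - (ω n k * ys i X k)) ≈⟨ sum-neg (λ k → ω n k * ys i X k) ⟩
      - (ω n · ys i X) ∎

    U-normal-dot : ∀ i j X → U-normal i j · X ≈ Û i X j + U-offset i j
    U-normal-dot i zero X = ≈-trans (dot-∙ˡ L (difference i (reference i)) X) (≈-trans (*-congˡ (difference-dot i (reference i) X))
      (solve 3 (λ L x c → L :* x := L :* (x :- c) :+ L :* c) ≈-refl L (xs i X) (Γ.centre i)))
    U-normal-dot i (suc k) X = begin
      (slope d k ∙ (height ⊕ ρ i ∙ difference i (reference i)) ⊕ Γ.θ i ∙ lift-normal i k) · X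
        ≈⟨ dot-⊕ˡ (slope d k ∙ (height ⊕ ρ i ∙ difference i (reference i))) (Γ.θ i ∙ lift-normal i k) X ⟩
      (slope d k ∙ (height ⊕ ρ i ∙ difference i (reference i))) · X + (Γ.θ i ∙ lift-normal i k) · X
        ≈⟨ +-cong (≈-trans (dot-∙ˡ (slope d k) (height ⊕ ρ i ∙ difference i (reference i)) X) (*-congˡ (≈-trans (dot-⊕ˡ height (ρ i ∙ difference i (reference i)) X)
             (+-cong (unit-dot zero X) (≈-trans (dot-∙ˡ (ρ i) (difference i (reference i)) X) (*-congˡ (difference-dot i (reference i) X)))))))
             (≈-trans (dot-∙ˡ (Γ.θ i) (lift-normal i k) X) (*-congˡ (lift-normal-dot i k X))) ⟩
      slope d k * (X zero + ρ i * xs i X) + Γ.θ i * lift (ys i X) k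
        ≈⟨ solve 6 (λ s h r x g y → s :* (h :+ r :* x) :+ y := s :* (h :+ r :* x :- g) :+ y :+ s :* g) ≈-refl
             (slope d k) (X zero) (ρ i) (xs i X) (G * (ρ i * ρ i)) (Γ.θ i * lift (ys i X) k) ⟩
      Û i X (suc k) + U-offset i (suc k) ∎

    -- A large T makes the sides nearly vertical walls that still close above, so together with the
    -- base they form a simplex.
    normal : Constraint d → ℝ^ (suc d)
    normal (link-at i k σ) = U-normal i (suc k) ⊕ (2ℝ * sg σ) ∙ U-normal i (inject₁ k)
    normal (side-at e)     = T ∙ side e ⊕ height
    normal base            = (- 1ℝ) ∙ height

    bound : Constraint d → ℝ
    bound (link-at i k σ) = Γ.scale i + link (U-offset i) k σ
    bound (side-at e)     = T * D₂
    bound base            = 2ℝ * T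

    slackness : ℝ^ (suc d) → Constraint d → ℝ
    slackness X (link-at i k σ) = Γ.scale i - link (Û i X) k σ
    slackness X (side-at e)     = T * (D₂ - side e · X) - X zero
    slackness X base            = X zero + 2ℝ * T

    slackness-value : ∀ X c → bound c - normal c · X ≈ slackness X c
    slackness-value X (link-at i k σ) = ≈-trans
      (+-congˡ (-‿cong (≈-trans (dot-⊕ˡ (U-normal i (suc k)) ((2ℝ * sg σ) ∙ U-normal i (inject₁ k)) X)
        (+-cong (U-normal-dot i (suc k) X) (≈-trans (dot-∙ˡ (2ℝ * sg σ) (U-normal i (inject₁ k)) X) (*-congˡ (U-normal-dot i (inject₁ k) X)))))))
      (solve 6 (λ s a b c σ o → (s :+ (o :+ σ :* c)) :- ((a :+ o) :+ σ :* (b :+ c)) := s :- (a :+ σ :* b)) ≈-refl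
        (Γ.scale i) (Û i X (suc k)) (Û i X (inject₁ k)) (U-offset i (inject₁ k)) (2ℝ * sg σ) (U-offset i (suc k)))
    slackness-value X (side-at e) = ≈-trans
      (+-congˡ (-‿cong (≈-trans (dot-⊕ˡ (T ∙ side e) height X) (+-cong (dot-∙ˡ T (side e) X) (unit-dot zero X)))))
      (solve 4 (λ T D s h → T :* D :- (T :* s :+ h) := T :* (D :- s) :- h) ≈-refl T D₂ (side e · X) (X zero))
    slackness-value X base = ≈-trans
      (+-congˡ (-‿cong (≈-trans (dot-∙ˡ (- 1ℝ) height X) (*-congˡ (unit-dot zero X)))))
      (solve 2 (λ h T → con 2ℚ :* T :- :- con 1ℚ :* h := h :+ con 2ℚ :* T) ≈-refl (X zero) T)

    holds : ∀ X c → 0ℝ ≤ slackness X c → normal c · X ≤ bound c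
    holds X c = ≤-via (slackness X c) (slackness-value X c)

    strict : ∀ X c → 0ℝ < slackness X c → normal c · X < bound c
    strict X c = <-via (slackness X c) (slackness-value X c)

    tight : ∀ X c → slackness X c ≈ 0ℝ → normal c · X ≈ bound c
    tight X c e = ≈-sym (diff≈0⇒≈ (≈-trans (slackness-value X c) e))

    slack-holds : ∀ X c → normal c · X ≤ bound c → 0ℝ ≤ slackness X c
    slack-holds X c h = ≤-respʳ (slackness-value X c) (≤-diff h)

    ones : ℝ
    ones = sum {suc d} (λ _ → 1ℝ)

    0≤ones : 0ℝ ≤ ones
    0≤ones = sum-0≤ {suc d} (λ _ → 0≤1)

    sum-const : ∀ m D → sum {m} (λ _ → D) ≈ sum {m} (λ _ → 1ℝ) * D
    sum-const m D = ≈-trans (sum-cong-≋ {m} (λ _ → ≈-sym (*-identityˡ D))) (≈-sym (*-distribʳ-sum {m} D (λ _ → 1ℝ)))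

    Feasible : ℝ^ (suc d) → Set
    Feasible X = ∀ c → normal c · X ≤ bound c

    side-zero-dot : ∀ X → side zero · X ≈ sum (λ k → X (suc k))
    side-zero-dot X = ≈-trans (+-cong (zeroˡ (X zero)) (sum-cong-≋ λ k → *-identityˡ (X (suc k)))) (+-identityˡ (sum (λ k → X (suc k))))

    side-suc-dot : ∀ k X → side (suc k) · X ≈ - X (suc k)
    side-suc-dot k X = ≈-trans (dot-∙ˡ (- 1ℝ) (unit (suc k)) X) (≈-trans (*-congˡ (unit-dot (suc k) X))
      (solve 1 (λ x → :- con 1ℚ :* x := :- x) ≈-refl (X (suc k))))

    -- The sides and the base suffice. From h ≥ -2 T each side functional is at most D₂ + 2; this
    -- bounds every -X_k and the sum of the X_k, hence every X_k, and one side then bounds h from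
    -- above.
    feasible-bounded : 0ℝ < T → 0ℝ ≤ D₂ → ∃ λ C → ∀ X → Feasible X → ∀ a → X a ≤ C × - X a ≤ C
    feasible-bounded 0<T 0≤D₂ = C , λ X feasible → bounds X feasible
      where
      E = D₂ + 2ℝ
      0≤E : 0ℝ ≤ E
      0≤E = 0≤+ 0≤D₂ (<⇒≤ 0<2)
      C = ones * E + (T * D₂ + T * (ones * E) + 2ℝ * T)
      0≤oE : 0ℝ ≤ ones * E
      0≤oE = 0≤* 0≤ones 0≤E
      0≤rest : 0ℝ ≤ T * D₂ + T * (ones * E) + 2ℝ * T
      0≤rest = 0≤+ (0≤+ (0≤* (<⇒≤ 0<T) 0≤D₂) (0≤* (<⇒≤ 0<T) 0≤oE)) (0≤* (<⇒≤ 0<2) (<⇒≤ 0<T))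
      bounds : ∀ X → Feasible X → ∀ a → X a ≤ C × - X a ≤ C
      bounds X feasible = result
        where
        h = X zero
        -h≤ : 0ℝ ≤ h + 2ℝ * T
        -h≤ = slack-holds X base (feasible base)
        side≤ : ∀ e → side e · X ≤ E
        side≤ e = *-cancelˡ-≤ 0<T (≤-via ((T * (D₂ - side e · X) - h) + (h + 2ℝ * T))
          (solve 4 (λ T D s h → T :* (D :+ con 2ℚ) :- T :* s := (T :* (D :- s) :- h) :+ (h :+ con 2ℚ :* T)) ≈-refl T D₂ (side e · X) h)
          (0≤+ (slack-holds X (side-at e) (feasible (side-at e))) -h≤))
        -X≤ : ∀ k → - X (suc k) ≤ E
        -X≤ k = ≤-respˡ (side-suc-dot k X) (side≤ (suc k))
        total-X = sum (λ k → X (suc k))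
        total-X≤ : total-X ≤ E
        total-X≤ = ≤-respˡ (side-zero-dot X) (side≤ zero)
        ones≥ : sum {d} (λ _ → 1ℝ) * E ≤ ones * E
        ones≥ = ≤-via E (solve 2 (λ o E → (con 1ℚ :+ o) :* E :- o :* E := E) ≈-refl (sum {d} (λ _ → 1ℝ)) E) 0≤E
        -Σ≤ : - total-X ≤ ones * E
        -Σ≤ = ≤-trans (≤-respˡ (sum-neg (λ k → X (suc k))) (≤-trans (sum-mono-≤ -X≤) (≈⇒≤ (sum-const d E)))) ones≥
        X≤ : ∀ k → X (suc k) ≤ ones * E
        X≤ k = ≤-via (E + (E - total-X) + (sum (λ j → X (suc j) + E) - (X (suc k) + E)))
            (≈-trans (solve 4 (λ o E s x → (con 1ℚ :+ o) :* E :- x := E :+ (E :- s) :+ ((s :+ o :* E) :- (x :+ E))) ≈-refl (sum {d} (λ _ → 1ℝ)) E total-X (X (suc k)))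
              (+-congˡ (+-congʳ (≈-sym (≈-trans (∑-distrib-+ (λ j → X (suc j)) (λ _ → E)) (+-congˡ (sum-const d E)))))))
            (0≤+ (0≤+ 0≤E (≤-diff total-X≤)) (≤-diff (term≤sum {f = λ j → X (suc j) + E} shifted k)))
          where
          shifted : ∀ j → 0ℝ ≤ X (suc j) + E
          shifted j = ≤-respʳ (solve 2 (λ x E → E :- :- x := x :+ E) ≈-refl (X (suc j)) E) (≤-diff (-X≤ j))
        oE≤C : ones * E ≤ C
        oE≤C = ≤-via _ (solve 2 (λ a b → (a :+ b) :- a := b) ≈-refl (ones * E) (T * D₂ + T * (ones * E) + 2ℝ * T)) 0≤rest
        E≤oE : E ≤ ones * E
        E≤oE = ≤-via (sum {d} (λ _ → 1ℝ) * E) (solve 2 (λ o E → (con 1ℚ :+ o) :* E :- E := o :* E) ≈-refl (sum {d} (λ _ → 1ℝ)) E)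
          (0≤* (sum-0≤ {d} (λ _ → 0≤1)) 0≤E)
        result : ∀ a → X a ≤ C × - X a ≤ C
        result (suc k) = ≤-trans (X≤ k) oE≤C , ≤-trans (-X≤ k) (≤-trans E≤oE oE≤C)
        result zero =
          ≤-via (ones * E + 2ℝ * T + ((T * (D₂ - side zero · X) - h) + T * (ones * E - - total-X)))
            (≈-trans (solve 6 (λ o E T D h s → o :* E :+ (T :* D :+ T :* (o :* E) :+ con 2ℚ :* T) :- h
                := o :* E :+ con 2ℚ :* T :+ ((T :* (D :- s) :- h) :+ T :* (o :* E :- :- s))) ≈-refl ones E T D₂ h total-X)
              (+-congˡ (+-congʳ (+-congʳ (*-congˡ (+-congˡ (-‿cong (≈-sym (side-zero-dot X)))))))))
            (0≤+ (0≤+ 0≤oE (0≤* (<⇒≤ 0<2) (<⇒≤ 0<T))) (0≤+ (slack-holds X (side-at zero) (feasible (side-at zero))) (0≤* (<⇒≤ 0<T) (≤-diff -Σ≤)))) ,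
          ≤-via ((h + 2ℝ * T) + (ones * E + (T * D₂ + T * (ones * E))))
            (solve 5 (λ h T oE D s → oE :+ (T :* D :+ T :* oE :+ con 2ℚ :* T) :- :- h := (h :+ con 2ℚ :* T) :+ (oE :+ (T :* D :+ T :* oE))) ≈-refl h T (ones * E) D₂ total-X)
            (0≤+ -h≤ (0≤+ 0≤oE (0≤+ (0≤* (<⇒≤ 0<T) 0≤D₂) (0≤* (<⇒≤ 0<T) 0≤oE))))

    side-within : ∀ {D X} → 0ℝ ≤ D → (∀ k → Within D (X (suc k))) → ∀ e → Within (ones * D) (side e · X)
    side-within {D} {X} 0≤D h zero = within-resp (≈-sym (side-zero-dot X)) (within-mono
      (≤-trans (≈⇒≤ (sum-const d D)) (≤-via D (solve 2 (λ o D → (con 1ℚ :+ o) :* D :- o :* D := D) ≈-refl (sum {d} (λ _ → 1ℝ)) D) 0≤D))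
      (within-sum {D = λ _ → D} h))
    side-within {D} {X} 0≤D h (suc k) = within-resp (≈-sym (side-suc-dot k X)) (within-mono
      (≤-via (sum {d} (λ _ → 1ℝ) * D) (solve 2 (λ o D → (con 1ℚ :+ o) :* D :- D := o :* D) ≈-refl (sum {d} (λ _ → 1ℝ)) D)
        (0≤* (sum-0≤ {d} (λ _ → 0≤1)) 0≤D)) (within-neg (h k)))

    link-scale : ∀ s {u v : ℝ^ (suc d)} → (∀ j → u j ≈ s * v j) → ∀ k σ → link u k σ ≈ s * link v k σ
    link-scale s {u} {v} e k σ = ≈-trans (+-cong (e (suc k)) (*-congˡ (e (inject₁ k))))
      (solve 4 (λ s a b t → s :* a :+ t :* (s :* b) := s :* (a :+ t :* b)) ≈-refl s (v (suc k)) (v (inject₁ k)) (2ℝ * sg σ))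

    gadget-point : Fin (suc d) → ℝ^ (suc d) → ℝ^ (suc d)
    gadget-point i u = point (Γ.point-h i u) (gadget-x i (Γ.point-x i u) (Γ.point-y i u))

    Û-gadget-point : ∀ i u j → Û i (gadget-point i u) j ≈ Γ.scale i * u j
    Û-gadget-point i u j = ≈-trans (Γ.U-cong i ≈-refl (xs-gadget h i x y) (ys-gadget h i x y) j) (Γ.U-point i u j)
      where
      h = Γ.point-h i u
      x = Γ.point-x i u
      y = Γ.point-y i u

    own-slackness : ∀ i u k σ → slackness (gadget-point i u) (link-at i k σ) ≈ Γ.scale i * (1ℝ - link u k σ)
    own-slackness i u k σ = ≈-trans (+-congˡ (-‿cong (link-scale (Γ.scale i) (Û-gadget-point i u) k σ)))
      (solve 2 (λ s l → s :- s :* l := s :* (con 1ℚ :- l)) ≈-refl (Γ.scale i) (link u k σ))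

    D E : ℝ
    D = D₂ + 1ℝ
    E = D + D

    -- `T-large` and `D₂-large` place the gadget points strictly inside the simplex, `far` places
    -- the points certifying the sides and the base strictly inside all gadgets, and `ratio` with
    -- `κ-small` keeps the gadgets apart.
    record Bounds : Set where
      field
        0<Θ      : 0ℝ < Θ
        0<G      : 0ℝ < G
        0<T      : 0ℝ < T
        1≤ρ      : ∀ i → 1ℝ ≤ ρ i
        G-large  : 2ℝ * (Θ * Q * W * (Ω + 1ℝ)) ≤ G
        κ-small  : 4ℝ * κ ≤ G
        ratio    : ∀ {i j} → i ≢ j → (36ℝ * (Θ * Ω) + 32ℝ * L) * (ρ i * ρ j) < ρ i * ρ i + ρ j * ρ j
        T-large  : ∀ i → 2ℝ * (G * (ρ i * ρ i)) ≤ T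
        D₂-large : ∀ i → ones * (6ℝ * (G * ρ i)) ≤ D₂
        far      : ∀ i → 3ℝ * (Γ.θ i * (Ω * E)) + 2ℝ * (L * (E + Γ.centre i)) + ρ i * E < T

    module WithBounds (B : Bounds) where
      open Bounds B

      0<ρ : ∀ i → 0ℝ < ρ i
      0<ρ i = <-≤-trans 0<1 (1≤ρ i)

      0<θ : ∀ i → 0ℝ < Γ.θ i
      0<θ i = 0<* 0<Θ (0<ρ i)

      0<scale : ∀ i → 0ℝ < Γ.scale i
      0<scale i = 0<* (0<* (0<θ i) 0<Q) 0<L

      0≤Gρ : ∀ i → 0ℝ ≤ G * ρ i
      0≤Gρ i = <⇒≤ (0<* 0<G (0<ρ i))

      0≤D₂ : 0ℝ ≤ D₂
      0≤D₂ = ≤-trans (0≤* 0≤ones (0≤* (<⇒≤ 0<6) (0≤Gρ zero))) (D₂-large zero)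

      0≤D : 0ℝ ≤ D
      0≤D = 0≤+ 0≤D₂ 0≤1

      slack-of-negative : ∀ X j k σ → link (Û j X) k σ < 0ℝ → 0ℝ < slackness X (link-at j k σ)
      slack-of-negative X j k σ h = 0≤+< (<⇒≤ (0<scale j)) (<-respʳ (+-identityˡ (- link (Û j X) k σ)) (<-diff h))

      -- At height -T or lower, -`ell` is at least T - ρ E, so `far` is exactly the depth required
      -- by `deep-slack`.
      far-slack : ∀ X → X zero ≤ - T → (∀ a → Within D (x̂ X a)) → ∀ j k σ → 0ℝ < slackness X (link-at j k σ)
      far-slack X h≤ x-within j k σ = slack-of-negative X j k σ
        (Γ.deep-slack j (0<θ j) (0≤Gρ j) x-in (λ k → within-- (x-within (other j k)) (x-within (reference j)))
          (<-via ((T - far-bound) + ((- T - X zero) + (ρ j * (E - xs j X) + G * (ρ j * ρ j))))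
            (solve 7 (λ T F h r x g E → :- (h :+ r :* x :- g) :- F := (T :- (F :+ r :* E)) :+ ((:- T :- h) :+ (r :* (E :- x) :+ g))) ≈-refl
              T (3ℝ * (Γ.θ j * (Ω * E)) + 2ℝ * (L * (E + Γ.centre j))) (X zero) (ρ j) (xs j X) (G * (ρ j * ρ j)) E)
            (0<+≤ (<-diff (far j)) (0≤+ (≤-diff h≤) (0≤+ (0≤* (<⇒≤ (0<ρ j)) (≤-diff (upper x-in))) (<⇒≤ (0<* 0<G (0<* (0<ρ j) (0<ρ j)))))))) k σ)
        where
        far-bound = 3ℝ * (Γ.θ j * (Ω * E)) + 2ℝ * (L * (E + Γ.centre j)) + ρ j * E
        x-in : Within E (xs j X)
        x-in = within-- (x-within j) (x-within (reference j))

      module GadgetPoint (i : Fin (suc d)) (u : ℝ^ (suc d)) (u-within : ∀ j → Within W (u j)) where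
        open Γ.Estimates i u (<⇒≤ 0<Θ) (1≤ρ i) G-large u-within

        X = gadget-point i u
        h = Γ.point-h i u
        x = Γ.point-x i u
        y = Γ.point-y i u
        xx = gadget-x i x y
        C = 3ℝ * (G * ρ i)

        y-within : ∀ k → Within κ ((0ℝ ∷ y) k)
        y-within zero    = within-0 0≤κ
        y-within (suc k) = Γ.within-point-y i {u = u} u-within k

        κ≤C : κ ≤ C
        κ≤C = ≤-via ((G - 4ℝ * κ) + (3ℝ * κ + (2ℝ * G + 3ℝ * G * (ρ i - 1ℝ))))
          (solve 3 (λ G k r → con 3ℚ :* (G :* r) :- k := (G :- con 4ℚ :* k) :+ (con 3ℚ :* k :+ (con 2ℚ :* G :+ con 3ℚ :* G :* (r :- con 1ℚ)))) ≈-refl G κ (ρ i))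
          (0≤+ (≤-diff κ-small) (0≤+ (0≤* (<⇒≤ 0<3) 0≤κ) (0≤+ (0≤* (<⇒≤ 0<2) (<⇒≤ 0<G))
            (0≤* (0≤* (<⇒≤ 0<3) (<⇒≤ 0<G)) (≤-diff (1≤ρ i))))))

        xx-within : ∀ a → Within C (xx a)
        xx-within = punchIn-cases i (λ a → Within C (xx a))
          (within-resp (≈-sym (gadget-x-at i x y)) (within
            (≤-trans (≤-via C (solve 1 (λ C → con 0ℚ :- :- C := C) ≈-refl C) (0≤* (<⇒≤ 0<3) (0≤Gρ i))) point-x-lower) point-x-upper))
          (λ k → within-resp (≈-sym (gadget-x-punchIn i x y k)) (within-mono κ≤C (y-within k)))

        xx-lower : ∀ a → - κ ≤ xx a
        xx-lower = punchIn-cases i (λ a → - κ ≤ xx a)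
          (≤-respʳ (≈-sym (gadget-x-at i x y)) (≤-trans (≤-via κ (solve 1 (λ C → con 0ℚ :- :- C := C) ≈-refl κ) 0≤κ) point-x-lower))
          (λ k → ≤-respʳ (≈-sym (gadget-x-punchIn i x y k)) (lower (y-within k)))

        xx-upper : ∀ a → i ≢ a → xx a ≤ κ
        xx-upper = punchIn-cases i (λ a → i ≢ a → xx a ≤ κ) (λ i≢i → ⊥-elim (i≢i refl))
          (λ k _ → ≤-respˡ (≈-sym (gadget-x-punchIn i x y k)) (upper (y-within k)))

        difference-within : ∀ a c → Within (6ℝ * (G * ρ i)) (xx a - xx c)
        difference-within a c = within-mono (≈⇒≤ (solve 1 (λ g → con 3ℚ :* g :+ con 3ℚ :* g := con 6ℚ :* g) ≈-refl (G * ρ i)))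
          (within-- (xx-within a) (xx-within c))

        h<0 : h < 0ℝ
        h<0 = ≤-<-trans point-h-upper (<-via (½ℝ * (G * (ρ i * ρ i)))
          (solve 1 (λ g → con 0ℚ :- :- (con ½ :* g) := con ½ :* g) ≈-refl (G * (ρ i * ρ i)))
          (0<* 0<½ (0<* 0<G (0<* (0<ρ i) (0<ρ i)))))

        other-slack : ∀ j → i ≢ j → ∀ k σ → 0ℝ < slackness X (link-at j k σ)
        other-slack j i≢j k σ = slack-of-negative X j k σ
          (Γ.deep-slack j (0<θ j) (0≤Gρ j) (relocate j (reference j)) (λ k → relocate (other j k) (reference j))
            (Γ.separated j (1≤ρ i) (1≤ρ j) 0<G κ-small (ratio i≢j) point-h-upper xs≤) k σ)
          where
          relocate : ∀ a c → Within (6ℝ * (G * ρ i)) (x̂ X a - x̂ X c)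
          relocate a c = within-resp (≈-sym (difference-point h xx a c)) (difference-within a c)
          -- Entry j is small because j ≠ i. The reference entry of gadget j may be the large entry
          -- i, but it enters with a minus sign, and only an upper bound is wanted.
          xs≤ : xs j X ≤ 2ℝ * κ
          xs≤ = ≤-respˡ (≈-sym (difference-point h xx j (reference j)))
            (≤-via ((κ - xx j) + (xx (reference j) - - κ))
              (solve 3 (λ k a c → con 2ℚ :* k :- (a :- c) := (k :- a) :+ (c :- :- k)) ≈-refl κ (xx j) (xx (reference j)))
              (0≤+ (≤-diff (xx-upper j i≢j)) (≤-diff (xx-lower (reference j)))))

        side-slack : ∀ e → 0ℝ < slackness X (side-at e)
        side-slack e = 0≤+< (0≤* (<⇒≤ 0<T) (≤-diff (≤-trans (upper (side-within {X = X} (0≤* (<⇒≤ 0<6) (0≤Gρ i))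
            (λ k → difference-within (suc k) zero) e)) (D₂-large i))))
          (<-respʳ (+-identityˡ (- h)) (<-diff h<0))

        base-slack : 0ℝ < slackness X base
        base-slack = <-respʳ (solve 3 (λ h T g → (h :- :- (con 2ℚ :* g)) :+ ((T :- con 2ℚ :* g) :+ T) := h :+ con 2ℚ :* T) ≈-refl h T (G * (ρ i * ρ i)))
          (0<+≤ (<-diff (point-h-lower 0<G)) (0≤+ (≤-diff (T-large i)) (<⇒≤ 0<T)))

        own-slack : ∀ k σ → link u k σ < 1ℝ → 0ℝ < slackness X (link-at i k σ)
        own-slack k σ lt = <-respʳ (≈-sym (own-slackness i u k σ)) (0<* (0<scale i) (<-diff lt))

        own-feasible : ∀ k σ → link u k σ ≤ 1ℝ → 0ℝ ≤ slackness X (link-at i k σ)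
        own-feasible k σ le = ≤-respʳ (≈-sym (own-slackness i u k σ)) (0≤* (<⇒≤ (0<scale i)) (≤-diff le))

        own-tight : ∀ k σ → link u k σ ≈ 1ℝ → slackness X (link-at i k σ) ≈ 0ℝ
        own-tight k σ eq = ≈-trans (own-slackness i u k σ)
          (≈-trans (*-congˡ (≈⇒diff≈0 (≈-sym eq))) (zeroʳ (Γ.scale i)))

      gadget-point-feasible : ∀ i u → (∀ j → Within W (u j)) → (∀ k σ → link u k σ ≤ 1ℝ) → Feasible (gadget-point i u)
      gadget-point-feasible i u u-within links (link-at j k σ) = own-or-other (i ≟ j)
        where
        open GadgetPoint i u u-within
        own-or-other : Dec (i ≡ j) → normal (link-at j k σ) · X ≤ bound (link-at j k σ)
        own-or-other (yes refl) = holds X (link-at i k σ) (own-feasible k σ (links k σ))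
        own-or-other (no i≢j)   = holds X (link-at j k σ) (<⇒≤ (other-slack j i≢j k σ))
      gadget-point-feasible i u u-within links (side-at e) = holds X (side-at e) (<⇒≤ (side-slack e))
        where open GadgetPoint i u u-within
      gadget-point-feasible i u u-within links base = holds X base (<⇒≤ base-slack)
        where open GadgetPoint i u u-within

      -- Points certifying irredundancy

      unit-off : ∀ {m} {a c : Fin m} → a ≢ c → unit a c ≡ 0ℝ
      unit-off {a = zero}  {zero}  ne = ⊥-elim (ne refl)
      unit-off {a = zero}  {suc c} ne = refl
      unit-off {a = suc a} {zero}  ne = refl
      unit-off {a = suc a} {suc c} ne = unit-off (ne ∘ ≡.cong suc)

      unit-within : ∀ {m} (a c : Fin m) → Within 1ℝ (unit a c)
      unit-within zero    zero    = within-self 0≤1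
      unit-within zero    (suc c) = within-0 0≤1
      unit-within (suc a) zero    = within-0 0≤1
      unit-within (suc a) (suc c) = unit-within a c

      0≤unit : ∀ {m} (a c : Fin m) → 0ℝ ≤ unit a c
      0≤unit zero    zero    = 0≤1
      0≤unit zero    (suc c) = ≤-refl
      0≤unit (suc a) zero    = ≤-refl
      0≤unit (suc a) (suc c) = 0≤unit a c

      side-offset : Fin (suc d) → ℝ^ d
      side-offset zero    k = D * unit zero k
      side-offset (suc a) k = - D * unit a k

      -- The height -T compensates for the value D = D₂ + 1 of the side functional: T (D₂ - D) + T =
      -- 0.
      side-point : Fin (suc d) → ℝ^ (suc d)
      side-point e = - T ∷ side-offset e

      side-offset-within : ∀ e k → Within D (side-offset e k)
      side-offset-within zero    k = within-mono (≈⇒≤ (*-identityʳ D)) (within-* (within-self 0≤D) (unit-within zero k))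
      side-offset-within (suc a) k = within-mono (≈⇒≤ (*-identityʳ D)) (within-* (within-neg (within-self 0≤D)) (unit-within a k))

      side-point-within : ∀ e a → Within D (x̂ (side-point e) a)
      side-point-within e zero    = within-0 0≤D
      side-point-within e (suc k) = side-offset-within e k

      sum-scaled-unit : ∀ C (a : Fin d) → sum (λ k → C * unit a k) ≈ C
      sum-scaled-unit C a = ≈-trans (sum-cong-≋ λ k → *-comm C (unit a k)) (unit-dot a (λ _ → C))

      side-own : ∀ e → side e · side-point e ≈ D
      side-own zero    = ≈-trans (side-zero-dot (side-point zero)) (sum-scaled-unit D zero)
      side-own (suc a) = ≈-trans (side-suc-dot a (side-point (suc a)))
        (≈-trans (-‿cong (*-congˡ (≈-reflexive (unit-same a)))) (solve 1 (λ D → :- (:- D :* con 1ℚ) := D) ≈-refl D))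

      side-other : ∀ e f → e ≢ f → side f · side-point e ≤ 0ℝ
      side-other zero zero ne = ⊥-elim (ne refl)
      side-other zero (suc k) ne = ≤-respˡ (≈-sym (side-suc-dot k (side-point zero)))
        (≤-via _ (solve 1 (λ x → con 0ℚ :- :- x := x) ≈-refl (D * unit zero k)) (0≤* 0≤D (0≤unit zero k)))
      side-other (suc a) zero ne = ≤-respˡ (≈-sym (≈-trans (side-zero-dot (side-point (suc a))) (sum-scaled-unit (- D) a)))
        (≤-via _ (solve 1 (λ x → con 0ℚ :- :- x := x) ≈-refl D) 0≤D)
      side-other (suc a) (suc k) ne = ≈⇒≤ (≈-trans (side-suc-dot k (side-point (suc a)))
        (≈-trans (-‿cong (*-congˡ (≈-reflexive (unit-off {a = a} {k} (ne ∘ ≡.cong suc))))) (solve 1 (λ D → :- (:- D :* con 0ℚ) := con 0ℚ) ≈-refl D)))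

      axis-point : ℝ → ℝ^ (suc d)
      axis-point h = h ∷ 𝟎

      axis-within : ∀ h a → Within D (x̂ (axis-point h) a)
      axis-within h zero    = within-0 0≤D
      axis-within h (suc k) = within-0 0≤D

      axis-side-slack : ∀ h → h ≤ - T → ∀ e → 0ℝ < slackness (axis-point h) (side-at e)
      axis-side-slack h h≤-T e = 0≤+< (0≤* (<⇒≤ 0<T) (≤-diff (≤-trans
          (≤-respʳ (zeroʳ ones) (upper (side-within {X = axis-point h} ≤-refl (λ _ → within-0 ≤-refl) e))) 0≤D₂)))
        (<-via (T + (- T - h)) (solve 2 (λ h T → :- h :- con 0ℚ := T :+ (:- T :- h)) ≈-refl h T) (0<+≤ 0<T (≤-diff h≤-T)))

      -2T≤-T : - (2ℝ * T) ≤ - T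
      -2T≤-T = ≤-via T (solve 1 (λ T → :- T :- :- (con 2ℚ :* T) := T) ≈-refl T) (<⇒≤ 0<T)

      witness : Constraint d → ℝ^ (suc d)
      witness (link-at i k σ) = gadget-point i (chain-facet-point d k σ)
      witness (side-at e)     = side-point e
      witness base            = axis-point (- (2ℝ * T))

      witness-tight : ∀ c → slackness (witness c) c ≈ 0ℝ
      witness-tight (link-at i k σ) = own-tight k σ (chain-facet-point-tight d k σ)
        where open GadgetPoint i (chain-facet-point d k σ) (chain-facet-point-within d k σ)
      witness-tight (side-at e) = ≈-trans (+-congʳ (*-congˡ (+-congˡ (-‿cong (side-own e)))))
        (solve 2 (λ T D → T :* (D :- (D :+ con 1ℚ)) :- :- T := con 0ℚ) ≈-refl T D₂)
      witness-tight base = -‿inverseˡ (2ℝ * T)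

      witness-slack : ∀ c c′ → c ≢ c′ → 0ℝ < slackness (witness c) c′
      witness-slack (link-at i k σ) (link-at j k′ σ′) ne = own-or-other (i ≟ j)
        where
        open GadgetPoint i (chain-facet-point d k σ) (chain-facet-point-within d k σ)
        own-or-other : Dec (i ≡ j) → 0ℝ < slackness X (link-at j k′ σ′)
        own-or-other (yes refl) = own-slack k′ σ′ (chain-facet-point-slack d k σ k′ σ′ (λ { refl → ne refl }))
        own-or-other (no i≢j)   = other-slack j i≢j k′ σ′
      witness-slack (link-at i k σ) (side-at e) ne = side-slack e
        where open GadgetPoint i (chain-facet-point d k σ) (chain-facet-point-within d k σ)
      witness-slack (link-at i k σ) base ne = base-slack
        where open GadgetPoint i (chain-facet-point d k σ) (chain-facet-point-within d k σ)
      witness-slack (side-at e) (link-at j k σ) ne = far-slack (side-point e) ≤-refl (side-point-within e) j k σ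
      witness-slack (side-at e) (side-at f) ne = <-respʳ
        (solve 3 (λ T D s → T :* ((con 0ℚ :- s) :+ (D :+ con 1ℚ)) := T :* (D :- s) :- :- T) ≈-refl T D₂ (side f · side-point e))
        (0<* 0<T (0≤+< (≤-diff (side-other e f (λ { refl → ne refl }))) (0≤+< 0≤D₂ 0<1)))
      witness-slack (side-at e) base ne = <-respʳ (solve 1 (λ T → T := :- T :+ con 2ℚ :* T) ≈-refl T) 0<T
      witness-slack base (link-at j k σ) ne = far-slack (axis-point (- (2ℝ * T))) -2T≤-T (axis-within (- (2ℝ * T))) j k σ
      witness-slack base (side-at e) ne = axis-side-slack (- (2ℝ * T)) -2T≤-T e
      witness-slack base base ne = ⊥-elim (ne refl)

      axis-interior : ∀ c → 0ℝ < slackness (axis-point (- T)) c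
      axis-interior (link-at j k σ) = far-slack (axis-point (- T)) ≤-refl (axis-within (- T)) j k σ
      axis-interior (side-at e)     = axis-side-slack (- T) ≤-refl e
      axis-interior base            = <-respʳ (solve 1 (λ T → T := :- T :+ con 2ℚ :* T) ≈-refl T) 0<T

      module _ {N : ℕ} (index : Fin N ↔ Constraint d) where
        open Inverse index using (to; from; strictlyInverseˡ; strictlyInverseʳ)

        feasible-everywhere : ∀ X → (∀ j → normal (to j) · X ≤ bound (to j)) → Feasible X
        feasible-everywhere X h c = ≡.subst (λ c → normal c · X ≤ bound c) (strictlyInverseˡ c) (h (from c))

        polytope : Polytope (suc d)
        polytope = record
          { m       = N
          ; A       = λ j → normal (to j)
          ; b       = λ j → bound (to j)
          ; bounded = proj₁ box , λ X X∈P → proj₂ box X (feasible-everywhere X X∈P)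
          }
          where
          box : ∃ λ C → ∀ X → Feasible X → ∀ a → X a ≤ C × - X a ≤ C
          box = feasible-bounded 0<T 0≤D₂

        to-≢ : ∀ {i j} → i ≢ j → to j ≢ to i
        to-≢ {i} {j} ne e = ne (≡.sym (≡.trans (≡.sym (strictlyInverseʳ j)) (≡.trans (≡.cong from e) (strictlyInverseʳ i))))

        irredundant : Irredundant polytope
        irredundant = record
          { interior          = axis-point (- T)
          ; interior-slack    = λ j → strict (axis-point (- T)) (to j) (axis-interior (to j))
          ; facet-point       = λ j → witness (to j)
          ; facet-point-tight = λ j → tight (witness (to j)) (to j) (witness-tight (to j))
          ; facet-point-slack = λ {i} {j} ne → strict (witness (to j)) (to i) (witness-slack (to j) (to i) (to-≢ ne))
          }

-- Choice of the scales, and the parametric problem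

index : ∀ d → Fin ((2 ℕ.* d ℕ.+ 1) ℕ.* (d ℕ.+ 1) ℕ.+ 1) ↔ Constraint d
index d = (((*↔× ⊎-↔ ↔-id (Fin 1)) ×-↔ successor) ⊎-↔ ↔-id (Fin 1)) ↔-∘
          (((+↔⊎ ×-↔ ↔-id (Fin (d ℕ.+ 1))) ⊎-↔ ↔-id (Fin 1)) ↔-∘
          ((*↔× ⊎-↔ ↔-id (Fin 1)) ↔-∘ +↔⊎))
  where
  successor : Fin (d ℕ.+ 1) ↔ Fin (suc d)
  successor = ≡.subst (λ k → Fin (d ℕ.+ 1) ↔ Fin k) (ℕ.+-comm d 1) (↔-id (Fin (d ℕ.+ 1)))

funToFin-cong : ∀ {m k} {f g : Fin m → Fin k} → (∀ i → f i ≡ g i) → funToFin f ≡ funToFin g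
funToFin-cong {zero}  h = refl
funToFin-cong {suc m} h = ≡.cong₂ combine (h zero) (funToFin-cong (h ∘ suc))

finToFun-injective : ∀ {m k} {i j : Fin (k ^ m)} → (∀ l → finToFun {k} {m} i l ≡ finToFun j l) → i ≡ j
finToFun-injective {m} {k} {i} {j} h =
  ≡.trans (≡.sym (funToFin-finToFin {m} {k} i)) (≡.trans (funToFin-cong h) (funToFin-finToFin {m} {k} j))

module Assembly (em : ExcludedMiddle 0ℓ) (n : ℕ) where
  open Ordered em
  open Chain em
  open Gadget em n
  open LinearAlgebra em
  open Irredundancy em
  open Construction em n

  -- In `R` the first summand separates the gadgets and 4 Q makes every ρ exceed all targets, so
  -- that t stays in [0, 2 ρ]. `S` replaces each single ρ in the sizes of the simplex. In `T` the
  -- first group is the requirement `far` at `S`, the 1 makes it strict, and the last term serves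
  -- `T-large`.
  B Θ G R S D₂ E T : ℝ
  B  = sum {suc d} (λ _ → 1ℝ)
  Θ  = 8ℝ * (B * (Λ + L))
  G  = 2ℝ * (Θ * Q * W * (Ω + 1ℝ)) + 4ℝ * κ
  R  = (36ℝ * (Θ * Ω) + 32ℝ * L) + 4ℝ * Q

  ρ : Fin (suc d) → ℝ
  ρ i = pow R (suc (toℕ i))

  S  = sum ρ
  D₂ = B * (6ℝ * (G * S))
  E  = (D₂ + 1ℝ) + (D₂ + 1ℝ)
  T  = (3ℝ * (Θ * S * (Ω * E)) + 2ℝ * (L * (E + 2ℝ * (G * S))) + S * E) + (1ℝ + 2ℝ * (G * (S * S)))

  open Normals G Θ D₂ T ρ hiding (E)

  0<B : 0ℝ < B
  0<B = 0<+≤ 0<1 (sum-0≤ {d} (λ _ → 0≤1))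

  0≤B : 0ℝ ≤ B
  0≤B = <⇒≤ 0<B

  0<Θ : 0ℝ < Θ
  0<Θ = 0<* 0<8 (0<* 0<B (0≤+< 0≤Λ 0<L))

  0<G₁ : 0ℝ < 2ℝ * (Θ * Q * W * (Ω + 1ℝ))
  0<G₁ = 0<* 0<2 (0<* (0<* (0<* 0<Θ 0<Q) 0<W) (0≤+< 0≤Ω 0<1))

  0<G : 0ℝ < G
  0<G = 0<+≤ 0<G₁ (0≤* (<⇒≤ 0<4) 0≤κ)

  x≤x+y : ∀ x {y} → 0ℝ ≤ y → x ≤ x + y
  x≤x+y x {y} = ≤-via y (solve 2 (λ x y → (x :+ y) :- x := y) ≈-refl x y)

  y≤x+y : ∀ {x} y → 0ℝ ≤ x → y ≤ x + y
  y≤x+y {x} y = ≤-via x (solve 2 (λ x y → (x :+ y) :- y := x) ≈-refl x y)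

  separation : ℝ
  separation = 36ℝ * (Θ * Ω) + 32ℝ * L

  0≤separation : 0ℝ ≤ separation
  0≤separation = 0≤+ (0≤* (<⇒≤ 0<36) (0≤* (<⇒≤ 0<Θ) 0≤Ω)) (0≤* (<⇒≤ 0<32) (<⇒≤ 0<L))

  4Q≤R : 4ℝ * Q ≤ R
  4Q≤R = y≤x+y (4ℝ * Q) 0≤separation

  1≤R : 1ℝ ≤ R
  1≤R = ≤-trans (1≤pow 1≤4 (suc n)) 4Q≤R

  0≤R : 0ℝ ≤ R
  0≤R = ≤-trans 0≤1 1≤R

  1≤ρ : ∀ i → 1ℝ ≤ ρ i
  1≤ρ i = 1≤pow 1≤R (suc (toℕ i))

  0≤ρ : ∀ i → 0ℝ ≤ ρ i
  0≤ρ i = ≤-trans 0≤1 (1≤ρ i)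

  0<ρ : ∀ i → 0ℝ < ρ i
  0<ρ i = <-≤-trans 0<1 (1≤ρ i)

  4Q≤ρ : ∀ i → 4ℝ * Q ≤ ρ i
  4Q≤ρ i = ≤-trans 4Q≤R (≤-respˡ (*-identityʳ R) (*-monoˡ-≤ 0≤R (1≤pow 1≤R (toℕ i))))

  ρ≤S : ∀ i → ρ i ≤ S
  ρ≤S = term≤sum 0≤ρ

  0≤S : 0ℝ ≤ S
  0≤S = ≤-trans (0≤ρ zero) (ρ≤S zero)

  -- Already y² ≥ R x y dominates the left side; x² provides the strictness.
  separated-squares : ∀ {x y} → 0ℝ < x → 0ℝ ≤ y → R * x ≤ y → separation * (x * y) < x * x + y * y
  separated-squares {x} {y} 0<x 0≤y Rx≤y = <-via (x * x + (y * (y - R * x) + 4ℝ * Q * (x * y)))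
    (solve 4 (λ x y s q → (x :* x :+ y :* y) :- s :* (x :* y) := x :* x :+ (y :* (y :- (s :+ con 4ℚ :* q) :* x) :+ con 4ℚ :* q :* (x :* y))) ≈-refl x y separation Q)
    (0<+≤ (0<* 0<x 0<x) (0≤+ (0≤* 0≤y (≤-diff Rx≤y)) (0≤* (0≤* (<⇒≤ 0<4) (<⇒≤ 0<Q)) (0≤* (<⇒≤ 0<x) 0≤y))))

  ratio : ∀ {i j} → i ≢ j → separation * (ρ i * ρ j) < ρ i * ρ i + ρ j * ρ j
  ratio {i} {j} i≢j with ℕ.<-cmp (toℕ i) (toℕ j)
  ... | tri< lt _ _ = separated-squares (0<ρ i) (0≤ρ j) (*-monoˡ-≤ 0≤R (pow-mono 1≤R lt))
  ... | tri≈ _ eq _ = ⊥-elim (i≢j (toℕ-injective eq))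
  ... | tri> _ _ lt = <-respˡ (*-congˡ (*-comm (ρ j) (ρ i))) (<-respʳ (+-comm (ρ j * ρ j) (ρ i * ρ i))
    (separated-squares (0<ρ j) (0≤ρ i) (*-monoˡ-≤ 0≤R (pow-mono 1≤R lt))))

  0≤D₂ : 0ℝ ≤ D₂
  0≤D₂ = 0≤* 0≤B (0≤* (<⇒≤ 0<6) (0≤* (<⇒≤ 0<G) 0≤S))

  0≤E : 0ℝ ≤ E
  0≤E = 0≤+ (0≤+ 0≤D₂ 0≤1) (0≤+ 0≤D₂ 0≤1)

  0≤reach : 0ℝ ≤ 3ℝ * (Θ * S * (Ω * E)) + 2ℝ * (L * (E + 2ℝ * (G * S))) + S * E
  0≤reach = 0≤+ (0≤+ (0≤* (<⇒≤ 0<3) (0≤* (0≤* (<⇒≤ 0<Θ) 0≤S) (0≤* 0≤Ω 0≤E)))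
    (0≤* (<⇒≤ 0<2) (0≤* (<⇒≤ 0<L) (0≤+ 0≤E (0≤* (<⇒≤ 0<2) (0≤* (<⇒≤ 0<G) 0≤S)))))) (0≤* 0≤S 0≤E)

  0≤2GSS : 0ℝ ≤ 2ℝ * (G * (S * S))
  0≤2GSS = 0≤* (<⇒≤ 0<2) (0≤* (<⇒≤ 0<G) (0≤* 0≤S 0≤S))

  bounds : Bounds
  bounds = record
    { 0<Θ      = 0<Θ
    ; 0<G      = 0<G
    ; 0<T      = 0≤+< 0≤reach (0<+≤ 0<1 0≤2GSS)
    ; 1≤ρ      = 1≤ρ
    ; G-large  = x≤x+y (2ℝ * (Θ * Q * W * (Ω + 1ℝ))) (0≤* (<⇒≤ 0<4) 0≤κ)
    ; κ-small  = y≤x+y (4ℝ * κ) (<⇒≤ 0<G₁)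
    ; ratio    = ratio
    ; T-large  = λ i → ≤-trans (*-monoˡ-≤ (<⇒≤ 0<2) (*-monoˡ-≤ (<⇒≤ 0<G) (squares i)))
        (≤-trans (y≤x+y (2ℝ * (G * (S * S))) 0≤1) (y≤x+y (1ℝ + 2ℝ * (G * (S * S))) 0≤reach))
    ; D₂-large = λ i → *-monoˡ-≤ 0≤B (*-monoˡ-≤ (<⇒≤ 0<6) (*-monoˡ-≤ (<⇒≤ 0<G) (ρ≤S i)))
    ; far      = λ i → far-enough (ρ i) (≤-diff (ρ≤S i))
    }
    where
    squares : ∀ i → ρ i * ρ i ≤ S * S
    squares i = ≤-via ((S - ρ i) * (S + ρ i)) (solve 2 (λ s r → s :* s :- r :* r := (s :- r) :* (s :+ r)) ≈-refl S (ρ i))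
      (0≤* (≤-diff (ρ≤S i)) (0≤+ 0≤S (0≤ρ i)))
    far-enough : ∀ r → 0ℝ ≤ S - r → 3ℝ * (Θ * r * (Ω * E)) + 2ℝ * (L * (E + 2ℝ * (G * r))) + r * E < T
    far-enough r h = <-via (1ℝ + (2ℝ * (G * (S * S)) + (3ℝ * (Θ * Ω * E) + 4ℝ * (L * G) + E) * (S - r)))
      (solve 7 (λ Θ Ω E L G S r → (con 3ℚ :* (Θ :* S :* (Ω :* E)) :+ con 2ℚ :* (L :* (E :+ con 2ℚ :* (G :* S))) :+ S :* E :+ (con 1ℚ :+ con 2ℚ :* (G :* (S :* S))))
          :- (con 3ℚ :* (Θ :* r :* (Ω :* E)) :+ con 2ℚ :* (L :* (E :+ con 2ℚ :* (G :* r))) :+ r :* E)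
        := con 1ℚ :+ (con 2ℚ :* (G :* (S :* S)) :+ (con 3ℚ :* (Θ :* Ω :* E) :+ con 4ℚ :* (L :* G) :+ E) :* (S :- r))) ≈-refl Θ Ω E L G S r)
      (0<+≤ 0<1 (0≤+ 0≤2GSS (0≤* (0≤+ (0≤+ (0≤* (<⇒≤ 0<3) (0≤* (0≤* (<⇒≤ 0<Θ) 0≤Ω) 0≤E)) (0≤* (<⇒≤ 0<4) (0≤* (<⇒≤ 0<L) (<⇒≤ 0<G)))) 0≤E) h)))

  open WithBounds bounds using (gadget-point-feasible; polytope; irredundant; feasible-everywhere; 0<θ; 0<scale)

  P : Polytope (suc d)
  P = polytope (index d)

  maximum : ∀ {m} (f : ℝ^ (suc m)) → ∃ λ i → ∀ k → f k ≤ f i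
  maximum {zero}  f = zero , λ { zero → ≤-refl }
  maximum {suc m} f with maximum (f ∘ suc)
  ... | i , max with ≤-total (f zero) (f (suc i))
  ...   | inj₁ p = suc i , λ { zero → p ; (suc k) → max k }
  ...   | inj₂ p = zero , λ { zero → ≤-refl ; (suc k) → ≤-trans (max k) p }

  -- The solutions for one direction

  module _ (c : ℝ^ (suc d)) where

    -- Dual to x̂: pairing with a vector of sum zero depends on differences only.
    ĉ : ℝ^ (suc d)
    ĉ zero    = - sum (λ k → c (suc k))
    ĉ (suc k) = c (suc k)

    sum-ĉ : sum ĉ ≈ 0ℝ
    sum-ĉ = -‿inverseˡ (sum (λ k → c (suc k)))

    dot-ĉ : ∀ X r → c · X ≈ c zero * X zero + sum (λ a → ĉ a * (x̂ X a - r))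
    dot-ĉ X r = +-congˡ (≈-sym (begin
      sum (λ a → ĉ a * (x̂ X a - r)) ≈⟨ sum-cong-≋ (λ a → solve 3 (λ c x r → c :* (x :- r) := c :* x :+ c :* :- r) ≈-refl (ĉ a) (x̂ X a) r) ⟩
      sum (λ a → ĉ a * x̂ X a + ĉ a * - r) ≈⟨ ∑-distrib-+ (λ a → ĉ a * x̂ X a) (λ a → ĉ a * - r) ⟩
      sum (λ a → ĉ a * x̂ X a) + sum (λ a → ĉ a * - r) ≈⟨ +-cong (≈-trans (+-congʳ (zeroʳ (ĉ zero))) (+-identityˡ _))
           (≈-trans (≈-sym (*-distribʳ-sum (- r) ĉ)) (≈-trans (*-congʳ sum-ĉ) (zeroˡ (- r)))) ⟩
      sum (λ k → c (suc k) * X (suc k)) + 0ℝ ≈⟨ +-identityʳ _ ⟩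
      sum (λ k → c (suc k) * X (suc k)) ∎))

    module _ (i : Fin (suc d)) (i-max : ∀ k → ĉ k ≤ ĉ i) where

      -- Nonpositive entries with sum zero all vanish.
      maximum-positive : ¬ (∀ k → c (suc k) ≈ 0ℝ) → 0ℝ < ĉ i
      maximum-positive c≉0 γ≤0 = c≉0 λ k → ≤-antisym (ĉ≤0 (suc k)) (≮⇒≥ λ c<0 →
        0≤-neg⇒ (term≤sum {f = λ a → - ĉ a} (λ a → 0≤neg (ĉ≤0 a)) (suc k)) c<0)
        where
        ĉ≤0 : ∀ k → ĉ k ≤ 0ℝ
        ĉ≤0 k = ≤-trans (i-max k) γ≤0
        0≤neg : ∀ {x} → x ≤ 0ℝ → 0ℝ ≤ - x
        0≤neg {x} h = ≤-respʳ (+-identityˡ (- x)) (≤-diff h)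
        0≤-neg⇒ : ∀ {x} → - x ≤ sum (λ a → - ĉ a) → x < 0ℝ → ⊥
        0≤-neg⇒ {x} h lt = lt (≤-via (sum (λ a → - ĉ a) - - x)
          (≈-trans (solve 1 (λ x → x :- con 0ℚ := :- con 0ℚ :- :- x) ≈-refl x)
            (+-congʳ (≈-sym (≈-trans (sum-neg ĉ) (-‿cong sum-ĉ))))) (≤-diff h))

      -- Each gap ĉ i - ĉ k is at most the sum of all gaps, and that sum is B ĉ i because the
      -- entries of `ĉ` add up to zero.
      ĉ-within : 0ℝ < ĉ i → ∀ k → Within (B * ĉ i) (ĉ k)
      ĉ-within 0<γ k = within
        (≤-via (ĉ i + (sum (λ a → ĉ i - ĉ a) - (ĉ i - ĉ k)))
          (≈-trans (solve 3 (λ b g x → x :- :- (b :* g) := g :+ ((b :* g :- con 0ℚ) :- (g :- x))) ≈-refl B (ĉ i) (ĉ k))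
            (+-congˡ (+-congʳ (≈-sym gaps))))
          (0≤+ (<⇒≤ 0<γ) (≤-diff (term≤sum {f = λ a → ĉ i - ĉ a} (λ a → ≤-diff (i-max a)) k))))
        (≤-trans (i-max k) (≤-via (sum {d} (λ _ → 1ℝ) * ĉ i) (solve 2 (λ o g → (con 1ℚ :+ o) :* g :- g := o :* g) ≈-refl (sum {d} (λ _ → 1ℝ)) (ĉ i))
          (0≤* (sum-0≤ {d} (λ _ → 0≤1)) (<⇒≤ 0<γ))))
        where
        gaps : sum (λ a → ĉ i - ĉ a) ≈ B * ĉ i - 0ℝ
        gaps = ≈-trans (∑-distrib-+ {suc d} (λ _ → ĉ i) (λ a → - ĉ a))
          (+-cong (sum-const (suc d) (ĉ i)) (≈-trans (sum-neg ĉ) (-‿cong sum-ĉ)))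

      β : ℝ^ n
      β k = ĉ (other i k)

      -- Measuring `x̂` from its reference entry is free since `ĉ` has sum zero, and it removes the
      -- reference term.
      dot-gadget : ∀ X → c · X ≈ c zero * X zero + (ĉ i * xs i X + β · ys i X)
      dot-gadget X = ≈-trans (dot-ĉ X (x̂ X (reference i))) (+-congˡ
        (≈-trans (sum-remove {i = i} (λ a → ĉ a * (x̂ X a - x̂ X (reference i))))
          (+-congˡ (≈-trans (+-congʳ (≈-trans (*-congˡ (-‿inverseʳ (x̂ X (reference i)))) (zeroʳ (ĉ (reference i))))) (+-identityˡ _)))))

      module _ (0<γ : 0ℝ < ĉ i) (c₀≤0 : c zero ≤ 0ℝ) (b : Fin n → Fin 2) where

        -- With r = t/g the height coefficient 1 + r c₀ of the objective equals γ/g, so multiplying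
        -- by g produces the normalised form γ h + t (γ x + β · y). The sign condition c₀ ≤ 0 is
        -- what makes g positive.
        γ t g : ℝ
        γ = ĉ i
        t = ρ i + target n b
        g = γ - t * c zero

        private
          v = chain-vertex n b

        target-in : Within (ρ i) (target n b)
        target-in = within-mono (≤-trans (≤-via 4ℝ (solve 1 (λ q → con 4ℚ :* q :- (con 4ℚ :* q :- con 4ℚ) := con 4ℚ) ≈-refl Q) (<⇒≤ 0<4)) (4Q≤ρ i))
          (target-within n b)

        0≤t : 0ℝ ≤ t
        0≤t = ≤-respʳ (solve 2 (λ r t → t :- :- r := r :+ t) ≈-refl (ρ i) (target n b)) (≤-diff (lower target-in))

        t-within : Within (2ℝ * ρ i) t
        t-within = within-mono (≈⇒≤ (solve 1 (λ r → r :+ r := con 2ℚ :* r) ≈-refl (ρ i))) (within-+ (within-self (0≤ρ i)) target-in)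

        0<g : 0ℝ < g
        0<g = <-respʳ (solve 3 (λ g t c → g :+ t :* (con 0ℚ :- c) := g :- t :* c) ≈-refl γ t (c zero)) (0<+≤ 0<γ (0≤* 0≤t (≤-diff c₀≤0)))

        r : ℝ
        r = t * proj₁ (inverse (0<⇒≉0 0<g))

        gr≈t : g * r ≈ t
        gr≈t = ≈-trans (solve 3 (λ g t u → g :* (t :* u) := t :* (u :* g)) ≈-refl g t (proj₁ (inverse (0<⇒≉0 0<g))))
          (≈-trans (*-congˡ (proj₂ (inverse (0<⇒≉0 0<g)))) (*-identityʳ t))

        a : ℝ^ (suc d)
        a = height ⊕ r ∙ c

        value : ∀ X → g * (a · X) ≈ Γ.objective i γ β t (X zero) (xs i X) (ys i X)
        value X = begin
          g * (a · X) ≈⟨ *-congˡ (≈-trans (dot-⊕ˡ height (r ∙ c) X) (+-cong (unit-dot zero X) (≈-trans (dot-∙ˡ r c X) (*-congˡ (dot-gadget X))))) ⟩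
          g * (X zero + r * (c zero * X zero + F)) ≈⟨ solve 5 (λ g h r c F → g :* (h :+ r :* (c :* h :+ F)) := g :* h :+ g :* r :* (c :* h :+ F)) ≈-refl g (X zero) r (c zero) F ⟩
          g * X zero + g * r * (c zero * X zero + F) ≈⟨ +-congˡ (*-congʳ gr≈t) ⟩
          g * X zero + t * (c zero * X zero + F) ≈⟨ solve 5 (λ γ t c h F → (γ :- t :* c) :* h :+ t :* (c :* h :+ F) := γ :* h :+ t :* F) ≈-refl γ t (c zero) (X zero) F ⟩
          γ * X zero + t * F ∎
          where F = γ * xs i X + β · ys i X

        V : ℝ^ (suc d)
        V = gadget-point i v

        v-within : ∀ j → Within W (v j)
        v-within j = within-mono (1≤pow 1≤2 d) (chain-vertex-within n b j)

        h x : ℝ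
        h = Γ.point-h i v
        x = Γ.point-x i v

        y : ℝ^ n
        y = Γ.point-y i v

        V-feasible : Feasible V
        V-feasible = gadget-point-feasible i v v-within (chain-vertex-link n b)

        V∈P : V ∈ Points P
        V∈P j = V-feasible (Inverse.to (index d) j)

        value-V : g * (a · V) ≈ Γ.objective i γ β t h x y
        value-V = ≈-trans (value V) (+-congˡ (*-congˡ (+-cong (*-congˡ (xs-gadget h i x y)) (dot-congʳ β (ys-gadget h i x y)))))

        links : ∀ X → X ∈ Points P → ∀ k σ → link (Û i X) k σ ≤ Γ.scale i
        links X X∈P k σ = diff-≤ (slack-holds X (link-at i k σ) (feasible-everywhere (index d) X X∈P (link-at i k σ)))

        optimal : ∀ X → X ∈ Points P →
          Γ.objective i γ β t (X zero) (xs i X) (ys i X) ≤ Γ.objective i γ β t h x y ×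
          (Γ.objective i γ β t h x y ≤ Γ.objective i γ β t (X zero) (xs i X) (ys i X) → ∀ j → Û i X j ≈ Γ.scale i * v j)
        optimal X X∈P = Γ.vertex-optimal i β b 0<γ (0<ρ i) 0<Θ 0≤B (λ k → ĉ-within 0<γ (other i k)) t-within ≤-refl
          (X zero) (xs i X) (ys i X) (links X X∈P)

        V∈Face : V ∈ Face P a
        V∈Face = V∈P , λ X X∈P → *-cancelˡ-≤ 0<g (≤-respˡ (≈-sym (value X)) (≤-respʳ (≈-sym value-V) (proj₁ (optimal X X∈P))))

        V-unique : ∀ X → X ∈ Face P a → X ≋ V
        V-unique X (X∈P , X-max) =
          let U≈ = proj₂ (optimal X X∈P) (≤-respˡ value-V (≤-respʳ (value X) (*-monoˡ-≤ (<⇒≤ 0<g) (X-max V V∈P))))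
              h≈ , x≈ , y≈ = Γ.U-injective i (0<θ i) (X zero) (xs i X) (ys i X) (V zero) (xs i V) (ys i V)
                (λ j → ≈-trans (U≈ j) (≈-sym (Û-gadget-point i v j)))
          in coordinates-determine i X V h≈ x≈ y≈

        -- One functional on the line both exposes V as a vertex and lies in its normal cone.
        solution : IsSolution P height c V
        solution = (a , V∈Face , V-unique) , r , V∈Face

      gadget-vertex-injective : ∀ b b′ → gadget-point i (chain-vertex n b) ≋ gadget-point i (chain-vertex n b′) → ∀ k → b k ≡ b′ k
      gadget-vertex-injective b b′ e = chain-vertex-injective n b b′ λ j → *-cancelˡ (0<⇒≉0 (0<scale i))
        (≈-trans (≈-sym (Û-gadget-point i (chain-vertex n b) j)) (≈-trans
          (Γ.U-cong i (e zero) (+-cong (x̂-cong i) (-‿cong (x̂-cong (reference i)))) (λ k → +-cong (x̂-cong (other i k)) (-‿cong (x̂-cong (reference i)))) j)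
          (Û-gadget-point i (chain-vertex n b′) j)))
        where
        x̂-cong : ∀ a → x̂ (gadget-point i (chain-vertex n b)) a ≈ x̂ (gadget-point i (chain-vertex n b′)) a
        x̂-cong zero    = ≈-refl
        x̂-cong (suc k) = e (suc k)

  height≉𝟎 : ¬ (height ≋ 𝟎)
  height≉𝟎 h = 0<⇒≉0 0<1 (h zero)

  Face-resp : ∀ {a a′} X → a ≋ a′ → X ∈ Face P a → X ∈ Face P a′
  Face-resp {a} {a′} X e (X∈P , max) = X∈P , λ Y Y∈P → ≤-respˡ (cong-at Y) (≤-respʳ (cong-at X) (max Y Y∈P))
    where
    cong-at : ∀ Y → a · Y ≈ a′ · Y
    cong-at Y = dot-cong {a = a} {b = a′} {x = Y} {y = Y} e (λ _ → ≈-refl)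

  -- Objectives on the line through `height` along s c also lie on the line along c; the vertex
  -- stays the same.
  solution-scaled : ∀ s c X → IsSolution P height (s ∙ c) X → IsSolution P height c X
  solution-scaled s c X (vertex , r , X∈F) = vertex , r * s ,
    Face-resp {height ⊕ r ∙ (s ∙ c)} {height ⊕ (r * s) ∙ c} X (λ i → +-congˡ (≈-sym (*-assoc r s (c i)))) X∈F

  solutions-scaled : ∀ s c {N} → HasAtLeast (Solutions P height (s ∙ c)) N → HasAtLeast (Solutions P height c) N
  solutions-scaled s c inj = record
    { to        = λ j → proj₁ (Injection.to inj j) , solution-scaled s c (proj₁ (Injection.to inj j)) (proj₂ (Injection.to inj j))
    ; cong      = Injection.cong inj
    ; injective = Injection.injective inj
    }

  many-solutions-nonpositive : ∀ c → c zero ≤ 0ℝ → ¬ (∀ k → c (suc k) ≈ 0ℝ) → HasAtLeast (Solutions P height c) (2 ^ n)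
  many-solutions-nonpositive c c₀≤0 c≉0 = at (maximum (ĉ c))
    where
    at : (∃ λ i → ∀ k → ĉ c k ≤ ĉ c i) → HasAtLeast (Solutions P height c) (2 ^ n)
    at (i , i-max) = record
      { to        = λ j → gadget-point i (chain-vertex n (finToFun j)) ,
                          solution c i i-max (maximum-positive c i i-max c≉0) c₀≤0 (finToFun j)
      ; cong      = λ { refl → λ _ → ≈-refl }
      ; injective = λ {j} {k} e → finToFun-injective {n} {2} (gadget-vertex-injective c i i-max (finToFun j) (finToFun k) e)
      }

  -- A direction without horizontal part satisfies -c₀ w + c = 0, against independence.
  not-vertical : ∀ c → LinearlyIndependent (height ∷ c ∷ []) → ¬ (∀ k → c (suc k) ≈ 0ℝ)
  not-vertical c indep c≈0 = 0<⇒≉0 0<1 (indep ((- c zero) ∷ 1ℝ ∷ []) vanish (suc zero))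
    where
    vanish : combination ((- c zero) ∷ 1ℝ ∷ []) (height ∷ c ∷ []) ≋ 𝟎
    vanish zero    = solve 1 (λ c → :- c :* con 1ℚ :+ (con 1ℚ :* c :+ con 0ℚ) := con 0ℚ) ≈-refl (c zero)
    vanish (suc k) = ≈-trans (+-congˡ (+-congʳ (*-congˡ (c≈0 k))))
      (solve 1 (λ c → :- c :* con 0ℚ :+ (con 1ℚ :* con 0ℚ :+ con 0ℚ) := con 0ℚ) ≈-refl (c zero))

  many-solutions : ∀ c → LinearlyIndependent (height ∷ c ∷ []) → HasAtLeast (Solutions P height c) (2 ^ n)
  many-solutions c indep = by-sign (≤-total (c zero) 0ℝ)
    where
    by-sign : c zero ≤ 0ℝ ⊎ 0ℝ ≤ c zero → HasAtLeast (Solutions P height c) (2 ^ n)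
    by-sign (inj₁ c₀≤0) = many-solutions-nonpositive c c₀≤0 (not-vertical c indep)
    by-sign (inj₂ 0≤c₀) = solutions-scaled (- 1ℝ) c (many-solutions-nonpositive (- 1ℝ ∙ c)
      (≤-via (c zero) (solve 1 (λ c → con 0ℚ :- :- con 1ℚ :* c := c) ≈-refl (c zero)) 0≤c₀)
      λ h → not-vertical c indep λ k → ≈-trans (solve 1 (λ c → c := :- con 1ℚ :* (:- con 1ℚ :* c)) ≈-refl (c (suc k)))
        (≈-trans (*-congˡ (h k)) (zeroʳ (- 1ℝ))))

corollary1p5 : ExcludedMiddle 0ℓ → (d : ℕ) → 3 ℕ.≤ d →
    Σ (Polytope (suc d)) λ P → Σ (ℝ^ (suc d)) λ w →
    HasDimension (Points P) (suc d) ×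
    HasCardinality (Facets P) ((2 ℕ.* d ℕ.+ 1) ℕ.* (d ℕ.+ 1) ℕ.+ 1) ×
    ¬ (w ≋ 𝟎) ×
    ((c : ℝ^ (suc d)) → LinearlyIndependent (w ∷ c ∷ []) →
    HasAtLeast (Solutions P w c) (2 ^ (d ∸ 1)))
corollary1p5 em (suc n) (s≤s _) = P , height , full-dimensional irr , facets irr , height≉𝟎 , many-solutions
  where
  open Irredundancy em
  open Construction em n using (height)
  open Assembly em n
  irr : Irredundant P
  irr = WithBounds.irredundant bounds (index (suc n))
    where open Construction.Normals em n G Θ D₂ T ρ
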